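{- Let $\varphi_j=\frac1{j!}$ for even $j\ge0$ and $\varphi_j=0$ for odd $j$ (so $\sum_j\varphi_jt^j=\cosh t$). For $n\ge1$ let $T_n=\sum_{T\in\mathcal{O}(n)}\big(\prod_{v\in T}\varphi_{\mathrm{outdeg}(v)}\big)\ell(T)$ be the number of unordered even-degree bilabelled increasing trees with $2n$ labels, where $\ell(T)$ is the number of increasing bilabellings of $T$ with label set $\{1,\dots,2n\}$, and let $T(z)=\sum_{n\ge1}T_n\frac{z^{2n}}{(2n)!}$. Then \[T'(z)=(1-i)\,\mathrm{sl}\Big(\frac{(1+i)z}{2}\Big),\qquad T_n=\Big(\frac i2\Big)^{n-1}S_{2n-1}\quad(n\ge1),\] and \[T_{n+2}=\frac12\sum_{j+k+\ell=n-1}\binom{2n+1}{2j+1,\,2k+1,\,2\ell+1}T_{j+1}T_{k+1}T_{\ell+1}\quad(n\ge0),\qquad T_1=1.\]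
   Context: $\mathcal{O}(n)$ is the set of ordered (planted plane) rooted trees with $n$ nodes; $\mathrm{outdeg}(v)$ is the number of children of $v$. An increasing bilabelling of a tree with $n$ nodes assigns to each node a set of exactly two integers from $\{1,\dots,2n\}$, these sets partitioning $\{1,\dots,2n\}$, such that every label of a child is larger than both labels of its parent. The lemniscate sine $\mathrm{sl}(z)$ is the inverse of $s\mapsto\int_0^s\frac{dt}{\sqrt{1-t^4}}$, with Taylor expansion $\mathrm{sl}(z)=\sum_{n\ge1}S_n\frac{z^n}{n!}$. -}

module Defs where

open import Data.Nat as ℕ using (ℕ; zero; suc; _∸_; _!; _≡ᵇ_; _<ᵇ_)
open import Data.Nat.Properties using (_!≢0)
open import Data.Nat.Combinatorics using (_C_)
open import Data.Integer using (+_)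
open import Data.Rational using (ℚ; 0ℚ; 1ℚ; _+_; _*_; -_) renaming (_/_ to _//_)
open import Data.Bool using (Bool; true; false; _∧_; not; if_then_else_)
open import Data.List as List using (List; []; _∷_; _++_; map; concatMap; upTo; length; filter; foldr)
open import Data.Product using (_×_; _,_)
open import Relation.Binary.PropositionalEquality using (_≡_)

fromℕ : ℕ → ℚ
fromℕ n = + n // 1

inv! : ℕ → ℚ
inv! n = (+ 1 // (n !)) {{n !≢0}}

Σ< : ℕ → (ℕ → ℚ) → ℚ
Σ< n f = foldr (λ i acc → f i + acc) 0ℚ (upTo n)

Π : List ℚ → ℚ
Π = foldr _*_ 1ℚ

_^ℚ_ : ℚ → ℕ → ℚ
q ^ℚ zero = 1ℚ
q ^ℚ suc n = q * (q ^ℚ n)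

data Tree : Set where
  node : List Tree → Tree

mutual
  size : Tree → ℕ
  size (node ts) = suc (sizeF ts)

  sizeF : List Tree → ℕ
  sizeF [] = 0
  sizeF (t ∷ ts) = size t ℕ.+ sizeF ts

-- forestsF fuel n : all forests (ordered lists of trees) with n nodes in
-- total; fuel (suc n) suffices.  The first tree has k+1 nodes, 0 ≤ k ≤ n-1.
forestsF : ℕ → ℕ → List (List Tree)
forestsF zero _ = []
forestsF (suc fuel) zero = [] ∷ []
forestsF (suc fuel) (suc n) =
  concatMap (λ k →
    concatMap (λ t → map (t ∷_) (forestsF fuel (n ∸ k)))
              (map node (forestsF fuel k)))
    (upTo (suc n))

𝒪 : ℕ → List Tree
𝒪 zero = []
𝒪 (suc m) = map node (forestsF (suc m) m)

-- Nodes numbered 0..n-1 in preorder; out-degrees and parent/child edges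

mutual
  outdegs : Tree → List ℕ
  outdegs (node ts) = length ts ∷ outdegsF ts

  outdegsF : List Tree → List ℕ
  outdegsF [] = []
  outdegsF (t ∷ ts) = outdegs t ++ outdegsF ts

mutual
  -- edges o t : (parent , child) pairs of t when its root has index o
  edges : ℕ → Tree → List (ℕ × ℕ)
  edges o (node ts) = edgesF o (suc o) ts

  -- edgesF p c ts : children ts of node p, the first one having index c
  edgesF : ℕ → ℕ → List Tree → List (ℕ × ℕ)
  edgesF p c [] = []
  edgesF p c (t ∷ ts) = (p , c) ∷ (edges c t ++ edgesF p (c ℕ.+ size t) ts)

-- Increasing bilabellings.
-- A bilabelling of a tree with n nodes is encoded by the map g sending
-- each label (position a = 0..2n-1 of the list, standing for label a+1)
-- to the node carrying it; the label sets partition {1..2n} and each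
-- node gets exactly two labels iff every node index appears exactly
-- twice in g.

allMaps : ℕ → ℕ → List (List ℕ)
allMaps zero n = [] ∷ []
allMaps (suc len) n = concatMap (λ x → map (x ∷_) (allMaps len n)) (upTo n)

count : ℕ → List ℕ → ℕ
count x [] = 0
count x (y ∷ ys) = (if x ≡ᵇ y then 1 else 0) ℕ.+ count x ys

allB : {A : Set} → (A → Bool) → List A → Bool
allB p = foldr (λ x b → p x ∧ b) true

labelsOf : ℕ → List ℕ → List ℕ
labelsOf v g = go 0 g
  where
  go : ℕ → List ℕ → List ℕ
  go a [] = []
  go a (x ∷ xs) = if v ≡ᵇ x then a ∷ go (suc a) xs else go (suc a) xs

isIncreasingBilabelling : Tree → List ℕ → Bool
isIncreasingBilabelling t g =
  allB (λ v → count v g ≡ᵇ 2) (upTo (size t)) ∧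
  allB (λ { (p , c) → allB (λ a → allB (λ b → a <ᵇ b) (labelsOf c g)) (labelsOf p g) })
       (edges 0 t)

countB : {A : Set} → (A → Bool) → List A → ℕ
countB p [] = 0
countB p (x ∷ xs) = (if p x then 1 else 0) ℕ.+ countB p xs

ℓ : Tree → ℕ
ℓ t = countB (isIncreasingBilabelling t) (allMaps (2 ℕ.* size t) (size t))

isEven : ℕ → Bool
isEven zero = true
isEven (suc n) = not (isEven n)

φ : ℕ → ℚ
φ j = if isEven j then inv! j else 0ℚ

Tn : ℕ → ℚ
Tn n = foldr (λ t acc → (Π (map φ (outdegs t)) * fromℕ (ℓ t)) + acc) 0ℚ (𝒪 n)

record ℚi : Set where
  constructor _+i_
  field
    re : ℚ
    im : ℚ
open ℚi public

_*i_ : ℚi → ℚi → ℚi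
(a +i b) *i (c +i d) = ((a * c) + (- (b * d))) +i ((a * d) + (b * c))

_^i_ : ℚi → ℕ → ℚi
z ^i zero = 1ℚ +i 0ℚ
z ^i suc n = z *i (z ^i n)

ofℚ : ℚ → ℚi
ofℚ q = q +i 0ℚ

Series : Set
Series = ℕ → ℚ

_⊛_ : Series → Series → Series
(a ⊛ b) m = Σ< (suc m) (λ i → a i * b (m ∸ i))

pow : Series → ℕ → Series
pow a zero m = if m ≡ᵇ 0 then 1ℚ else 0ℚ
pow a (suc p) = a ⊛ pow a p

-- ∫_0^s dt / √(1-t⁴) = Σ_k binom(2k,k)/(4^k (4k+1)) s^{4k+1},
-- from (1-u)^{-1/2} = Σ_k binom(2k,k)/4^k u^k.
arcslCoeff : ℕ → ℚ
arcslCoeff k = (+ ((2 ℕ.* k) C k) // ((4 ℕ.^ k) ℕ.* suc (4 ℕ.* k))) {{nz k}}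
  where
  open import Data.Nat.Properties using (m*n≢0; m^n≢0)
  nz : ∀ k → ℕ.NonZero ((4 ℕ.^ k) ℕ.* suc (4 ℕ.* k))
  nz k = m*n≢0 (4 ℕ.^ k) (suc (4 ℕ.* k)) {{m^n≢0 4 k}}

-- coefficient m of (arcsl ∘ a) for a series a with a 0 = 0
-- (terms with 4k+1 > m vanish since a has zero constant term)
arcsl∘ : Series → Series
arcsl∘ a m = Σ< (suc m) (λ k → arcslCoeff k * pow a (4 ℕ.* k ℕ.+ 1) m)

-- a is the Taylor coefficient sequence (a m = [z^m] sl(z)) of the
-- lemniscate sine: the compositional inverse of arcsl, sl(0) = 0.
IsSl : Series → Set
IsSl a = (a 0 ≡ 0ℚ) × (∀ m → arcsl∘ a m ≡ (if m ≡ᵇ 1 then 1ℚ else 0ℚ))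

Sn : Series → ℕ → ℚ
Sn a m = fromℕ (m !) * a m

triples : ℕ → List (ℕ × ℕ × ℕ)
triples zero = []
triples (suc m) =
  concatMap (λ j → map (λ k → (j , k , m ∸ j ∸ k)) (upTo (suc (m ∸ j)))) (upTo (suc m))

multinom : ℕ → ℕ → ℕ → ℕ → ℚ
multinom n j k l = fromℕ ((2 ℕ.* n ℕ.+ 1) !) * inv! (2 ℕ.* j ℕ.+ 1)
                   * inv! (2 ℕ.* k ℕ.+ 1) * inv! (2 ℕ.* l ℕ.+ 1)

sumL : List ℚ → ℚ
sumL = foldr _+_ 0ℚ

-- T(z) = Σ_{n≥1} T_n z^{2n}/(2n)!;  [z^m] T'(z)
T′coeff : Series
T′coeff m = if isEven m then 0ℚ else Tn (suc (m ℕ./ 2)) * inv! m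

-- [z^m] of (1-i) sl((1+i)z/2), given the coefficients a of sl
rhsCoeff : Series → ℕ → ℚi
rhsCoeff a m = (1ℚ +i (- 1ℚ)) *i ((((+ 1 // 2) +i (+ 1 // 2)) ^i m) *i ofℚ (a m))

sumTriples : ℕ → (ℕ → ℕ → ℕ → ℚ) → ℚ
sumTriples n f = sumL (map (λ { (j , k , l) → f j k l }) (triples n))

{-# OPTIONS --safe #-}
-- Reading an increasing bilabelling label by label, each label goes to a node
-- that is currently a root of what remains of the tree.  Summing over that root
-- gives a hook length formula: ℓ(T) times the product over all nodes v of
-- 2h(2h-1), where h is the size of the subtree at v, equals (2n)!.  Hence the
-- weights of trees are multiplicative and T'' = cosh T.  Multiplying by T' gives
-- T'² = 2 sinh T, and differentiating T'' = cosh T gives T''' = T'³/2, which is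
-- the stated recurrence.  On the other side arcsl(sl z) = z gives
-- sl'² = 1 - sl⁴, so sl'' = -2 sl³.  With c = 1-i and w = (1+i)/2 the series
-- c·sl(wz) satisfies the same equation Y'' = Y³/2 as T', with the same initial
-- values, so the two coincide.
module Submission where

-- Once some labels have been read, what remains is no longer a tree but a forest whose roots may
-- have one label used. The hook formula is therefore proved for lists of `Item`s; the factors 2h
-- and 2h-1 of a node are the numbers of labels left in its subtree before and after its own first
-- label. Counts are multiplied by hook products and equated with factorials, so nothing is divided.
--
-- T is even, so T(z) = τ(z²) and T'(z) = z t(z²). The tree equations live in u = z², where no
-- parity cases arise; the variable z returns only for the comparison with sl.
--
-- Series are never inverted or integrated: equalities come from `D-injective`, and sl' is cancelled
-- by multiplying with F = (1 - sl⁴)^(-1/2), for which F sl' = 1. All series stay rational; complex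
-- numbers enter only as one scalar c w^m per coefficient. What is asked of c and w is c w = 1, for
-- the initial values, and c² = -4 w², which turns sl'' = -2 sl³ into Y'' = Y³/2.

open import Defs

-- Hook length formula for increasing bilabellings

module HookLength where

  open import Data.Nat using (ℕ; zero; suc; _+_; _*_; _≤_; _<_; z≤n; s≤s; _!; _≡ᵇ_; _<ᵇ_)
  open import Data.Nat.Properties
  open import Data.Nat.Solver using (module +-*-Solver)
  open +-*-Solver using (solve; _:+_; _:*_; _:=_; con)
  open import Data.Bool using (Bool; true; false; T; if_then_else_)
  open import Data.Bool.Properties using (T-∧)
  open import Data.List using (List; []; _∷_; _++_; map; concatMap; upTo; applyUpTo)
  open import Data.List.Membership.Propositional using (_∈_)
  open import Data.List.Membership.Propositional.Properties using (∈-++⁺ˡ; ∈-++⁺ʳ; ∈-++⁻)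
  open import Data.List.Relation.Unary.Any using (Any; here; there)
  open import Data.List.Relation.Unary.Any.Properties using (++⁺ˡ; ++⁺ʳ)
  open import Data.Product using (_×_; _,_; proj₁; proj₂; ∃; ∃₂)
  open import Data.Sum using (_⊎_; inj₁; inj₂)
  open import Data.Unit using (⊤; tt)
  open import Data.Empty using (⊥-elim)
  open import Function using (_∘_; Equivalence)
  open import Relation.Nullary using (¬_; yes; no; contradiction)
  open import Relation.Binary.PropositionalEquality

  -- The summand of `count`, named so that `count v (x ∷ xs)` unfolds to `δ v x + count v xs` and
  -- occurrences can be added linearly.
  δ : ℕ → ℕ → ℕ
  δ x y = if x ≡ᵇ y then 1 else 0

  δ-refl : ∀ x → δ x x ≡ 1
  δ-refl zero = refl
  δ-refl (suc x) = δ-refl x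

  δ-positive : ∀ x y → 0 < δ x y → x ≡ y
  δ-positive x y h with x ≡ᵇ y in eq
  ... | true = ≡ᵇ⇒≡ x y (subst T (sym eq) tt)

  -- The block of preorder indices taken up by `s` nodes starting at `o`; unlike `upTo` it carries
  -- its offset, so blocks of subtrees can be concatenated.
  range : ℕ → ℕ → List ℕ
  range o zero = []
  range o (suc s) = o ∷ range (suc o) s

  range-++ : ∀ o s t → range o (s + t) ≡ range o s ++ range (o + s) t
  range-++ o zero t rewrite +-identityʳ o = refl
  range-++ o (suc s) t rewrite +-suc o s = cong (o ∷_) (range-++ (suc o) s t)

  applyUpTo-range : ∀ (f : ℕ → ℕ) o n → (∀ i → f i ≡ o + i) → applyUpTo f n ≡ range o n
  applyUpTo-range f o zero h = refl
  applyUpTo-range f o (suc n) h =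
    cong₂ _∷_ (trans (h 0) (+-identityʳ o))
              (applyUpTo-range (f ∘ suc) (suc o) n (λ i → trans (h (suc i)) (+-suc o i)))

  upTo-range : ∀ n → upTo n ≡ range 0 n
  upTo-range n = applyUpTo-range _ 0 n (λ i → refl)

  ∈-range⁻ : ∀ {v} o s → v ∈ range o s → o ≤ v × v < o + s
  ∈-range⁻ o (suc s) (here refl) = ≤-refl , m<m+n o (s≤s z≤n)
  ∈-range⁻ {v} o (suc s) (there h) with ∈-range⁻ (suc o) s h
  ... | l , u = <⇒≤ l , subst (v <_) (sym (+-suc o s)) u

  ∈-range⁺ : ∀ {v} o s → o ≤ v → v < o + s → v ∈ range o s
  ∈-range⁺ {v} o zero l u = contradiction (subst (v <_) (+-identityʳ o) u) (≤⇒≯ l)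
  ∈-range⁺ {v} o (suc s) l u with o ≟ v
  ... | yes refl = here refl
  ... | no o≢v = there (∈-range⁺ (suc o) s (≤∧≢⇒< l o≢v) (subst (v <_) (+-suc o s) u))

  count-++ : ∀ v xs ys → count v (xs ++ ys) ≡ count v xs + count v ys
  count-++ v [] ys = refl
  count-++ v (x ∷ xs) ys = trans (cong (δ v x +_) (count-++ v xs ys)) (sym (+-assoc (δ v x) _ _))

  count-range-+ : ∀ v o s t → count v (range o (s + t)) ≡ count v (range o s) + count v (range (o + s) t)
  count-range-+ v o s t = trans (cong (count v) (range-++ o s t)) (count-++ v (range o s) _)

  ∈⇒0<count : ∀ {v xs} → v ∈ xs → 0 < count v xs
  ∈⇒0<count {v} (here refl) rewrite δ-refl v = s≤s z≤n
  ∈⇒0<count {v} {x ∷ xs} (there h) = ≤-trans (∈⇒0<count h) (m≤n+m _ (δ v x))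

  0<+ : ∀ m {n} → 0 < m + n → 0 < m ⊎ 0 < n
  0<+ zero h = inj₂ h
  0<+ (suc m) h = inj₁ (s≤s z≤n)

  0<count⇒∈ : ∀ {v} xs → 0 < count v xs → v ∈ xs
  0<count⇒∈ {v} (x ∷ xs) h with 0<+ (δ v x) h
  ... | inj₁ p = here (δ-positive v x p)
  ... | inj₂ p = there (0<count⇒∈ xs p)

  count-range-≤1 : ∀ v o s → count v (range o s) ≤ 1
  count-range-≤1 v o zero = z≤n
  count-range-≤1 v o (suc s) with count v (range (suc o) s) in eq
  ... | zero = subst (_≤ 1) (sym (+-identityʳ (δ v o))) δ≤1
    where
    δ≤1 : δ v o ≤ 1
    δ≤1 with v ≡ᵇ o
    ... | true = ≤-refl
    ... | false = z≤n
  ... | suc k with δ v o in eq′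
  ...   | zero = subst (_≤ 1) eq (count-range-≤1 v (suc o) s)
  ...   | suc _ with δ-positive v o (subst (0 <_) (sym eq′) (s≤s z≤n))
  ...     | refl = contradiction (proj₁ (∈-range⁻ (suc o) s (0<count⇒∈ _ (subst (0 <_) (sym eq) (s≤s z≤n))))) 1+n≰n

  count-range-∈ : ∀ {v} n → v < n → count v (range 0 n) ≡ 1
  count-range-∈ {v} n v<n = ≤-antisym (count-range-≤1 v 0 n) (∈⇒0<count (∈-range⁺ 0 n z≤n v<n))

  sumBy : {A : Set} → (A → ℕ) → List A → ℕ
  sumBy f [] = 0
  sumBy f (x ∷ xs) = f x + sumBy f xs

  module _ {A : Set} where

    sumBy-++ : ∀ (f : A → ℕ) xs ys → sumBy f (xs ++ ys) ≡ sumBy f xs + sumBy f ys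
    sumBy-++ f [] ys = refl
    sumBy-++ f (x ∷ xs) ys = trans (cong (f x +_) (sumBy-++ f xs ys)) (sym (+-assoc (f x) _ _))

    sumBy-cong : ∀ {f g : A → ℕ} xs → (∀ x → x ∈ xs → f x ≡ g x) → sumBy f xs ≡ sumBy g xs
    sumBy-cong [] h = refl
    sumBy-cong (x ∷ xs) h = cong₂ _+_ (h x (here refl)) (sumBy-cong xs (λ y m → h y (there m)))

    sumBy-zero : ∀ (xs : List A) → sumBy (λ _ → 0) xs ≡ 0
    sumBy-zero [] = refl
    sumBy-zero (x ∷ xs) = sumBy-zero xs

    sumBy-+ : ∀ (f g : A → ℕ) xs → sumBy (λ x → f x + g x) xs ≡ sumBy f xs + sumBy g xs
    sumBy-+ f g [] = refl
    sumBy-+ f g (x ∷ xs) rewrite sumBy-+ f g xs =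
      solve 4 (λ a b c d → (a :+ b) :+ (c :+ d) := (a :+ c) :+ (b :+ d)) refl (f x) (g x) (sumBy f xs) (sumBy g xs)

    sumBy-*ʳ : ∀ (f : A → ℕ) k xs → sumBy (λ x → f x * k) xs ≡ sumBy f xs * k
    sumBy-*ʳ f k [] = refl
    sumBy-*ʳ f k (x ∷ xs) rewrite sumBy-*ʳ f k xs = sym (*-distribʳ-+ k (f x) _)

    0<sumBy⇒Any : ∀ (f : A → ℕ) xs → 0 < sumBy f xs → Any (λ x → 0 < f x) xs
    0<sumBy⇒Any f (x ∷ xs) h with 0<+ (f x) h
    ... | inj₁ p = here p
    ... | inj₂ p = there (0<sumBy⇒Any f xs p)

    Any⇒0<sumBy : ∀ (f : A → ℕ) {xs} → Any (λ x → 0 < f x) xs → 0 < sumBy f xs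
    Any⇒0<sumBy f {x ∷ xs} (here p) = ≤-trans p (m≤m+n (f x) _)
    Any⇒0<sumBy f {x ∷ xs} (there p) = ≤-trans (Any⇒0<sumBy f p) (m≤n+m _ (f x))

  sumBy-swap : {A B : Set} (f : A → B → ℕ) (xs : List A) (ys : List B) →
    sumBy (λ x → sumBy (f x) ys) xs ≡ sumBy (λ y → sumBy (λ x → f x y) xs) ys
  sumBy-swap f [] ys = sym (sumBy-zero ys)
  sumBy-swap f (x ∷ xs) ys =
    trans (cong (sumBy (f x) ys +_) (sumBy-swap f xs ys)) (sym (sumBy-+ (f x) _ ys))

  sumBy-δ : ∀ y xs → sumBy (λ x → δ x y) xs ≡ count y xs
  sumBy-δ y [] = refl
  sumBy-δ y (x ∷ xs) = cong₂ _+_ (δ-sym x y) (sumBy-δ y xs)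
    where
    δ-sym : ∀ x y → δ x y ≡ δ y x
    δ-sym zero zero = refl
    δ-sym zero (suc y) = refl
    δ-sym (suc x) zero = refl
    δ-sym (suc x) (suc y) = δ-sym x y

  mutual
    hook : Tree → ℕ
    hook (node ts) = (2 + 2 * sizeF ts) * ((1 + 2 * sizeF ts) * hookF ts)

    hookF : List Tree → ℕ
    hookF [] = 1
    hookF (t ∷ ts) = hook t * hookF ts

  -- What is left of a tree whose root has preorder index o after no (full) or
  -- one (half) label of the root has been used.
  data Item : Set where
    full half : ℕ → List Tree → Item

  root : Item → ℕ
  root (full o ts) = o
  root (half o ts) = o

  desc : Item → List ℕ
  desc (full o ts) = range (suc o) (sizeF ts)
  desc (half o ts) = range (suc o) (sizeF ts)

  -- Labels the item still has to receive: 2h for an untouched subtree of size h, 2h-1 once its root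
  -- has one label. These are the two factors that a node contributes to `hook`.
  rem : Item → ℕ
  rem (full o ts) = 2 + 2 * sizeF ts
  rem (half o ts) = 1 + 2 * sizeF ts

  hookI : Item → ℕ
  hookI (full o ts) = (2 + 2 * sizeF ts) * ((1 + 2 * sizeF ts) * hookF ts)
  hookI (half o ts) = (1 + 2 * sizeF ts) * hookF ts

  hookL : List Item → ℕ
  hookL [] = 1
  hookL (i ∷ F) = hookI i * hookL F

  -- How many further labels node `v` must receive from the item. The repeated `δ` makes the full
  -- case one `δ` plus the half case, in step with the reading of labels.
  need : ℕ → Item → ℕ
  need v (full o ts) = δ v o + (δ v o + 2 * count v (range (suc o) (sizeF ts)))
  need v (half o ts) = δ v o + 2 * count v (range (suc o) (sizeF ts))

  edgesI : Item → List (ℕ × ℕ)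
  edgesI (full o ts) = edgesF o (suc o) ts
  edgesI (half o ts) = edgesF o (suc o) ts

  kids : ℕ → List Tree → List Item
  kids o [] = []
  kids o (node ts ∷ us) = full o ts ∷ kids (o + suc (sizeF ts)) us

  -- What one more label at the root leaves behind: the second label completes the root and frees
  -- its children.
  step : Item → List Item
  step (full o ts) = half o ts ∷ []
  step (half o ts) = kids (suc o) ts

  rootC descC needC : List Item → ℕ → ℕ
  rootC F v = sumBy (λ i → δ v (root i)) F
  descC F v = sumBy (λ i → count v (desc i)) F
  needC F v = sumBy (need v) F

  Edge : List Item → ℕ → ℕ → Set
  Edge F p c = Any (λ i → (p , c) ∈ edgesI i) F

  rem-kids : ∀ o ts → sumBy rem (kids o ts) ≡ 2 * sizeF ts
  rem-kids o [] = refl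
  rem-kids o (node ts ∷ us) rewrite rem-kids (o + suc (sizeF ts)) us =
    solve 2 (λ a b → con 2 :+ con 2 :* a :+ con 2 :* b := con 2 :* (con 1 :+ a :+ b)) refl (sizeF ts) (sizeF us)

  rem-step : ∀ i → rem i ≡ suc (sumBy rem (step i))
  rem-step (full o ts) = cong suc (sym (+-identityʳ _))
  rem-step (half o ts) = cong suc (sym (rem-kids (suc o) ts))

  hook-kids : ∀ o ts → hookL (kids o ts) ≡ hookF ts
  hook-kids o [] = refl
  hook-kids o (node ts ∷ us) = cong (hook (node ts) *_) (hook-kids _ us)

  -- The local form of the hook formula: reading one label strips exactly one factor from the
  -- product.
  hook-step : ∀ i → hookI i ≡ rem i * hookL (step i)
  hook-step (full o ts) = cong ((2 + 2 * sizeF ts) *_) (sym (*-identityʳ ((1 + 2 * sizeF ts) * hookF ts)))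
  hook-step (half o ts) = cong ((1 + 2 * sizeF ts) *_) (sym (hook-kids (suc o) ts))

  need-kids : ∀ v o ts → needC (kids o ts) v ≡ 2 * count v (range o (sizeF ts))
  need-kids v o [] = refl
  need-kids v o (node ts ∷ us)
    rewrite need-kids v (o + suc (sizeF ts)) us | count-range-+ v o (suc (sizeF ts)) (sizeF us) =
    solve 3 (λ a b c → a :+ (a :+ con 2 :* b) :+ con 2 :* c := con 2 :* (a :+ b :+ c)) refl
      (δ v o) (count v (range (suc o) (sizeF ts))) (count v (range (o + suc (sizeF ts)) (sizeF us)))

  need-step : ∀ v i → need v i ≡ δ v (root i) + needC (step i) v
  need-step v (full o ts) = cong (δ v o +_) (sym (+-identityʳ _))
  need-step v (half o ts) = cong (δ v o +_) (sym (need-kids v (suc o) ts))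

  nodes-kids : ∀ v o ts → rootC (kids o ts) v + descC (kids o ts) v ≡ count v (range o (sizeF ts))
  nodes-kids v o [] = refl
  nodes-kids v o (node ts ∷ us)
    rewrite count-range-+ v o (suc (sizeF ts)) (sizeF us) | sym (nodes-kids v (o + suc (sizeF ts)) us) =
    solve 4 (λ a b c d → (a :+ b) :+ (c :+ d) := (a :+ c) :+ (b :+ d)) refl
      (δ v o) (rootC (kids (o + suc (sizeF ts)) us) v) (count v (range (suc o) (sizeF ts))) _

  edge-child : ∀ {p c} q o ts → (p , c) ∈ edgesF q o ts → c ∈ range o (sizeF ts)
  edge-child {p} {c} q o (node ts ∷ us) h = subst (c ∈_) (sym (range-++ o (suc (sizeF ts)) (sizeF us))) (go h)
    where
    go : (p , c) ∈ edgesF q o (node ts ∷ us) → c ∈ range o (suc (sizeF ts)) ++ range (o + suc (sizeF ts)) (sizeF us)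
    go (here refl) = here refl
    go (there m) with ∈-++⁻ (edgesF o (suc o) ts) m
    ... | inj₁ m₁ = there (∈-++⁺ˡ (edge-child o (suc o) ts m₁))
    ... | inj₂ m₂ = ∈-++⁺ʳ (range o (suc (sizeF ts))) (edge-child q (o + suc (sizeF ts)) us m₂)

  -- The last component places the parent in the same item, from which it follows later that the
  -- parent still awaits labels.
  parent : ∀ {c} q o ts → c ∈ range o (sizeF ts) →
    ∃ λ p → (p , c) ∈ edgesF q o ts × (p ≡ q ⊎ p ∈ range o (sizeF ts))
  parent {c} q o (node ts ∷ us) h
    rewrite range-++ o (suc (sizeF ts)) (sizeF us) with ∈-++⁻ (range o (suc (sizeF ts))) h
  ... | inj₁ (here refl) = q , here refl , inj₁ refl
  ... | inj₁ (there m) with parent o (suc o) ts m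
  ...   | p , e , inj₁ refl = p , there (∈-++⁺ˡ e) , inj₂ (here refl)
  ...   | p , e , inj₂ m′ = p , there (∈-++⁺ˡ e) , inj₂ (there (∈-++⁺ˡ m′))
  parent {c} q o (node ts ∷ us) h | inj₂ m with parent q (o + suc (sizeF ts)) us m
  ... | p , e , inj₁ eq = p , there (∈-++⁺ʳ (edgesF o (suc o) ts) e) , inj₁ eq
  ... | p , e , inj₂ m′ = p , there (∈-++⁺ʳ (edgesF o (suc o) ts) e) , inj₂ (∈-++⁺ʳ (range o (suc (sizeF ts))) m′)

  edges-kids⁻ : ∀ {p c} q o ts → (p , c) ∈ edgesF q o ts → p ≡ q ⊎ Edge (kids o ts) p c
  edges-kids⁻ q o (node ts ∷ us) (here refl) = inj₁ refl
  edges-kids⁻ q o (node ts ∷ us) (there m) with ∈-++⁻ (edgesF o (suc o) ts) m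
  ... | inj₁ m₁ = inj₂ (here m₁)
  ... | inj₂ m₂ with edges-kids⁻ q _ us m₂
  ...   | inj₁ eq = inj₁ eq
  ...   | inj₂ e = inj₂ (there e)

  edges-kids⁺ : ∀ {p c} q o ts → Edge (kids o ts) p c → (p , c) ∈ edgesF q o ts
  edges-kids⁺ q o (node ts ∷ us) (here m) = there (∈-++⁺ˡ m)
  edges-kids⁺ q o (node ts ∷ us) (there e) = there (∈-++⁺ʳ (edgesF o (suc o) ts) (edges-kids⁺ q _ us e))

  -- The effect of reading the letter `x` on the remaining forest. Keeping the place of `r` in the
  -- derivation lets statistics of the two forests be compared by induction.
  data Step (x : ℕ) (r : Item) : List Item → List Item → Set where
    here : ∀ {F} → root r ≡ x → Step x r (r ∷ F) (step r ++ F)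
    there : ∀ {i F F′} → Step x r F F′ → Step x r (i ∷ F) (i ∷ F′)

  findStep : ∀ x F → (∃₂ λ r F′ → Step x r F F′) ⊎ rootC F x ≡ 0
  findStep x [] = inj₂ refl
  findStep x (i ∷ F) with root i ≟ x
  ... | yes eq = inj₁ (i , _ , here eq)
  ... | no ne with findStep x F
  ...   | inj₁ (r , F′ , s) = inj₁ (r , i ∷ F′ , there s)
  ...   | inj₂ z with δ x (root i) in eq
  ...     | zero = inj₂ z
  ...     | suc _ = contradiction (sym (δ-positive x (root i) (subst (0 <_) (sym eq) (s≤s z≤n)))) ne

  -- Replacing `r` by `step r` trades `f r` for the sum over `step r`. Adding on both sides avoids
  -- subtraction in ℕ; the laws for labels, needs and nodes follow by cancellation.
  Step-sumBy : ∀ {x r F F′} (f : Item → ℕ) → Step x r F F′ →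
    sumBy f F + sumBy f (step r) ≡ f r + sumBy f F′
  Step-sumBy {r = r} f (here {F} _) rewrite sumBy-++ f (step r) F =
    solve 3 (λ a b c → a :+ b :+ c := a :+ (c :+ b)) refl (f r) (sumBy f F) (sumBy f (step r))
  Step-sumBy {r = r} f (there {i} {F} {F′} s) = begin
    f i + sumBy f F + sumBy f (step r)   ≡⟨ +-assoc (f i) _ _ ⟩
    f i + (sumBy f F + sumBy f (step r)) ≡⟨ cong (f i +_) (Step-sumBy f s) ⟩
    f i + (f r + sumBy f F′)             ≡⟨ solve 3 (λ a b c → a :+ (b :+ c) := b :+ (a :+ c)) refl (f i) (f r) _ ⟩
    f r + (f i + sumBy f F′)             ∎
    where open ≡-Reasoning

  Step-rem : ∀ {x r F F′} → Step x r F F′ → sumBy rem F ≡ suc (sumBy rem F′)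
  Step-rem {r = r} {F} {F′} s = +-cancelʳ-≡ (sumBy rem (step r)) _ _ (begin
    sumBy rem F + sumBy rem (step r)          ≡⟨ Step-sumBy rem s ⟩
    rem r + sumBy rem F′                      ≡⟨ cong (_+ sumBy rem F′) (rem-step r) ⟩
    suc (sumBy rem (step r)) + sumBy rem F′   ≡⟨ cong suc (+-comm (sumBy rem (step r)) _) ⟩
    suc (sumBy rem F′) + sumBy rem (step r)   ∎)
    where open ≡-Reasoning

  Step-root : ∀ {x r F F′} → Step x r F F′ → root r ≡ x
  Step-root (here eq) = eq
  Step-root (there s) = Step-root s

  Step-need : ∀ {x r F F′} v → Step x r F F′ → needC F v ≡ δ v x + needC F′ v
  Step-need {x} {r} {F} {F′} v s = +-cancelʳ-≡ (needC (step r) v) _ _ (begin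
    needC F v + needC (step r) v              ≡⟨ Step-sumBy (need v) s ⟩
    need v r + needC F′ v                     ≡⟨ cong (_+ needC F′ v) (need-step v r) ⟩
    δ v (root r) + needC (step r) v + needC F′ v ≡⟨ cong (λ y → δ v y + needC (step r) v + needC F′ v) (Step-root s) ⟩
    δ v x + needC (step r) v + needC F′ v     ≡⟨ solve 3 (λ a b c → a :+ b :+ c := a :+ c :+ b) refl (δ v x) (needC (step r) v) _ ⟩
    δ v x + needC F′ v + needC (step r) v     ∎)
    where open ≡-Reasoning

  hookL-++ : ∀ F G → hookL (F ++ G) ≡ hookL F * hookL G
  hookL-++ [] G = sym (+-identityʳ _)
  hookL-++ (i ∷ F) G rewrite hookL-++ F G = sym (*-assoc (hookI i) _ _)

  Step-hook : ∀ {x r F F′} → Step x r F F′ → hookL F ≡ rem r * hookL F′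
  Step-hook {r = r} (here {F} _) rewrite hook-step r | hookL-++ (step r) F = *-assoc (rem r) _ _
  Step-hook {r = r} (there {i} {F} {F′} s) rewrite Step-hook s =
    solve 3 (λ a b c → a :* (b :* c) := b :* (a :* c)) refl (hookI i) (rem r) (hookL F′)

  Step-rootC : ∀ {x r F F′} → Step x r F F′ → 0 < rootC F x
  Step-rootC {x} s = Any⇒0<sumBy _ (go s)
    where
    go : ∀ {r F F′} → Step x r F F′ → Any (λ i → 0 < δ x (root i)) F
    go (here refl) = here (subst (0 <_) (sym (δ-refl x)) (s≤s z≤n))
    go (there s) = there (go s)

  -- Multiplicity of the index `v` among the nodes not yet completed.
  nodesC : List Item → ℕ → ℕ
  nodesC F v = rootC F v + descC F v

  data IsHalf : Item → Set where
    isHalf : ∀ {o ts} → IsHalf (half o ts)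

  Step-nodesC : ∀ {x r F F′} v → Step x r F F′ →
    nodesC F v + nodesC (step r) v ≡ (δ v (root r) + count v (desc r)) + nodesC F′ v
  Step-nodesC {x} {r} {F} {F′} v s = begin
    (rootC F v + descC F v) + (rootC (step r) v + descC (step r) v)
      ≡⟨ interchange (rootC F v) _ _ _ ⟩
    (rootC F v + rootC (step r) v) + (descC F v + descC (step r) v)
      ≡⟨ cong₂ _+_ (Step-sumBy _ s) (Step-sumBy _ s) ⟩
    (δ v (root r) + rootC F′ v) + (count v (desc r) + descC F′ v)
      ≡⟨ interchange (δ v (root r)) _ _ _ ⟩
    (δ v (root r) + count v (desc r)) + nodesC F′ v ∎
    where
    open ≡-Reasoning
    interchange : ∀ a b c d → (a + b) + (c + d) ≡ (a + c) + (b + d)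
    interchange = solve 4 (λ a b c d → (a :+ b) :+ (c :+ d) := (a :+ c) :+ (b :+ d)) refl

  -- The second label removes the root alone: its descendants are exactly the nodes of the freed
  -- items.
  Step-nodes-half : ∀ {x r F F′} v → IsHalf r → Step x r F F′ → nodesC F v ≡ δ v x + nodesC F′ v
  Step-nodes-half {x} {half o ts} {F} {F′} v isHalf s = +-cancelʳ-≡ c _ _ (begin
    nodesC F v + c                            ≡⟨ cong (nodesC F v +_) (sym (nodes-kids v (suc o) ts)) ⟩
    nodesC F v + nodesC (kids (suc o) ts) v   ≡⟨ Step-nodesC v s ⟩
    δ v o + c + nodesC F′ v                   ≡⟨ cong (λ y → δ v y + c + nodesC F′ v) (Step-root s) ⟩
    δ v x + c + nodesC F′ v                   ≡⟨ solve 3 (λ a b c → a :+ b :+ c := a :+ c :+ b) refl (δ v x) c _ ⟩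
    δ v x + nodesC F′ v + c                   ∎)
    where
    open ≡-Reasoning
    c = count v (range (suc o) (sizeF ts))

  Step-nodes-≤ : ∀ {x r F F′} v → Step x r F F′ → nodesC F′ v ≤ nodesC F v
  Step-nodes-≤ {x} {full o ts} {F} {F′} v s = ≤-reflexive (+-cancelʳ-≡ (nodesC (step (full o ts)) v) _ _ (begin
    nodesC F′ v + nodesC (step (full o ts)) v  ≡⟨ +-comm (nodesC F′ v) _ ⟩
    nodesC (step (full o ts)) v + nodesC F′ v  ≡⟨ cong (_+ nodesC F′ v) (cong₂ _+_ (+-identityʳ (δ v o)) (+-identityʳ (count v (range (suc o) (sizeF ts))))) ⟩
    δ v o + count v (range (suc o) (sizeF ts)) + nodesC F′ v ≡⟨ sym (Step-nodesC v s) ⟩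
    nodesC F v + nodesC (step (full o ts)) v   ∎))
    where open ≡-Reasoning
  Step-nodes-≤ {x} {half o ts} v s rewrite Step-nodes-half v isHalf s = m≤n+m _ (δ v x)

  Step-edge⁺ : ∀ {x r F F′ p c} → Step x r F F′ → Edge F′ p c → Edge F p c
  Step-edge⁺ {r = full o ts} (here eq) (here e) = here e
  Step-edge⁺ {r = full o ts} (here eq) (there e) = there e
  Step-edge⁺ {r = half o ts} (here eq) e = go (kids (suc o) ts) (edges-kids⁺ o (suc o) ts) e
    where
    go : ∀ {p c F} G → (Edge G p c → (p , c) ∈ edgesF o (suc o) ts) → Edge (G ++ F) p c → Edge (half o ts ∷ F) p c
    go [] f e = there e
    go (i ∷ G) f (here e) = here (f (here e))
    go (i ∷ G) f (there e) = go G (f ∘ there) e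
  Step-edge⁺ (there s) (here e) = here e
  Step-edge⁺ (there s) (there e) = there (Step-edge⁺ s e)

  -- An edge is dropped only when its parent receives its second label, after which no label of that
  -- parent can follow.
  Step-edge⁻ : ∀ {x r F F′ p c} → Step x r F F′ → Edge F p c → Edge F′ p c ⊎ (p ≡ x × IsHalf r)
  Step-edge⁻ {r = full o ts} (here eq) (here e) = inj₁ (here e)
  Step-edge⁻ {r = full o ts} (here eq) (there e) = inj₁ (there e)
  Step-edge⁻ {r = half o ts} (here eq) (here e) with edges-kids⁻ o (suc o) ts e
  ... | inj₁ refl = inj₂ (eq , isHalf)
  ... | inj₂ e′ = inj₁ (++⁺ˡ e′)
  Step-edge⁻ {r = half o ts} (here eq) (there e) = inj₁ (++⁺ʳ (kids (suc o) ts) e)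
  Step-edge⁻ (there s) (here e) = inj₁ (here e)
  Step-edge⁻ (there s) (there e) with Step-edge⁻ s e
  ... | inj₁ e′ = inj₁ (there e′)
  ... | inj₂ h = inj₂ h

  edge-desc : ∀ {F p c} → Edge F p c → 0 < descC F c
  edge-desc {c = c} e = Any⇒0<sumBy _ (go e)
    where
    go : ∀ {F p} → Edge F p c → Any (λ i → 0 < count c (desc i)) F
    go {full o ts ∷ F} (here m) = here (∈⇒0<count (edge-child o (suc o) ts m))
    go {half o ts ∷ F} (here m) = here (∈⇒0<count (edge-child o (suc o) ts m))
    go (there e) = there (go e)

  -- A node strictly below a root is blocked: its parent is in the same item and is still owed a
  -- label.
  desc-edge : ∀ {c} F → 0 < descC F c → ∃ λ p → Edge F p c × 0 < nodesC F p × 0 < needC F p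
  desc-edge {c} F h with go F (0<sumBy⇒Any _ F h)
    where
    item : ∀ i → 0 < count c (desc i) → ∃ λ p → (p , c) ∈ edgesI i × (p ≡ root i ⊎ p ∈ desc i)
    item (full o ts) h = parent o (suc o) ts (0<count⇒∈ _ h)
    item (half o ts) h = parent o (suc o) ts (0<count⇒∈ _ h)
    go : ∀ F → Any (λ i → 0 < count c (desc i)) F → ∃ λ p → Edge F p c × Any (λ i → p ≡ root i ⊎ p ∈ desc i) F
    go (i ∷ F) (here h) with item i h
    ... | p , e , m = p , here e , here m
    go (i ∷ F) (there h) with go F h
    ... | p , e , m = p , there e , there m
  ... | p , e , m = p , e , nodes F m , Any⇒0<sumBy _ (needs F m)
    where
    nodes : ∀ {p} F → Any (λ i → p ≡ root i ⊎ p ∈ desc i) F → 0 < nodesC F p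
    nodes {p} (i ∷ F) (here (inj₁ refl)) rewrite δ-refl p = s≤s z≤n
    nodes {p} (i ∷ F) (here (inj₂ m)) = ≤-trans (≤-trans (∈⇒0<count m) (m≤m+n _ _)) (m≤n+m _ (rootC (i ∷ F) p))
    nodes {p} (i ∷ F) (there m) = ≤-trans (nodes F m) (+-mono-≤ (m≤n+m _ (δ p (root i))) (m≤n+m _ (count p (desc i))))
    need+ : ∀ {p} i → p ≡ root i ⊎ p ∈ desc i → 0 < need p i
    need+ {p} (full o ts) (inj₁ refl) rewrite δ-refl p = s≤s z≤n
    need+ {p} (half o ts) (inj₁ refl) rewrite δ-refl p = s≤s z≤n
    need+ {p} (full o ts) (inj₂ m) = ≤-trans (∈⇒0<count m) (≤-trans (m≤m+n _ _) (≤-trans (m≤n+m _ (δ p o)) (m≤n+m _ (δ p o))))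
    need+ {p} (half o ts) (inj₂ m) = ≤-trans (∈⇒0<count m) (≤-trans (m≤m+n _ _) (m≤n+m _ (δ p o)))
    needs : ∀ {p} F → Any (λ i → p ≡ root i ⊎ p ∈ desc i) F → Any (λ i → 0 < need p i) F
    needs (i ∷ F) (here m) = here (need+ i m)
    needs (i ∷ F) (there m) = there (needs F m)

  need⇒nodes : ∀ F v → 0 < needC F v → 0 < rootC F v ⊎ 0 < descC F v
  need⇒nodes (i ∷ F) v h with 0<+ (need v i) h
  ... | inj₂ h′ with need⇒nodes F v h′
  ...   | inj₁ p = inj₁ (≤-trans p (m≤n+m _ (δ v (root i))))
  ...   | inj₂ p = inj₂ (≤-trans p (m≤n+m _ (count v (desc i))))
  need⇒nodes (i ∷ F) v h | inj₁ h′ with item i h′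
    where
    twice : ∀ k → 0 < 2 * k → 0 < k
    twice (suc k) _ = s≤s z≤n
    item : ∀ i → 0 < need v i → 0 < δ v (root i) ⊎ 0 < count v (desc i)
    item (half o ts) h with 0<+ (δ v o) h
    ... | inj₁ p = inj₁ p
    ... | inj₂ p = inj₂ (twice _ p)
    item (full o ts) h with 0<+ (δ v o) h
    ... | inj₁ p = inj₁ p
    ... | inj₂ p = item (half o ts) p
  ... | inj₁ p = inj₁ (≤-trans p (m≤m+n (δ v (root i)) _))
  ... | inj₂ p = inj₂ (≤-trans p (m≤m+n (count v (desc i)) _))

  -- All labels of `p` precede those of `c`: whenever `c` is read, `p` no longer occurs. Unlike a
  -- comparison of positions, this form passes to tails of the word.
  Before : ℕ → ℕ → List ℕ → Set
  Before p c [] = ⊤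
  Before p c (x ∷ g) = (x ≡ c → count p (x ∷ g) ≡ 0) × Before p c g

  count≡0⇒Before : ∀ p c g → count p g ≡ 0 → Before p c g
  count≡0⇒Before p c [] h = tt
  count≡0⇒Before p c (x ∷ g) h = (λ _ → h) , count≡0⇒Before p c g (m+n≡0⇒n≡0 (δ p x) h)

  countB-++ : {A : Set} (b : A → Bool) (xs ys : List A) → countB b (xs ++ ys) ≡ countB b xs + countB b ys
  countB-++ b [] ys = refl
  countB-++ b (x ∷ xs) ys = trans (cong (_ +_) (countB-++ b xs ys)) (sym (+-assoc (if b x then 1 else 0) _ _))

  countB-map : {A B : Set} (b : B → Bool) (f : A → B) (xs : List A) → countB b (map f xs) ≡ countB (b ∘ f) xs
  countB-map b f [] = refl
  countB-map b f (x ∷ xs) = cong (_ +_) (countB-map b f xs)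

  countB-concatMap : {A B : Set} (b : B → Bool) (f : A → List B) (xs : List A) →
    countB b (concatMap f xs) ≡ sumBy (λ x → countB b (f x)) xs
  countB-concatMap b f [] = refl
  countB-concatMap b f (x ∷ xs) = trans (countB-++ b (f x) _) (cong (_ +_) (countB-concatMap b f xs))

  countB-false : {A : Set} (b : A → Bool) (xs : List A) → (∀ x → ¬ T (b x)) → countB b xs ≡ 0
  countB-false b [] h = refl
  countB-false b (x ∷ xs) h with b x in eq
  ... | false = countB-false b xs h
  ... | true = ⊥-elim (h x (subst T (sym eq) tt))

  -- `n` is the number of nodes of the original tree, hence the size of the alphabet; it stays fixed
  -- while the forest shrinks.
  module Words (n : ℕ) where

    -- Since `count v (range 0 n)` is 1 below `n` and 0 beyond, this one inequality says both that
    -- no node occurs twice and that every index is in the alphabet.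
    Inv : List Item → Set
    Inv F = ∀ v → nodesC F v ≤ count v (range 0 n)

    -- The words `g` that complete the labelling of the remaining forest.
    Valid : List Item → List ℕ → Set
    Valid F g = (∀ v → v < n → count v g ≡ needC F v) × (∀ p c → Edge F p c → Before p c g)

    Inv-< : ∀ {F v} → Inv F → 0 < nodesC F v → v < n
    Inv-< {F} {v} inv h = proj₂ (∈-range⁻ 0 n (0<count⇒∈ _ (≤-trans h (inv v))))

    Inv-≤1 : ∀ {F} v → Inv F → nodesC F v ≤ 1
    Inv-≤1 v inv = ≤-trans (inv v) (count-range-≤1 v 0 n)

    Step-Inv : ∀ {x r F F′} → Step x r F F′ → Inv F → Inv F′
    Step-Inv s inv v = ≤-trans (Step-nodes-≤ v s) (inv v)

    -- The letter `x` occurs, so some node of `F` needs it. Were that node a descendant, its parent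
    -- would still need a label and so occur in the word, whereas `Before` forbids the parent from
    -- the first `x` on.
    valid-root : ∀ {x F g} → x < n → Inv F → Valid F (x ∷ g) → 0 < rootC F x
    valid-root {x} {F} {g} x<n inv (cnt , bef)
      with need⇒nodes F x (subst (0 <_) (cnt x x<n) (∈⇒0<count {x} {x ∷ g} (here refl)))
    ... | inj₁ h = h
    ... | inj₂ h with desc-edge F h
    ...   | p , e , nd , ne =
      contradiction (subst (0 <_) (trans (sym (cnt p (Inv-< {F} inv nd))) (proj₁ (bef p x e) refl)) ne) λ ()

    valid-step⁻ : ∀ {x r F F′ g} → Step x r F F′ → Valid F (x ∷ g) → Valid F′ g
    valid-step⁻ {x} s (cnt , bef) =
      (λ v v<n → +-cancelˡ-≡ (δ v x) _ _ (trans (cnt v v<n) (Step-need v s))) ,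
      (λ p c e → proj₂ (bef p c (Step-edge⁺ s e)))

    -- Two obligations are new. The letter read must not be the child of an edge: it is a root and,
    -- by `Inv`, not also a descendant. An edge dropped with its completed parent must hold in `g`:
    -- there the parent does not occur, as nothing of it is needed any more.
    valid-step⁺ : ∀ {x r F F′ g} → x < n → Inv F → Step x r F F′ → Valid F′ g → Valid F (x ∷ g)
    valid-step⁺ {x} {r} {F} {F′} {g} x<n inv s (cnt , bef) =
      (λ v v<n → trans (cong (δ v x +_) (cnt v v<n)) (sym (Step-need v s))) ,
      (λ p c e → (λ { refl → contradiction (≤-trans (+-mono-≤ (Step-rootC s) (edge-desc e)) (Inv-≤1 {F} x inv)) λ { (s≤s ()) } }) ,
                 tail p c (Step-edge⁻ s e))
      where
      used-up : IsHalf r → needC F′ x ≡ 0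
      used-up h with needC F′ x in eq
      ... | zero = refl
      ... | suc _ = contradiction (≤-trans (+-monoʳ-≤ 1 nd) (≤-trans (≤-reflexive (sym total)) (Inv-≤1 {F} x inv))) λ { (s≤s ()) }
        where
        total : nodesC F x ≡ 1 + nodesC F′ x
        total = trans (Step-nodes-half x h s) (cong (_+ nodesC F′ x) (δ-refl x))
        nd : 0 < nodesC F′ x
        nd with need⇒nodes F′ x (subst (0 <_) (sym eq) (s≤s z≤n))
        ... | inj₁ p = ≤-trans p (m≤m+n _ _)
        ... | inj₂ p = ≤-trans p (m≤n+m _ (rootC F′ x))
      tail : ∀ p c → Edge F′ p c ⊎ (p ≡ x × IsHalf r) → Before p c g
      tail p c (inj₁ e) = bef p c e
      tail p c (inj₂ (refl , h)) = count≡0⇒Before x c g (trans (cnt x x<n) (used-up h))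

    -- The `rem` of the item rooted at `x`, or 0 if there is none, as an indicator sum so that
    -- summation over letters can be exchanged with summation over items.
    remAt : List Item → ℕ → ℕ
    remAt F x = sumBy (λ i → δ x (root i) * rem i) F

    remAt-nonroot : ∀ x F → rootC F x ≡ 0 → remAt F x ≡ 0
    remAt-nonroot x [] h = refl
    remAt-nonroot x (i ∷ F) h rewrite m+n≡0⇒m≡0 (δ x (root i)) h = remAt-nonroot x F (m+n≡0⇒n≡0 (δ x (root i)) h)

    remAt-root : ∀ {x r F F′} → Step x r F F′ → rootC F x ≤ 1 → remAt F x ≡ rem r
    remAt-root {x} {r} (here {F} refl) h rewrite δ-refl x =
      trans (cong₂ _+_ (+-identityʳ (rem r)) (remAt-nonroot x F (n≤0⇒n≡0 (≤-pred h)))) (+-identityʳ _)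
    remAt-root {x} (there {i} {F} s) h =
      cong₂ (λ a b → a * rem i + b)
        (n≤0⇒n≡0 (≤-pred (≤-trans (+-monoʳ-≤ 1 (≤-reflexive (sym (+-identityʳ _)))) (≤-trans (≤-reflexive (sym (+-suc (δ x (root i)) 0))) (≤-trans (+-monoʳ-≤ (δ x (root i)) (Step-rootC s)) h)))))
        (remAt-root s (≤-trans (m≤n+m _ (δ x (root i))) h))

    sum-remAt : ∀ F → Inv F → sumBy (remAt F) (range 0 n) ≡ sumBy rem F
    sum-remAt F inv = trans (sumBy-swap (λ x i → δ x (root i) * rem i) (range 0 n) F) (sumBy-cong F one)
      where
      bound : ∀ {i} F → i ∈ F → 0 < nodesC F (root i)
      bound {i} F m = ≤-trans (Any⇒0<sumBy _ (go m)) (m≤m+n _ _)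
        where
        go : ∀ {F} → i ∈ F → Any (λ j → 0 < δ (root i) (root j)) F
        go (here refl) = here (subst (0 <_) (sym (δ-refl (root i))) (s≤s z≤n))
        go (there m) = there (go m)
      one : ∀ i → i ∈ F → sumBy (λ x → δ x (root i) * rem i) (range 0 n) ≡ rem i
      one i m = begin
        sumBy (λ x → δ x (root i) * rem i) (range 0 n) ≡⟨ sumBy-*ʳ (λ x → δ x (root i)) (rem i) (range 0 n) ⟩
        sumBy (λ x → δ x (root i)) (range 0 n) * rem i ≡⟨ cong (_* rem i) (sumBy-δ (root i) (range 0 n)) ⟩
        count (root i) (range 0 n) * rem i             ≡⟨ cong (_* rem i) (count-range-∈ n (Inv-< {F} inv (bound F m))) ⟩
        rem i + 0                                      ≡⟨ +-identityʳ _ ⟩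
        rem i                                          ∎
        where open ≡-Reasoning

    -- Induction on the word length. A first letter has continuations only if it is the root of an
    -- item `r`; then the hook product loses the factor `rem r` and the continuations give `len !`.
    -- Over all roots `rem r` adds up to `suc len`. The test `b` is arbitrary up to equivalence with
    -- `Valid`, since on tails it becomes `b ∘ (x ∷_)`.
    count-valid : ∀ len F → Inv F → sumBy rem F ≡ len → (b : List ℕ → Bool) →
      (∀ g → T (b g) → Valid F g) → (∀ g → Valid F g → T (b g)) →
      countB b (allMaps len n) * hookL F ≡ len !
    -- The empty word completes the empty forest, so `complete` forces `b []` to be true and the
    -- count is 1.
    count-valid zero [] inv eq b sound complete with b [] | complete [] ((λ _ _ → refl) , λ _ _ ())
    ... | true | _ = refl
    count-valid zero (full o ts ∷ F) inv () b sound complete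
    count-valid zero (half o ts ∷ F) inv () b sound complete
    count-valid (suc len) F inv eq b sound complete = begin
      countB b (concatMap (λ x → map (x ∷_) (allMaps len n)) (upTo n)) * hookL F
        ≡⟨ cong (λ xs → countB b (concatMap (λ x → map (x ∷_) (allMaps len n)) xs) * hookL F) (upTo-range n) ⟩
      countB b (concatMap (λ x → map (x ∷_) (allMaps len n)) (range 0 n)) * hookL F
        ≡⟨ cong (_* hookL F) (countB-concatMap b _ (range 0 n)) ⟩
      sumBy (λ x → countB b (map (x ∷_) (allMaps len n))) (range 0 n) * hookL F
        ≡⟨ sym (sumBy-*ʳ _ (hookL F) (range 0 n)) ⟩
      sumBy (λ x → countB b (map (x ∷_) (allMaps len n)) * hookL F) (range 0 n)
        ≡⟨ sumBy-cong (range 0 n) (λ x m → first x (proj₂ (∈-range⁻ 0 n m))) ⟩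
      sumBy (λ x → remAt F x * len !) (range 0 n)
        ≡⟨ sumBy-*ʳ (remAt F) (len !) (range 0 n) ⟩
      sumBy (remAt F) (range 0 n) * len !
        ≡⟨ cong (_* len !) (trans (sum-remAt F inv) eq) ⟩
      suc len * len ! ∎
      where
      open ≡-Reasoning
      first : ∀ x → x < n → countB b (map (x ∷_) (allMaps len n)) * hookL F ≡ remAt F x * len !
      first x x<n rewrite countB-map b (x ∷_) (allMaps len n) with findStep x F
      ... | inj₂ z = trans
        (cong (_* hookL F) (countB-false _ (allMaps len n)
          (λ g h → contradiction (subst (0 <_) z (valid-root x<n inv (sound (x ∷ g) h))) λ ())))
        (cong (_* len !) (sym (remAt-nonroot x F z)))
      ... | inj₁ (r , F′ , s) = begin
        countB (b ∘ (x ∷_)) (allMaps len n) * hookL F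
          ≡⟨ cong (countB (b ∘ (x ∷_)) (allMaps len n) *_) (Step-hook s) ⟩
        countB (b ∘ (x ∷_)) (allMaps len n) * (rem r * hookL F′)
          ≡⟨ solve 3 (λ a b c → a :* (b :* c) := b :* (a :* c)) refl (countB (b ∘ (x ∷_)) (allMaps len n)) (rem r) (hookL F′) ⟩
        rem r * (countB (b ∘ (x ∷_)) (allMaps len n) * hookL F′)
          ≡⟨ cong (rem r *_) (count-valid len F′ (Step-Inv s inv) (suc-injective (trans (sym (Step-rem s)) eq)) (b ∘ (x ∷_))
               (λ g h → valid-step⁻ s (sound (x ∷ g) h)) (λ g h → complete (x ∷ g) (valid-step⁺ x<n inv s h))) ⟩
        rem r * len !
          ≡⟨ cong (_* len !) (sym (remAt-root s (≤-trans (m≤m+n _ _) (Inv-≤1 {F} x inv)))) ⟩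
        remAt F x * len ! ∎

  allB⁻ : {A : Set} {p : A → Bool} (xs : List A) → T (allB p xs) → ∀ {x} → x ∈ xs → T (p x)
  allB⁻ (x ∷ xs) h (here refl) = proj₁ (Equivalence.to T-∧ h)
  allB⁻ (x ∷ xs) h (there m) = allB⁻ xs (proj₂ (Equivalence.to T-∧ h)) m

  allB⁺ : {A : Set} {p : A → Bool} (xs : List A) → (∀ {x} → x ∈ xs → T (p x)) → T (allB p xs)
  allB⁺ [] h = tt
  allB⁺ (x ∷ xs) h = Equivalence.from T-∧ (h (here refl) , allB⁺ xs (h ∘ there))

  positions : ℕ → ℕ → List ℕ → List ℕ
  positions v a [] = []
  positions v a (x ∷ xs) = if v ≡ᵇ x then a ∷ positions v (suc a) xs else positions v (suc a) xs

  -- The local function go of labelsOf cannot be named here: the left-hand side of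
  -- labelsOf-go is found by unification, from its use in labelsOf-positions.
  mutual
    labelsOf-go : ∀ v g a xs → _ ≡ positions v a xs

    labelsOf-positions : ∀ v g → labelsOf v g ≡ positions v 0 g
    labelsOf-positions v [] = refl
    -- Abstracting the literal `1` and the whole word gives the local function distinct variables as
    -- arguments, from which unification can solve for the missing side.
    labelsOf-positions v (x ∷ xs) with 1 | x ∷ xs
    ... | a | g with v ≡ᵇ x
    ...   | true = cong (0 ∷_) (labelsOf-go v g a xs)
    ...   | false = labelsOf-go v g a xs

    labelsOf-go v g a [] = refl
    labelsOf-go v g a (x ∷ xs) with v ≡ᵇ x
    ... | true = cong (a ∷_) (labelsOf-go v g (suc a) xs)
    ... | false = labelsOf-go v g (suc a) xs

  ∈-positions⁻ : ∀ {v b} a x xs → b ∈ positions v a (x ∷ xs) → (b ≡ a × v ≡ x) ⊎ b ∈ positions v (suc a) xs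
  ∈-positions⁻ {v} a x xs m with v ≡ᵇ x in eq
  ∈-positions⁻ {v} a x xs (here refl) | true = inj₁ (refl , ≡ᵇ⇒≡ v x (subst T (sym eq) tt))
  ∈-positions⁻ {v} a x xs (there m) | true = inj₂ m
  ... | false = inj₂ m

  ∈-positions-here : ∀ v a xs → a ∈ positions v a (v ∷ xs)
  ∈-positions-here v a xs with v ≡ᵇ v | ≡⇒≡ᵇ v v refl
  ... | true | _ = here refl

  ∈-positions-there : ∀ {v b} a x xs → b ∈ positions v (suc a) xs → b ∈ positions v a (x ∷ xs)
  ∈-positions-there {v} a x xs m with v ≡ᵇ x
  ... | true = there m
  ... | false = m

  positions-≥ : ∀ {v b} a xs → b ∈ positions v a xs → a ≤ b
  positions-≥ a (x ∷ xs) m with ∈-positions⁻ a x xs m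
  ... | inj₁ (refl , _) = ≤-refl
  ... | inj₂ m′ = <⇒≤ (positions-≥ (suc a) xs m′)

  ∈⇒positions : ∀ {v} a xs → v ∈ xs → ∃ λ b → b ∈ positions v a xs
  ∈⇒positions a (x ∷ xs) (here refl) = a , ∈-positions-here x a xs
  ∈⇒positions a (x ∷ xs) (there m) with ∈⇒positions (suc a) xs m
  ... | b , m′ = b , ∈-positions-there a x xs m′

  positions⇒∈ : ∀ {v b} a xs → b ∈ positions v a xs → v ∈ xs
  positions⇒∈ a (x ∷ xs) m with ∈-positions⁻ a x xs m
  ... | inj₁ (_ , refl) = here refl
  ... | inj₂ m′ = there (positions⇒∈ (suc a) xs m′)

  Separated : ℕ → ℕ → ℕ → List ℕ → Set
  Separated p c o g = ∀ {a b} → a ∈ positions p o g → b ∈ positions c o g → a < b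

  -- A `p` found at or after a `c` at position `o` would have a position of at least `o`.
  separated⇒Before : ∀ p c o g → Separated p c o g → Before p c g
  separated⇒Before p c o [] h = tt
  separated⇒Before p c o (x ∷ g) h =
    absent ,
    separated⇒Before p c (suc o) g (λ ma mb → h (∈-positions-there o x g ma) (∈-positions-there o x g mb))
    where
    absent : x ≡ c → count p (x ∷ g) ≡ 0
    absent refl with count p (x ∷ g) in eq
    ... | zero = refl
    ... | suc _ with ∈⇒positions {p} o (x ∷ g) (0<count⇒∈ (x ∷ g) (subst (0 <_) (sym eq) (s≤s z≤n)))
    ...   | a , m = contradiction (h m (∈-positions-here x o g)) (≤⇒≯ (positions-≥ o (x ∷ g) m))

  Before⇒separated : ∀ p c o g → Before p c g → Separated p c o g
  Before⇒separated p c o (x ∷ g) (hd , tl) {a} {b} ma mb with ∈-positions⁻ o x g mb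
  ... | inj₁ (refl , refl) =
    contradiction (subst (0 <_) (hd refl) (∈⇒0<count (positions⇒∈ o (x ∷ g) ma))) λ ()
  ... | inj₂ mb′ with ∈-positions⁻ o x g ma
  ...   | inj₁ (refl , _) = positions-≥ (suc o) g mb′
  ...   | inj₂ ma′ = Before⇒separated p c (suc o) g tl ma′ mb′

  -- The case of a single untouched tree with root index 0, in which every node needs two labels;
  -- `Valid` is then equivalent to the Boolean test on positions.
  ℓ-hook : ∀ t → ℓ t * hook t ≡ (2 * size t) !
  ℓ-hook (node ts) = trans (cong (ℓ t *_) (sym (*-identityʳ (hook t))))
    (count-valid (2 * size t) (full 0 ts ∷ []) inv rems (isIncreasingBilabelling t) sound complete)
    where
    t = node ts
    s = sizeF ts
    open Words (suc s)

    inv : Inv (full 0 ts ∷ [])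
    inv v = ≤-reflexive (cong₂ _+_ (+-identityʳ (δ v 0)) (+-identityʳ (count v (range 1 s))))

    rems : 2 + 2 * s + 0 ≡ 2 * suc s
    rems = solve 1 (λ s → con 2 :+ con 2 :* s :+ con 0 := con 2 :* (con 1 :+ s)) refl s

    needed : ∀ v → v < suc s → needC (full 0 ts ∷ []) v ≡ 2
    needed v v<n = trans
      (solve 2 (λ a b → a :+ (a :+ con 2 :* b) :+ con 0 := con 2 :* (a :+ b)) refl (δ v 0) (count v (range 1 s)))
      (cong (2 *_) (count-range-∈ (suc s) v<n))

    ∈-upTo : ∀ {v} → v < suc s → v ∈ upTo (suc s)
    ∈-upTo {v} v<n = subst (λ xs → v ∈ xs) (sym (upTo-range (suc s))) (∈-range⁺ 0 (suc s) z≤n v<n)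

    bilabels : List ℕ → Bool
    bilabels g = allB (λ v → count v g ≡ᵇ 2) (upTo (suc s))

    sound : ∀ g → T (isIncreasingBilabelling t g) → Valid (full 0 ts ∷ []) g
    sound g h with Equivalence.to (T-∧ {bilabels g}) h
    ... | h₁ , h₂ =
      (λ v v<n → trans (≡ᵇ⇒≡ (count v g) 2 (allB⁻ {p = λ v → count v g ≡ᵇ 2} (upTo (suc s)) h₁ (∈-upTo v<n))) (sym (needed v v<n))) ,
      (λ { p c (here e) → separated⇒Before p c 0 g (λ ma mb →
        <ᵇ⇒< _ _ (allB⁻ {p = λ b → _ <ᵇ b} (labelsOf c g)
          (allB⁻ {p = λ a → allB (λ b → a <ᵇ b) (labelsOf c g)} (labelsOf p g) (allB⁻ (edges 0 t) h₂ e) (subst (_ ∈_) (sym (labelsOf-positions p g)) ma))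
          (subst (_ ∈_) (sym (labelsOf-positions c g)) mb))) })

    complete : ∀ g → Valid (full 0 ts ∷ []) g → T (isIncreasingBilabelling t g)
    complete g (cnt , bef) = Equivalence.from (T-∧ {bilabels g})
      ( allB⁺ (upTo (suc s)) (λ {v} m →
          let v<n = proj₂ (∈-range⁻ 0 (suc s) (subst (v ∈_) (upTo-range (suc s)) m)) in
          ≡⇒≡ᵇ (count v g) 2 (trans (cnt v v<n) (needed v v<n)))
      , allB⁺ (edges 0 t) (λ { {p , c} e →
          allB⁺ (labelsOf p g) (λ ma → allB⁺ (labelsOf c g) (λ mb →
            <⇒<ᵇ (Before⇒separated p c 0 g (bef p c (here e))
              (subst (_ ∈_) (labelsOf-positions p g) ma) (subst (_ ∈_) (labelsOf-positions c g) mb)))) }))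

-- Formal power series over the rationals: products, derivatives, composition

module PowerSeries where

  open import Data.Nat as ℕ using (ℕ; zero; suc; _∸_; _!; _≤_; _<_; z≤n; s≤s; _≡ᵇ_)
  import Data.Nat.Properties as ℕₚ
  import Data.Integer as ℤ
  import Data.Integer.Properties as ℤₚ
  open import Data.Rational using (ℚ; 0ℚ; 1ℚ; _+_; _*_; fromℚᵘ) renaming (_/_ to _//_)
  open import Data.Rational.Properties
  open import Data.Rational.Unnormalised as ℚᵘ using (mkℚᵘ; *≡*)
  import Data.Rational.Unnormalised.Properties as ℚᵘₚ
  open import Data.Rational.Solver using (module +-*-Solver)
  open +-*-Solver using (solve; _:+_; _:*_; _:=_; con)
  open import Data.Bool using (if_then_else_)
  open import Data.List using (applyUpTo; foldr)
  open import Data.Product using (_,_)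
  open import Function using (_∘_)
  open import Algebra using (CommutativeSemiring)
  import Algebra.Solver.Ring.NaturalCoefficients.Default as NaturalCoefficients
  import Relation.Binary.Reasoning.Setoid as SetoidReasoning
  open import Relation.Binary.Structures using (IsEquivalence)
  open import Relation.Binary.PropositionalEquality

  -- Fractions made by `_//_` are normalised by a gcd that is stuck on variables. Read as `fromℚᵘ`
  -- of unnormalised fractions, their laws become integer identities.
  fromℚᵘ-+ : ∀ p q → fromℚᵘ (p ℚᵘ.+ q) ≡ fromℚᵘ p + fromℚᵘ q
  fromℚᵘ-+ p q = toℚᵘ-injective (ℚᵘₚ.≃-trans (toℚᵘ-fromℚᵘ (p ℚᵘ.+ q))
    (ℚᵘₚ.≃-sym (ℚᵘₚ.≃-trans (toℚᵘ-homo-+ (fromℚᵘ p) (fromℚᵘ q)) (ℚᵘₚ.+-cong (toℚᵘ-fromℚᵘ p) (toℚᵘ-fromℚᵘ q)))))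

  fromℚᵘ-* : ∀ p q → fromℚᵘ (p ℚᵘ.* q) ≡ fromℚᵘ p * fromℚᵘ q
  fromℚᵘ-* p q = toℚᵘ-injective (ℚᵘₚ.≃-trans (toℚᵘ-fromℚᵘ (p ℚᵘ.* q))
    (ℚᵘₚ.≃-sym (ℚᵘₚ.≃-trans (toℚᵘ-homo-* (fromℚᵘ p) (fromℚᵘ q)) (ℚᵘₚ.*-cong (toℚᵘ-fromℚᵘ p) (toℚᵘ-fromℚᵘ q)))))

  fromℕ-+ : ∀ m n → fromℕ (m ℕ.+ n) ≡ fromℕ m + fromℕ n
  fromℕ-+ m n = trans (fromℚᵘ-cong {mkℚᵘ (ℤ.+ (m ℕ.+ n)) 0} {mkℚᵘ (ℤ.+ m) 0 ℚᵘ.+ mkℚᵘ (ℤ.+ n) 0}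
    (*≡* (cong (ℤ._* ℤ.+ 1) (sym (cong₂ ℤ._+_ (ℤₚ.*-identityʳ (ℤ.+ m)) (ℤₚ.*-identityʳ (ℤ.+ n)))))))
    (fromℚᵘ-+ (mkℚᵘ (ℤ.+ m) 0) (mkℚᵘ (ℤ.+ n) 0))

  fromℕ-* : ∀ m n → fromℕ (m ℕ.* n) ≡ fromℕ m * fromℕ n
  fromℕ-* m n = trans (fromℚᵘ-cong {mkℚᵘ (ℤ.+ (m ℕ.* n)) 0} {mkℚᵘ (ℤ.+ m) 0 ℚᵘ.* mkℚᵘ (ℤ.+ n) 0}
    (*≡* (cong (ℤ._* ℤ.+ 1) (ℤₚ.pos-* m n))))
    (fromℚᵘ-* (mkℚᵘ (ℤ.+ m) 0) (mkℚᵘ (ℤ.+ n) 0))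

  fromℕ-suc : ∀ n → fromℕ (suc n) ≡ 1ℚ + fromℕ n
  fromℕ-suc n = fromℕ-+ 1 n

  //-* : ∀ m d .{{_ : ℕ.NonZero d}} → (ℤ.+ m // d) * fromℕ d ≡ fromℕ m
  //-* m (suc d) = trans (sym (fromℚᵘ-* (mkℚᵘ (ℤ.+ m) d) (mkℚᵘ (ℤ.+ suc d) 0)))
    (fromℚᵘ-cong {mkℚᵘ (ℤ.+ m) d ℚᵘ.* mkℚᵘ (ℤ.+ suc d) 0} {mkℚᵘ (ℤ.+ m) 0}
      (*≡* (trans (ℤₚ.*-identityʳ _) (cong (λ k → ℤ.+ m ℤ.* ℤ.+ suc k) (sym (ℕₚ.*-identityʳ d))))))

  //-fromℕ : ∀ n .{{_ : ℕ.NonZero n}} x → (ℤ.+ 1 // n) * (fromℕ n * x) ≡ x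
  //-fromℕ n x = trans (sym (*-assoc (ℤ.+ 1 // n) (fromℕ n) x)) (trans (cong (_* x) (//-* 1 n)) (*-identityˡ x))

  fromℕ-cancel : ∀ n .{{_ : ℕ.NonZero n}} {x y} → fromℕ n * x ≡ fromℕ n * y → x ≡ y
  fromℕ-cancel n {x} {y} h = trans (sym (//-fromℕ n x)) (trans (cong ((ℤ.+ 1 // n) *_) h) (//-fromℕ n y))

  inv!-! : ∀ n → inv! n * fromℕ (n !) ≡ 1ℚ
  inv!-! n = //-* 1 (n !) {{n ℕₚ.!≢0}}

  inv!-suc : ∀ n → fromℕ (suc n) * inv! (suc n) ≡ inv! n
  inv!-suc n = fromℕ-cancel (n !) {{n ℕₚ.!≢0}} (begin
    fromℕ (n !) * (fromℕ (suc n) * inv! (suc n)) ≡⟨ solve 3 (λ a b c → a :* (b :* c) := c :* (b :* a)) refl (fromℕ (n !)) (fromℕ (suc n)) (inv! (suc n)) ⟩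
    inv! (suc n) * (fromℕ (suc n) * fromℕ (n !)) ≡⟨ cong (inv! (suc n) *_) (sym (fromℕ-* (suc n) (n !))) ⟩
    inv! (suc n) * fromℕ (suc n !)               ≡⟨ inv!-! (suc n) ⟩
    1ℚ                                           ≡⟨ sym (inv!-! n) ⟩
    inv! n * fromℕ (n !)                         ≡⟨ *-comm (inv! n) _ ⟩
    fromℕ (n !) * inv! n                         ∎)
    where open ≡-Reasoning

  +-vanishˡ : ∀ {x} y → x ≡ 0ℚ → x + y ≡ y
  +-vanishˡ y refl = +-identityˡ y

  -- Not definitional: the tail of `upTo` keeps `suc` inside the generating function of `applyUpTo`,
  -- and moving it into the summand needs that function generalised.
  Σ<-suc : ∀ n f → Σ< (suc n) f ≡ f 0 + Σ< n (f ∘ suc)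
  Σ<-suc n f = cong (f 0 +_) (go suc n)
    where
    go : ∀ (g : ℕ → ℕ) n → foldr (λ i acc → f i + acc) 0ℚ (applyUpTo g n) ≡ Σ< n (f ∘ g)
    go g n = go′ g (λ i → i) n
      where
      go′ : ∀ (g h : ℕ → ℕ) n → foldr (λ i acc → f i + acc) 0ℚ (applyUpTo (g ∘ h) n)
                               ≡ foldr (λ i acc → f (g i) + acc) 0ℚ (applyUpTo h n)
      go′ g h zero = refl
      go′ g h (suc n) = cong (f (g (h 0)) +_) (go′ g (h ∘ suc) n)

  Σ<-cong : ∀ n {f g} → (∀ i → i < n → f i ≡ g i) → Σ< n f ≡ Σ< n g
  Σ<-cong zero h = refl
  Σ<-cong (suc n) {f} {g} h = trans (Σ<-suc n f)
    (trans (cong₂ _+_ (h 0 (s≤s z≤n)) (Σ<-cong n (λ i i<n → h (suc i) (s≤s i<n)))) (sym (Σ<-suc n g)))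

  Σ<-last : ∀ n f → Σ< (suc n) f ≡ Σ< n f + f n
  Σ<-last zero f = +-comm (f 0) 0ℚ
  Σ<-last (suc n) f = begin
    Σ< (suc (suc n)) f                    ≡⟨ Σ<-suc (suc n) f ⟩
    f 0 + Σ< (suc n) (f ∘ suc)            ≡⟨ cong (f 0 +_) (Σ<-last n (f ∘ suc)) ⟩
    f 0 + (Σ< n (f ∘ suc) + f (suc n))    ≡⟨ sym (+-assoc (f 0) _ _) ⟩
    f 0 + Σ< n (f ∘ suc) + f (suc n)      ≡⟨ cong (_+ f (suc n)) (sym (Σ<-suc n f)) ⟩
    Σ< (suc n) f + f (suc n)              ∎
    where open ≡-Reasoning

  Σ<-* : ∀ n c f → c * Σ< n f ≡ Σ< n (λ i → c * f i)
  Σ<-* zero c f = *-zeroʳ c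
  Σ<-* (suc n) c f = begin
    c * Σ< (suc n) f                     ≡⟨ cong (c *_) (Σ<-suc n f) ⟩
    c * (f 0 + Σ< n (f ∘ suc))           ≡⟨ *-distribˡ-+ c _ _ ⟩
    c * f 0 + c * Σ< n (f ∘ suc)         ≡⟨ cong (c * f 0 +_) (Σ<-* n c (f ∘ suc)) ⟩
    c * f 0 + Σ< n (λ i → c * f (suc i)) ≡⟨ sym (Σ<-suc n (λ i → c * f i)) ⟩
    Σ< (suc n) (λ i → c * f i)           ∎
    where open ≡-Reasoning

  Σ<-+ : ∀ n f g → Σ< n (λ i → f i + g i) ≡ Σ< n f + Σ< n g
  Σ<-+ zero f g = refl
  Σ<-+ (suc n) f g = begin
    Σ< (suc n) (λ i → f i + g i) ≡⟨ Σ<-suc n (λ i → f i + g i) ⟩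
    (f 0 + g 0) + Σ< n (λ i → f (suc i) + g (suc i)) ≡⟨ cong (f 0 + g 0 +_) (Σ<-+ n (f ∘ suc) (g ∘ suc)) ⟩
    (f 0 + g 0) + (Σ< n (f ∘ suc) + Σ< n (g ∘ suc)) ≡⟨ solve 4 (λ a b c d → (a :+ b) :+ (c :+ d) := (a :+ c) :+ (b :+ d)) refl (f 0) (g 0) _ _ ⟩
    (f 0 + Σ< n (f ∘ suc)) + (g 0 + Σ< n (g ∘ suc)) ≡⟨ sym (cong₂ _+_ (Σ<-suc n f) (Σ<-suc n g)) ⟩
    Σ< (suc n) f + Σ< (suc n) g ∎
    where open ≡-Reasoning

  infix 4 _≈_
  infixl 6 _⊕_
  infixl 7 _⊗_
  infixr 8 _↑_

  -- A record, so that both series can be recovered from the type by unification; the bare family of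
  -- equations would only show their values.
  record _≈_ (a b : Series) : Set where
    constructor pointwise
    field at : ∀ m → a m ≡ b m
  open _≈_ public

  ≈-isEquivalence : IsEquivalence _≈_
  ≈-isEquivalence = record
    { refl = pointwise (λ _ → refl)
    ; sym = λ h → pointwise (λ m → sym (h .at m))
    ; trans = λ h k → pointwise (λ m → trans (h .at m) (k .at m)) }

  open IsEquivalence ≈-isEquivalence public using () renaming (refl to ≈-refl; sym to ≈-sym; trans to ≈-trans)

  0s 1s : Series
  0s m = 0ℚ
  1s m = if m ≡ᵇ 0 then 1ℚ else 0ℚ

  shift : Series → Series
  shift a m = a (suc m)

  X : Series → Series
  X a zero = 0ℚ
  X a (suc m) = a m

  X-cong : ∀ {a b} → a ≈ b → X a ≈ X b
  X-cong h .at zero = refl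
  X-cong h .at (suc m) = h .at m

  -- The operations are opaque so that unification treats them as injective.
  opaque
    _⊗_ _⊕_ : Series → Series → Series
    _⊗_ = _⊛_
    (a ⊕ b) m = a m + b m

    scale : ℚ → Series → Series
    scale c a m = c * a m

    D : Series → Series
    D a m = fromℕ (suc m) * a (suc m)

    ⊗-⊛ : ∀ a b → a ⊗ b ≈ a ⊛ b
    ⊗-⊛ a b .at m = refl

    ⊕-at : ∀ a b m → (a ⊕ b) m ≡ a m + b m
    ⊕-at a b m = refl

    scale-at : ∀ c a m → scale c a m ≡ c * a m
    scale-at c a m = refl

    D-at : ∀ a m → D a m ≡ fromℕ (suc m) * a (suc m)
    D-at a m = refl

    ⊕-cong : ∀ {a a′ b b′} → a ≈ a′ → b ≈ b′ → a ⊕ b ≈ a′ ⊕ b′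
    ⊕-cong h k .at m = cong₂ _+_ (h .at m) (k .at m)

    ⊕-assoc : ∀ a b c → (a ⊕ b) ⊕ c ≈ a ⊕ (b ⊕ c)
    ⊕-assoc a b c .at m = +-assoc (a m) (b m) (c m)

    ⊕-comm : ∀ a b → a ⊕ b ≈ b ⊕ a
    ⊕-comm a b .at m = +-comm (a m) (b m)

    ⊕-identityˡ : ∀ a → 0s ⊕ a ≈ a
    ⊕-identityˡ a .at m = +-identityˡ (a m)

    ⊕-identityʳ : ∀ a → a ⊕ 0s ≈ a
    ⊕-identityʳ a .at m = +-identityʳ (a m)

    ⊗-zero : ∀ a b → (a ⊗ b) 0 ≡ a 0 * b 0
    ⊗-zero a b = +-identityʳ (a 0 * b 0)

    ⊗-suc : ∀ a b m → (a ⊗ b) (suc m) ≡ a 0 * b (suc m) + (shift a ⊗ b) m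
    ⊗-suc a b m = Σ<-suc (suc m) (λ i → a i * b (suc m ∸ i))

    -- Coefficient `m` of a product sees only coefficients up to `m`; this lets a truncated
    -- composition stand for the full one inside a product.
    ⊗-cong-≤ : ∀ m {a a′ b b′} → (∀ i → i ≤ m → a i ≡ a′ i) → (∀ i → i ≤ m → b i ≡ b′ i) →
      (a ⊗ b) m ≡ (a′ ⊗ b′) m
    ⊗-cong-≤ m ha hb = Σ<-cong (suc m) (λ { i (s≤s i≤m) → cong₂ _*_ (ha i i≤m) (hb (m ∸ i) (ℕₚ.m∸n≤m m i)) })

    ⊗-cong : ∀ {a a′ b b′} → a ≈ a′ → b ≈ b′ → a ⊗ b ≈ a′ ⊗ b′
    ⊗-cong ha hb .at m = ⊗-cong-≤ m (λ i _ → ha .at i) (λ i _ → hb .at i)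

    -- The mirror image of `⊗-suc`; together they give commutativity by recursion, without reversing
    -- a sum.
    ⊗-sucʳ : ∀ m a b → (a ⊗ b) (suc m) ≡ a (suc m) * b 0 + (a ⊗ shift b) m
    ⊗-sucʳ zero a b = begin
      (a ⊗ b) 1                              ≡⟨ ⊗-suc a b 0 ⟩
      a 0 * b 1 + (shift a ⊗ b) 0            ≡⟨ cong (a 0 * b 1 +_) (⊗-zero (shift a) b) ⟩
      a 0 * b 1 + a 1 * b 0                  ≡⟨ +-comm (a 0 * b 1) _ ⟩
      a 1 * b 0 + a 0 * b 1                  ≡⟨ cong (a 1 * b 0 +_) (sym (⊗-zero a (shift b))) ⟩
      a 1 * b 0 + (a ⊗ shift b) 0            ∎
      where open ≡-Reasoning
    ⊗-sucʳ (suc m) a b = begin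
      (a ⊗ b) (2 ℕ.+ m)                                       ≡⟨ ⊗-suc a b (suc m) ⟩
      a 0 * b (2 ℕ.+ m) + (shift a ⊗ b) (suc m)               ≡⟨ cong (a 0 * b (2 ℕ.+ m) +_) (⊗-sucʳ m (shift a) b) ⟩
      a 0 * b (2 ℕ.+ m) + (a (2 ℕ.+ m) * b 0 + (shift a ⊗ shift b) m)
        ≡⟨ solve 3 (λ x y z → x :+ (y :+ z) := y :+ (x :+ z)) refl (a 0 * b (2 ℕ.+ m)) (a (2 ℕ.+ m) * b 0) _ ⟩
      a (2 ℕ.+ m) * b 0 + (a 0 * b (2 ℕ.+ m) + (shift a ⊗ shift b) m)
        ≡⟨ cong (a (2 ℕ.+ m) * b 0 +_) (sym (⊗-suc a (shift b) m)) ⟩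
      a (2 ℕ.+ m) * b 0 + (a ⊗ shift b) (suc m)               ∎
      where open ≡-Reasoning

    ⊗-comm : ∀ a b → a ⊗ b ≈ b ⊗ a
    ⊗-comm a b .at m = go m a b
      where
      go : ∀ m a b → (a ⊗ b) m ≡ (b ⊗ a) m
      go zero a b = trans (⊗-zero a b) (trans (*-comm (a 0) _) (sym (⊗-zero b a)))
      go (suc m) a b = trans (⊗-suc a b m)
        (trans (cong₂ _+_ (*-comm (a 0) _) (go m (shift a) b)) (sym (⊗-sucʳ m b a)))

    ⊗-distribʳ : ∀ c a b → (a ⊕ b) ⊗ c ≈ a ⊗ c ⊕ b ⊗ c
    ⊗-distribʳ c a b .at m = trans
      (Σ<-cong (suc m) (λ i _ → *-distribʳ-+ (c (m ∸ i)) (a i) (b i)))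
      (Σ<-+ (suc m) (λ i → a i * c (m ∸ i)) (λ i → b i * c (m ∸ i)))

    scale-⊗ : ∀ c a b → scale c a ⊗ b ≈ scale c (a ⊗ b)
    scale-⊗ c a b .at m = trans
      (Σ<-cong (suc m) (λ i _ → *-assoc c (a i) (b (m ∸ i))))
      (sym (Σ<-* (suc m) c _))

    ⊗-assoc : ∀ a b c → (a ⊗ b) ⊗ c ≈ a ⊗ (b ⊗ c)
    ⊗-assoc a b c .at m = go m a
      where
      open ≡-Reasoning
      go : ∀ m a → ((a ⊗ b) ⊗ c) m ≡ (a ⊗ (b ⊗ c)) m
      go zero a = begin
        ((a ⊗ b) ⊗ c) 0     ≡⟨ ⊗-zero (a ⊗ b) c ⟩
        (a ⊗ b) 0 * c 0     ≡⟨ cong (_* c 0) (⊗-zero a b) ⟩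
        a 0 * b 0 * c 0     ≡⟨ *-assoc (a 0) _ _ ⟩
        a 0 * (b 0 * c 0)   ≡⟨ cong (a 0 *_) (sym (⊗-zero b c)) ⟩
        a 0 * (b ⊗ c) 0     ≡⟨ sym (⊗-zero a (b ⊗ c)) ⟩
        (a ⊗ (b ⊗ c)) 0     ∎
      go (suc m) a = begin
        ((a ⊗ b) ⊗ c) (suc m)
          ≡⟨ ⊗-suc (a ⊗ b) c m ⟩
        (a ⊗ b) 0 * c (suc m) + (shift (a ⊗ b) ⊗ c) m
          ≡⟨ cong₂ (λ u v → u * c (suc m) + v) (⊗-zero a b)
               (⊗-cong-≤ m {b = c} (λ i _ → ⊗-suc a b i) (λ _ _ → refl)) ⟩
        a 0 * b 0 * c (suc m) + ((scale (a 0) (shift b) ⊕ (shift a ⊗ b)) ⊗ c) m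
          ≡⟨ cong (a 0 * b 0 * c (suc m) +_) (⊗-distribʳ c (scale (a 0) (shift b)) (shift a ⊗ b) .at m) ⟩
        a 0 * b 0 * c (suc m) + ((scale (a 0) (shift b) ⊗ c) m + ((shift a ⊗ b) ⊗ c) m)
          ≡⟨ cong₂ (λ u v → a 0 * b 0 * c (suc m) + (u + v)) (scale-⊗ (a 0) (shift b) c .at m) (go m (shift a)) ⟩
        a 0 * b 0 * c (suc m) + (a 0 * (shift b ⊗ c) m + (shift a ⊗ (b ⊗ c)) m)
          ≡⟨ solve 5 (λ x y z u v → x :* y :* z :+ (x :* u :+ v) := x :* (y :* z :+ u) :+ v) refl (a 0) (b 0) (c (suc m)) _ _ ⟩
        a 0 * (b 0 * c (suc m) + (shift b ⊗ c) m) + (shift a ⊗ (b ⊗ c)) m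
          ≡⟨ cong (λ u → a 0 * u + (shift a ⊗ (b ⊗ c)) m) (sym (⊗-suc b c m)) ⟩
        a 0 * (b ⊗ c) (suc m) + (shift a ⊗ (b ⊗ c)) m
          ≡⟨ sym (⊗-suc a (b ⊗ c) m) ⟩
        (a ⊗ (b ⊗ c)) (suc m) ∎

    ⊗-zeroˡ : ∀ a → 0s ⊗ a ≈ 0s
    ⊗-zeroˡ a .at m = trans (sym (Σ<-* (suc m) 0ℚ (λ i → a (m ∸ i)))) (*-zeroˡ (Σ< (suc m) (λ i → a (m ∸ i))))

    ⊗-identityˡ : ∀ a → 1s ⊗ a ≈ a
    ⊗-identityˡ a .at zero = trans (⊗-zero 1s a) (*-identityˡ (a 0))
    ⊗-identityˡ a .at (suc m) = trans (⊗-suc 1s a m)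
      (trans (cong₂ _+_ (*-identityˡ (a (suc m))) (⊗-zeroˡ a .at m)) (+-identityʳ (a (suc m))))

    X-⊗ : ∀ a b → X a ⊗ b ≈ X (a ⊗ b)
    X-⊗ a b .at zero = trans (⊗-zero (X a) b) (*-zeroˡ (b 0))
    X-⊗ a b .at (suc m) = trans (⊗-suc (X a) b m)
      (trans (cong (_+ (a ⊗ b) m) (*-zeroˡ (b (suc m)))) (+-identityˡ _))

    D-cong : ∀ {a b} → a ≈ b → D a ≈ D b
    D-cong h .at m = cong (fromℕ (suc m) *_) (h .at (suc m))

    D-⊕ : ∀ a b → D (a ⊕ b) ≈ D a ⊕ D b
    D-⊕ a b .at m = *-distribˡ-+ (fromℕ (suc m)) _ _

    D-1s : D 1s ≈ 0s
    D-1s .at m = *-zeroʳ (fromℕ (suc m))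

    -- After peeling off `a 0`, the factor m+2 leaves one copy of the remaining product beyond the
    -- m+1 used by the induction; it is absorbed by `shift (D a) = D (shift a) + shift (shift a)`.
    D-⊗ : ∀ a b → D (a ⊗ b) ≈ D a ⊗ b ⊕ a ⊗ D b
    D-⊗ a b .at m = go m a
      where
      open ≡-Reasoning
      go : ∀ m a → D (a ⊗ b) m ≡ (D a ⊗ b ⊕ a ⊗ D b) m
      go zero a = begin
        fromℕ 1 * (a ⊗ b) 1                    ≡⟨ *-identityˡ _ ⟩
        (a ⊗ b) 1                              ≡⟨ ⊗-suc a b 0 ⟩
        a 0 * b 1 + (shift a ⊗ b) 0            ≡⟨ cong (a 0 * b 1 +_) (⊗-zero (shift a) b) ⟩
        a 0 * b 1 + a 1 * b 0
          ≡⟨ solve 4 (λ x y z w → x :* y :+ z :* w := con 1ℚ :* z :* w :+ x :* (con 1ℚ :* y)) refl (a 0) (b 1) (a 1) (b 0) ⟩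
        fromℕ 1 * a 1 * b 0 + a 0 * (fromℕ 1 * b 1)
          ≡⟨ sym (cong₂ _+_ (⊗-zero (D a) b) (⊗-zero a (D b))) ⟩
        (D a ⊗ b) 0 + (a ⊗ D b) 0              ∎
      go (suc m) a = begin
        fromℕ (2 ℕ.+ m) * (a ⊗ b) (2 ℕ.+ m)
          ≡⟨ cong (fromℕ (2 ℕ.+ m) *_) (⊗-suc a b (suc m)) ⟩
        fromℕ (2 ℕ.+ m) * (a 0 * b (2 ℕ.+ m) + s)
          ≡⟨ solve 4 (λ n x y s → n :* (x :* y :+ s) := x :* (n :* y) :+ n :* s) refl (fromℕ (2 ℕ.+ m)) (a 0) (b (2 ℕ.+ m)) s ⟩
        a 0 * D b (suc m) + fromℕ (2 ℕ.+ m) * s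
          ≡⟨ cong (λ n → a 0 * D b (suc m) + n * s) (fromℕ-suc (suc m)) ⟩
        a 0 * D b (suc m) + (1ℚ + fromℕ (suc m)) * s
          ≡⟨ solve 3 (λ u n s → u :+ (con 1ℚ :+ n) :* s := u :+ (n :* s :+ s)) refl (a 0 * D b (suc m)) (fromℕ (suc m)) s ⟩
        a 0 * D b (suc m) + (D (shift a ⊗ b) m + s)
          ≡⟨ cong₂ (λ u v → a 0 * D b (suc m) + (u + v)) (go m (shift a)) (⊗-suc (shift a) b m) ⟩
        a 0 * D b (suc m) + ((D (shift a) ⊗ b) m + (shift a ⊗ D b) m + (a 1 * b (suc m) + (shift (shift a) ⊗ b) m))
          ≡⟨ solve 6 (λ u v w x y z → u :+ (v :+ w :+ (x :* y :+ z)) := con 1ℚ :* x :* y :+ (v :+ z) :+ (u :+ w)) refl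
               (a 0 * D b (suc m)) ((D (shift a) ⊗ b) m) ((shift a ⊗ D b) m) (a 1) (b (suc m)) ((shift (shift a) ⊗ b) m) ⟩
        D a 0 * b (suc m) + ((D (shift a) ⊗ b) m + (shift (shift a) ⊗ b) m) + (a 0 * D b (suc m) + (shift a ⊗ D b) m)
          ≡⟨ cong₂ _+_ (cong (D a 0 * b (suc m) +_) (sym (trans
               (⊗-cong-≤ m {b = b} (λ i _ → shift-D i) (λ _ _ → refl))
               (⊗-distribʳ b (D (shift a)) (shift (shift a)) .at m)))) (sym (⊗-suc a (D b) m)) ⟩
        D a 0 * b (suc m) + (shift (D a) ⊗ b) m + (a ⊗ D b) (suc m)
          ≡⟨ cong (_+ (a ⊗ D b) (suc m)) (sym (⊗-suc (D a) b m)) ⟩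
        (D a ⊗ b) (suc m) + (a ⊗ D b) (suc m) ∎
        where
        s : ℚ
        s = (shift a ⊗ b) (suc m)
        shift-D : ∀ i → shift (D a) i ≡ (D (shift a) ⊕ shift (shift a)) i
        shift-D i = trans (cong (_* a (2 ℕ.+ i)) (fromℕ-suc (suc i)))
          (solve 2 (λ n x → (con 1ℚ :+ n) :* x := n :* x :+ x) refl (fromℕ (suc i)) (a (2 ℕ.+ i)))

    -- The substitute for integration: positive integers can be cancelled in ℚ.
    D-injective : ∀ {a b} → a 0 ≡ b 0 → D a ≈ D b → a ≈ b
    D-injective h0 h .at zero = h0
    D-injective h0 h .at (suc m) = fromℕ-cancel (suc m) (h .at m)

  -- Only a semiring, so equations such as sl'² = 1 - sl⁴ appear below with every term moved to its
  -- positive side.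
  seriesSemiring : CommutativeSemiring _ _
  seriesSemiring = record
    { Carrier = Series ; _≈_ = _≈_ ; _+_ = _⊕_ ; _*_ = _⊗_ ; 0# = 0s ; 1# = 1s
    ; isCommutativeSemiring = isCommutativeSemiringˡ record
      { +-isCommutativeMonoid = record
        { isMonoid = record
          { isSemigroup = record
            { isMagma = record { isEquivalence = ≈-isEquivalence ; ∙-cong = ⊕-cong }
            ; assoc = ⊕-assoc }
          ; identity = ⊕-identityˡ , ⊕-identityʳ }
        ; comm = ⊕-comm }
      ; *-isCommutativeMonoid = isCommutativeMonoidˡ record
        { isSemigroup = record
          { isMagma = record { isEquivalence = ≈-isEquivalence ; ∙-cong = ⊗-cong }
          ; assoc = ⊗-assoc }
        ; identityˡ = ⊗-identityˡ
        ; comm = ⊗-comm }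
      ; distribʳ = ⊗-distribʳ
      ; zeroˡ = ⊗-zeroˡ } }
    where
    open import Algebra.Structures.Biased _≈_ using (isCommutativeSemiringˡ; isCommutativeMonoidˡ)

  module S = NaturalCoefficients seriesSemiring
  module ≈-Reasoning = SetoidReasoning (CommutativeSemiring.setoid seriesSemiring)

  K : ℚ → Series
  K c = scale c 1s

  opaque
    unfolding _⊗_

    K-⊗ : ∀ c a → K c ⊗ a ≈ scale c a
    K-⊗ c a = ≈-trans (scale-⊗ c 1s a) (pointwise (λ m → cong (c *_) (⊗-identityˡ a .at m)))

    K-+ : ∀ c d → K (c + d) ≈ K c ⊕ K d
    K-+ c d .at m = *-distribʳ-+ (1s m) c d

    K-1 : K 1ℚ ≈ 1s
    K-1 .at m = *-identityˡ (1s m)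

  _↑_ : Series → ℕ → Series
  a ↑ zero = 1s
  a ↑ suc p = a ⊗ a ↑ p

  pow-↑ : ∀ a p → pow a p ≈ a ↑ p
  pow-↑ a zero = pointwise (λ _ → refl)
  pow-↑ a (suc p) = ≈-trans (≈-sym (⊗-⊛ a (pow a p))) (⊗-cong ≈-refl (pow-↑ a p))

  ↑-+ : ∀ a p q → a ↑ (p ℕ.+ q) ≈ a ↑ p ⊗ a ↑ q
  ↑-+ a zero q = ≈-sym (⊗-identityˡ _)
  ↑-+ a (suc p) q = ≈-trans (⊗-cong ≈-refl (↑-+ a p q)) (≈-sym (⊗-assoc a (a ↑ p) (a ↑ q)))

  ↑-* : ∀ a p k → a ↑ (k ℕ.* p) ≈ (a ↑ p) ↑ k
  ↑-* a p zero = ≈-refl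
  ↑-* a p (suc k) = ≈-trans (↑-+ a p (k ℕ.* p)) (⊗-cong ≈-refl (↑-* a p k))

  D-↑ : ∀ a p → D (a ↑ suc p) ≈ K (fromℕ (suc p)) ⊗ (a ↑ p ⊗ D a)
  D-↑ a zero = begin
    D (a ⊗ 1s)                    ≈⟨ D-cong (≈-trans (⊗-comm a 1s) (⊗-identityˡ a)) ⟩
    D a                           ≈⟨ ≈-sym (⊗-identityˡ (D a)) ⟩
    1s ⊗ D a                      ≈⟨ ≈-sym (⊗-identityˡ _) ⟩
    1s ⊗ (1s ⊗ D a)               ≈⟨ ⊗-cong (≈-sym K-1) ≈-refl ⟩
    K (fromℕ 1) ⊗ (1s ⊗ D a)      ∎
    where open ≈-Reasoning
  D-↑ a (suc p) = begin
    D (a ⊗ a ↑ suc p)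
      ≈⟨ D-⊗ a (a ↑ suc p) ⟩
    D a ⊗ a ↑ suc p ⊕ a ⊗ D (a ↑ suc p)
      ≈⟨ ⊕-cong ≈-refl (⊗-cong ≈-refl (D-↑ a p)) ⟩
    D a ⊗ (a ⊗ a ↑ p) ⊕ a ⊗ (K (fromℕ (suc p)) ⊗ (a ↑ p ⊗ D a))
      ≈⟨ S.solve 4 (λ d a q k → d S.:* (a S.:* q) S.:+ a S.:* (k S.:* (q S.:* d)) S.:= (S.con 1 S.:+ k) S.:* ((a S.:* q) S.:* d))
           ≈-refl (D a) a (a ↑ p) (K (fromℕ (suc p))) ⟩
    (1s ⊕ K (fromℕ (suc p))) ⊗ (a ↑ suc p ⊗ D a)
      ≈⟨ ⊗-cong (⊕-cong (≈-sym K-1) ≈-refl) ≈-refl ⟩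
    (K 1ℚ ⊕ K (fromℕ (suc p))) ⊗ (a ↑ suc p ⊗ D a)
      ≈⟨ ⊗-cong (≈-sym (K-+ 1ℚ (fromℕ (suc p)))) ≈-refl ⟩
    K (1ℚ + fromℕ (suc p)) ⊗ (a ↑ suc p ⊗ D a)
      ≡⟨ cong (λ c → K c ⊗ (a ↑ suc p ⊗ D a)) (sym (fromℕ-suc (suc p))) ⟩
    K (fromℕ (2 ℕ.+ p)) ⊗ (a ↑ suc p ⊗ D a) ∎
    where open ≈-Reasoning

  opaque
    ΣS : ℕ → (ℕ → Series) → Series
    ΣS N f m = Σ< N (λ j → f j m)

    ΣS-at : ∀ N f m → ΣS N f m ≡ Σ< N (λ j → f j m)
    ΣS-at N f m = refl

    ΣS-zero : ∀ f → ΣS 0 f ≈ 0s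
    ΣS-zero f .at m = refl

    ΣS-suc : ∀ N f → ΣS (suc N) f ≈ f 0 ⊕ ΣS N (f ∘ suc)
    ΣS-suc N f .at m = trans (Σ<-suc N (λ j → f j m)) (sym (⊕-at (f 0) (ΣS N (f ∘ suc)) m))

    ΣS-cong : ∀ N {f g} → (∀ j → f j ≈ g j) → ΣS N f ≈ ΣS N g
    ΣS-cong N h .at m = Σ<-cong N (λ j _ → h j .at m)

    D-ΣS : ∀ N f → D (ΣS N f) ≈ ΣS N (λ j → D (f j))
    D-ΣS N f .at m = trans (D-at (ΣS N f) m) (trans (Σ<-* N (fromℕ (suc m)) (λ j → f j (suc m)))
      (Σ<-cong N (λ j _ → sym (D-at (f j) m))))

  ΣS-⊗ : ∀ N f a → ΣS N f ⊗ a ≈ ΣS N (λ j → f j ⊗ a)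
  ΣS-⊗ zero f a = ≈-trans (⊗-cong (ΣS-zero f) ≈-refl) (≈-trans (⊗-zeroˡ a) (≈-sym (ΣS-zero _)))
  ΣS-⊗ (suc N) f a = begin
    ΣS (suc N) f ⊗ a                        ≈⟨ ⊗-cong (ΣS-suc N f) ≈-refl ⟩
    (f 0 ⊕ ΣS N (f ∘ suc)) ⊗ a              ≈⟨ ⊗-distribʳ a _ _ ⟩
    f 0 ⊗ a ⊕ ΣS N (f ∘ suc) ⊗ a            ≈⟨ ⊕-cong ≈-refl (ΣS-⊗ N (f ∘ suc) a) ⟩
    f 0 ⊗ a ⊕ ΣS N (λ j → f (suc j) ⊗ a)    ≈⟨ ≈-sym (ΣS-suc N (λ j → f j ⊗ a)) ⟩
    ΣS (suc N) (λ j → f j ⊗ a)              ∎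
    where open ≈-Reasoning

  -- Each factor without constant term raises the order by one.
  ↑-vanish : ∀ {x} → x 0 ≡ 0ℚ → ∀ j m → m < j → (x ↑ j) m ≡ 0ℚ
  ↑-vanish {x} x0 (suc j) zero _ = trans (⊗-zero x (x ↑ j)) (trans (cong (_* (x ↑ j) 0) x0) (*-zeroˡ ((x ↑ j) 0)))
  ↑-vanish {x} x0 (suc j) (suc m) (s≤s m<j) = trans (⊗-suc x (x ↑ j) m) (trans
    (cong₂ _+_ (trans (cong (_* (x ↑ j) (suc m)) x0) (*-zeroˡ ((x ↑ j) (suc m))))
      (trans (⊗-cong-≤ m {a = shift x} {b′ = 0s} (λ _ _ → refl) (λ i i≤m → ↑-vanish x0 j i (ℕₚ.≤-<-trans i≤m m<j)))
        (trans (⊗-comm (shift x) 0s .at m) (⊗-zeroˡ (shift x) .at m))))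
    (+-identityˡ 0ℚ))

  Σ<-truncate : ∀ M d {f} → (∀ j → M ≤ j → f j ≡ 0ℚ) → Σ< (d ℕ.+ M) f ≡ Σ< M f
  Σ<-truncate M zero h = refl
  Σ<-truncate M (suc d) {f} h = trans (Σ<-last (d ℕ.+ M) f)
    (trans (cong₂ _+_ (Σ<-truncate M d h) (h (d ℕ.+ M) (ℕₚ.m≤n+m M d))) (+-identityʳ (Σ< M f)))

  opaque
    -- The composite of `ψ` with `x`, meant for `x 0 ≡ 0ℚ`: the powers cut off at degree `m` then
    -- vanish there by `↑-vanish`.
    comp : Series → Series → Series
    comp ψ x m = Σ< (suc m) (λ j → ψ j * (x ↑ j) m)

    comp-at : ∀ ψ x m → comp ψ x m ≡ Σ< (suc m) (λ j → ψ j * (x ↑ j) m)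
    comp-at ψ x m = refl

  -- Replaces the cut-off that varies with the coefficient by a common one, so that series
  -- operations apply to an honest finite sum.
  comp-truncate : ∀ ψ {x} → x 0 ≡ 0ℚ → ∀ N m → m < N → ΣS N (λ j → scale (ψ j) (x ↑ j)) m ≡ comp ψ x m
  comp-truncate ψ {x} x0 N m m<N = begin
    ΣS N (λ j → scale (ψ j) (x ↑ j)) m
      ≡⟨ ΣS-at N _ m ⟩
    Σ< N (λ j → scale (ψ j) (x ↑ j) m)
      ≡⟨ Σ<-cong N (λ j _ → scale-at (ψ j) (x ↑ j) m) ⟩
    Σ< N (λ j → ψ j * (x ↑ j) m)
      ≡⟨ cong (λ n → Σ< n (λ j → ψ j * (x ↑ j) m)) (sym (ℕₚ.m∸n+n≡m m<N)) ⟩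
    Σ< (N ∸ suc m ℕ.+ suc m) (λ j → ψ j * (x ↑ j) m)
      ≡⟨ Σ<-truncate (suc m) (N ∸ suc m) (λ j m<j → trans (cong (ψ j *_) (↑-vanish x0 j m m<j)) (*-zeroʳ (ψ j))) ⟩
    Σ< (suc m) (λ j → ψ j * (x ↑ j) m)
      ≡⟨ sym (comp-at ψ x m) ⟩
    comp ψ x m ∎
    where open ≡-Reasoning

  comp-zero : ∀ ψ {x} → x 0 ≡ 0ℚ → comp ψ x 0 ≡ ψ 0
  comp-zero ψ {x} x0 = trans (comp-at ψ x 0) (solve 1 (λ p → p :* con 1ℚ :+ con 0ℚ := p) refl (ψ 0))

  opaque
    unfolding comp

    comp-cong : ∀ {ψ χ} x → ψ ≈ χ → comp ψ x ≈ comp χ x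
    comp-cong x h .at m = Σ<-cong (suc m) (λ j _ → cong (_* (x ↑ j) m) (h .at j))

    comp-⊕ : ∀ ψ χ x → comp (ψ ⊕ χ) x ≈ comp ψ x ⊕ comp χ x
    comp-⊕ ψ χ x .at m = trans
      (Σ<-cong (suc m) (λ j _ → trans (cong (_* (x ↑ j) m) (⊕-at ψ χ j)) (*-distribʳ-+ ((x ↑ j) m) (ψ j) (χ j))))
      (trans (Σ<-+ (suc m) (λ j → ψ j * (x ↑ j) m) (λ j → χ j * (x ↑ j) m)) (sym (⊕-at (comp ψ x) (comp χ x) m)))

  -- Horner's scheme. For `x = τ` it mirrors the choice between the empty forest and a first tree
  -- followed by a forest.
  comp-unfold : ∀ ψ {x} → x 0 ≡ 0ℚ → comp ψ x ≈ K (ψ 0) ⊕ x ⊗ comp (shift ψ) x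
  comp-unfold ψ {x} x0 .at m = begin
    comp ψ x m
      ≡⟨ sym (comp-truncate ψ x0 (2 ℕ.+ m) m (ℕₚ.m≤n+m _ 1)) ⟩
    ΣS (2 ℕ.+ m) (λ j → scale (ψ j) (x ↑ j)) m
      ≡⟨ ΣS-suc (suc m) (λ j → scale (ψ j) (x ↑ j)) .at m ⟩
    (K (ψ 0) ⊕ ΣS (suc m) (λ j → scale (ψ (suc j)) (x ⊗ x ↑ j))) m
      ≡⟨ ⊕-cong ≈-refl (ΣS-cong (suc m) (λ j → pointwise (λ i → swap j i))) .at m ⟩
    (K (ψ 0) ⊕ ΣS (suc m) (λ j → scale (ψ (suc j)) (x ↑ j) ⊗ x)) m
      ≡⟨ ⊕-cong ≈-refl (≈-sym (ΣS-⊗ (suc m) (λ j → scale (ψ (suc j)) (x ↑ j)) x)) .at m ⟩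
    (K (ψ 0) ⊕ ΣS (suc m) (λ j → scale (ψ (suc j)) (x ↑ j)) ⊗ x) m
      ≡⟨ ⊕-at _ _ m ⟩
    K (ψ 0) m + (ΣS (suc m) (λ j → scale (ψ (suc j)) (x ↑ j)) ⊗ x) m
      ≡⟨ cong (K (ψ 0) m +_) (⊗-cong-≤ m {b = x} (λ i i≤m → comp-truncate (shift ψ) x0 (suc m) i (s≤s i≤m)) (λ _ _ → refl)) ⟩
    K (ψ 0) m + (comp (shift ψ) x ⊗ x) m
      ≡⟨ cong (K (ψ 0) m +_) (⊗-comm _ x .at m) ⟩
    K (ψ 0) m + (x ⊗ comp (shift ψ) x) m
      ≡⟨ sym (⊕-at _ _ m) ⟩
    (K (ψ 0) ⊕ x ⊗ comp (shift ψ) x) m ∎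
    where
    open ≡-Reasoning
    swap : ∀ j i → scale (ψ (suc j)) (x ⊗ x ↑ j) i ≡ (scale (ψ (suc j)) (x ↑ j) ⊗ x) i
    swap j i = trans (scale-at _ _ i) (trans (cong (ψ (suc j) *_) (⊗-comm x (x ↑ j) .at i))
      (trans (sym (scale-at _ _ i)) (sym (scale-⊗ (ψ (suc j)) (x ↑ j) x .at i))))

  D-scale-↑ : ∀ c x j → D (scale c (x ↑ suc j)) ≈ scale (fromℕ (suc j) * c) (x ↑ j) ⊗ D x
  D-scale-↑ c x j .at m = begin
    D (scale c (x ↑ suc j)) m
      ≡⟨ trans (D-at _ m) (cong (fromℕ (suc m) *_) (scale-at c (x ↑ suc j) (suc m))) ⟩
    fromℕ (suc m) * (c * (x ↑ suc j) (suc m))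
      ≡⟨ solve 3 (λ a b c → a :* (b :* c) := b :* (a :* c)) refl (fromℕ (suc m)) c ((x ↑ suc j) (suc m)) ⟩
    c * (fromℕ (suc m) * (x ↑ suc j) (suc m))
      ≡⟨ cong (c *_) (sym (D-at (x ↑ suc j) m)) ⟩
    c * D (x ↑ suc j) m
      ≡⟨ cong (c *_) (trans (D-↑ x j .at m) (trans (K-⊗ (fromℕ (suc j)) (x ↑ j ⊗ D x) .at m) (scale-at _ _ m))) ⟩
    c * (fromℕ (suc j) * (x ↑ j ⊗ D x) m)
      ≡⟨ solve 3 (λ a b c → a :* (b :* c) := b :* a :* c) refl c (fromℕ (suc j)) ((x ↑ j ⊗ D x) m) ⟩
    fromℕ (suc j) * c * (x ↑ j ⊗ D x) m
      ≡⟨ sym (trans (scale-⊗ (fromℕ (suc j) * c) (x ↑ j) (D x) .at m) (scale-at _ _ m)) ⟩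
    (scale (fromℕ (suc j) * c) (x ↑ j) ⊗ D x) m ∎
    where open ≡-Reasoning

  D-K : ∀ c → D (K c) ≈ 0s
  D-K c .at m = trans (D-at _ m) (trans (cong (fromℕ (suc m) *_) (scale-at c 1s (suc m)))
    (solve 2 (λ a b → a :* (b :* con 0ℚ) := con 0ℚ) refl (fromℕ (suc m)) c))

  D-comp : ∀ ψ {x} → x 0 ≡ 0ℚ → D (comp ψ x) ≈ comp (D ψ) x ⊗ D x
  D-comp ψ {x} x0 .at m = begin
    D (comp ψ x) m
      -- Coefficient `m` of a derivative reads coefficient `suc m`, hence length `2 + m`;
      -- differentiation kills the constant term and leaves `suc m` terms.
      ≡⟨ trans (D-at _ m) (cong (fromℕ (suc m) *_) (sym (comp-truncate ψ x0 (2 ℕ.+ m) (suc m) ℕₚ.≤-refl))) ⟩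
    fromℕ (suc m) * ΣS (2 ℕ.+ m) (λ j → scale (ψ j) (x ↑ j)) (suc m)
      ≡⟨ sym (D-at _ m) ⟩
    D (ΣS (2 ℕ.+ m) (λ j → scale (ψ j) (x ↑ j))) m
      ≡⟨ terms .at m ⟩
    (ΣS (suc m) (λ j → scale (D ψ j) (x ↑ j)) ⊗ D x) m
      ≡⟨ ⊗-cong-≤ m {b = D x} (λ i i≤m → comp-truncate (D ψ) x0 (suc m) i (s≤s i≤m)) (λ _ _ → refl) ⟩
    (comp (D ψ) x ⊗ D x) m ∎
    where
    open ≡-Reasoning
    term : ∀ j → D (scale (ψ (suc j)) (x ↑ suc j)) ≈ scale (D ψ j) (x ↑ j) ⊗ D x
    term j = ≈-trans (D-scale-↑ (ψ (suc j)) x j) (pointwise (λ i → cong (λ c → (scale c (x ↑ j) ⊗ D x) i) (sym (D-at ψ j))))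
    terms : D (ΣS (2 ℕ.+ m) (λ j → scale (ψ j) (x ↑ j))) ≈ ΣS (suc m) (λ j → scale (D ψ j) (x ↑ j)) ⊗ D x
    terms = ≈-trans (D-cong (ΣS-suc (suc m) (λ j → scale (ψ j) (x ↑ j))))
      (≈-trans (D-⊕ (K (ψ 0)) (ΣS (suc m) (λ j → scale (ψ (suc j)) (x ↑ suc j))))
      (≈-trans (⊕-cong (D-K (ψ 0)) (D-ΣS (suc m) (λ j → scale (ψ (suc j)) (x ↑ suc j))))
      (≈-trans (⊕-identityˡ _)
      (≈-trans (ΣS-cong (suc m) term)
      (≈-sym (ΣS-⊗ (suc m) (λ j → scale (D ψ j) (x ↑ j)) (D x)))))))

  Z : Series
  Z = X 1s

  Z-⊗ : ∀ a → Z ⊗ a ≈ X a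
  Z-⊗ a = ≈-trans (X-⊗ 1s a) (X-cong (⊗-identityˡ a))

  D-Z : D Z ≈ 1s
  D-Z .at zero = D-at Z 0
  D-Z .at (suc m) = trans (D-at Z (suc m)) (*-zeroʳ (fromℕ (2 ℕ.+ m)))

  -- The Euler operator z d/dz, which turns coefficient recurrences linear in `m` into differential
  -- equations.
  X-D-at : ∀ a m → X (D a) m ≡ fromℕ m * a m
  X-D-at a zero = sym (*-zeroˡ (a 0))
  X-D-at a (suc m) = D-at a m

  comp-X : ∀ ψ {x} → x 0 ≡ 0ℚ → comp (X ψ) x ≈ x ⊗ comp ψ x
  comp-X ψ {x} x0 = ≈-trans (comp-unfold (X ψ) x0) (≈-trans (⊕-cong K-0 ≈-refl) (⊕-identityˡ _))
    where
    K-0 : K 0ℚ ≈ 0s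
    K-0 .at m = trans (scale-at 0ℚ 1s m) (*-zeroˡ (1s m))

-- Differential equations of the tree series

module TreeSeries where

  open HookLength using (hook; hookF; ℓ-hook)
  open PowerSeries
  open import Data.Nat as ℕ using (ℕ; zero; suc; _∸_; _!; _<_; z≤n; s≤s)
  import Data.Nat.Properties as ℕₚ
  open import Data.Nat.Solver using () renaming (module +-*-Solver to N)
  open import Data.Rational using (ℚ; 0ℚ; 1ℚ; _+_; _*_)
  open import Data.Rational.Properties
  open import Data.Rational.Solver using (module +-*-Solver)
  open +-*-Solver using (solve; _:+_; _:*_; _:=_; con)
  open import Data.Bool using (true; false; not; if_then_else_)
  open import Data.List using (List; []; _∷_; _++_; map; concatMap; upTo; applyUpTo; foldr; length)
  open import Data.List.Properties using (map-++)
  open import Data.List.Relation.Unary.All as All using (All; []; _∷_)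
  open import Data.List.Relation.Unary.All.Properties using (concat⁺; map⁺; applyUpTo⁺₁)
  open import Function using (_∘_)
  open import Relation.Binary.PropositionalEquality

  sumOver : {A : Set} → (A → ℚ) → List A → ℚ
  sumOver f = foldr (λ x acc → f x + acc) 0ℚ

  module _ {A : Set} where

    sumOver-++ : ∀ (f : A → ℚ) xs ys → sumOver f (xs ++ ys) ≡ sumOver f xs + sumOver f ys
    sumOver-++ f [] ys = sym (+-identityˡ _)
    sumOver-++ f (x ∷ xs) ys = trans (cong (f x +_) (sumOver-++ f xs ys)) (sym (+-assoc (f x) _ _))

    sumOver-cong : ∀ {f g : A → ℚ} {xs} → All (λ x → f x ≡ g x) xs → sumOver f xs ≡ sumOver g xs
    sumOver-cong [] = refl
    sumOver-cong (h ∷ hs) = cong₂ _+_ h (sumOver-cong hs)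

    sumOver-* : ∀ c (f : A → ℚ) xs → c * sumOver f xs ≡ sumOver (λ x → c * f x) xs
    sumOver-* c f [] = *-zeroʳ c
    sumOver-* c f (x ∷ xs) = trans (*-distribˡ-+ c (f x) _) (cong (c * f x +_) (sumOver-* c f xs))

  sumOver-map : {A B : Set} (f : B → ℚ) (g : A → B) (xs : List A) → sumOver f (map g xs) ≡ sumOver (f ∘ g) xs
  sumOver-map f g [] = refl
  sumOver-map f g (x ∷ xs) = cong (f (g x) +_) (sumOver-map f g xs)

  sumOver-concatMap : {A B : Set} (f : B → ℚ) (g : A → List B) (xs : List A) →
    sumOver f (concatMap g xs) ≡ sumOver (λ x → sumOver f (g x)) xs
  sumOver-concatMap f g [] = refl
  sumOver-concatMap f g (x ∷ xs) = trans (sumOver-++ f (g x) _) (cong (sumOver f (g x) +_) (sumOver-concatMap f g xs))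

  concatMap-applyUpTo-cong : {A : Set} {f g : ℕ → List A} (h : ℕ → ℕ) (n : ℕ) →
    (∀ i → i < n → f (h i) ≡ g (h i)) → concatMap f (applyUpTo h n) ≡ concatMap g (applyUpTo h n)
  concatMap-applyUpTo-cong h zero e = refl
  concatMap-applyUpTo-cong h (suc n) e =
    cong₂ _++_ (e 0 (s≤s z≤n)) (concatMap-applyUpTo-cong (h ∘ suc) n (λ i i<n → e (suc i) (s≤s i<n)))

  -- Nested calls run on leftover fuel, while `τ` refers to forests with fuel exactly one above
  -- their size; the two lists must be identified.
  forestsF-fuel : ∀ f f′ n → n < f → n < f′ → forestsF f n ≡ forestsF f′ n
  forestsF-fuel (suc f) (suc f′) zero _ _ = refl
  forestsF-fuel (suc f) (suc f′) (suc n) (s≤s p) (s≤s q) =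
    concatMap-applyUpTo-cong (λ i → i) (suc n) (λ { k (s≤s k≤n) →
      cong₂ (λ us vs → concatMap (λ t → map (t ∷_) vs) (map node us))
        (forestsF-fuel f f′ k (ℕₚ.≤-<-trans k≤n p) (ℕₚ.≤-<-trans k≤n q))
        (forestsF-fuel f f′ (n ∸ k) (ℕₚ.≤-<-trans (ℕₚ.m∸n≤m n k) p) (ℕₚ.≤-<-trans (ℕₚ.m∸n≤m n k) q)) })

  -- Makes factors that depend on the size of a tree constant throughout the sum.
  forestsF-size : ∀ f n → All (λ ts → sizeF ts ≡ n) (forestsF f n)
  forestsF-size zero n = []
  forestsF-size (suc f) zero = refl ∷ []
  forestsF-size (suc f) (suc n) = concat⁺ (map⁺ (applyUpTo⁺₁ (λ i → i) (suc n) (λ { {k} (s≤s k≤n) →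
    concat⁺ (map⁺ (map⁺ (All.map (λ {us} eu → map⁺ (All.map (λ {ts} et →
      cong suc (trans (cong₂ ℕ._+_ eu et) (ℕₚ.m+[n∸m]≡n k≤n))) (forestsF-size f (n ∸ k)))) (forestsF-size f k)))) })))

  -- By `ℓ-hook` this is the reciprocal of `hook t`, hence a product over the nodes.
  labelDensity : Tree → ℚ
  labelDensity t = fromℕ (ℓ t) * inv! (2 ℕ.* size t)

  labelDensity-hook : ∀ t → labelDensity t * fromℕ (hook t) ≡ 1ℚ
  labelDensity-hook t = begin
    fromℕ (ℓ t) * inv! (2 ℕ.* size t) * fromℕ (hook t)
      ≡⟨ solve 3 (λ a b c → a :* b :* c := b :* (a :* c)) refl (fromℕ (ℓ t)) (inv! (2 ℕ.* size t)) (fromℕ (hook t)) ⟩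
    inv! (2 ℕ.* size t) * (fromℕ (ℓ t) * fromℕ (hook t))
      ≡⟨ cong (inv! (2 ℕ.* size t) *_) (trans (sym (fromℕ-* (ℓ t) (hook t))) (cong fromℕ (ℓ-hook t))) ⟩
    inv! (2 ℕ.* size t) * fromℕ ((2 ℕ.* size t) !)
      ≡⟨ inv!-! (2 ℕ.* size t) ⟩
    1ℚ ∎
    where open ≡-Reasoning

  densityF : List Tree → ℚ
  densityF ts = Π (map labelDensity ts)

  densityF-hook : ∀ ts → densityF ts * fromℕ (hookF ts) ≡ 1ℚ
  densityF-hook [] = refl
  densityF-hook (t ∷ ts) = begin
    labelDensity t * densityF ts * fromℕ (hook t ℕ.* hookF ts)
      ≡⟨ cong (labelDensity t * densityF ts *_) (fromℕ-* (hook t) (hookF ts)) ⟩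
    labelDensity t * densityF ts * (fromℕ (hook t) * fromℕ (hookF ts))
      ≡⟨ solve 4 (λ a b c d → a :* b :* (c :* d) := a :* c :* (b :* d)) refl (labelDensity t) (densityF ts) (fromℕ (hook t)) (fromℕ (hookF ts)) ⟩
    labelDensity t * fromℕ (hook t) * (densityF ts * fromℕ (hookF ts))
      ≡⟨ cong₂ _*_ (labelDensity-hook t) (densityF-hook ts) ⟩
    1ℚ ∎
    where open ≡-Reasoning

  -- Deleting the root removes just its two hook factors; both densities are reciprocals of hook
  -- products.
  labelDensity-node : ∀ ts → fromℕ (2 ℕ.+ 2 ℕ.* sizeF ts) * (fromℕ (1 ℕ.+ 2 ℕ.* sizeF ts) * labelDensity (node ts)) ≡ densityF ts
  labelDensity-node ts = begin
    c * (d * w)                          ≡⟨ sym (*-identityʳ _) ⟩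
    c * (d * w) * 1ℚ                     ≡⟨ cong (c * (d * w) *_) (sym (densityF-hook ts)) ⟩
    c * (d * w) * (densityF ts * h)      ≡⟨ solve 5 (λ c d w x h → c :* (d :* w) :* (x :* h) := w :* (c :* (d :* h)) :* x) refl c d w (densityF ts) h ⟩
    w * (c * (d * h)) * densityF ts      ≡⟨ cong (λ u → w * u * densityF ts) hook-ℚ ⟩
    w * fromℕ (hook (node ts)) * densityF ts ≡⟨ cong (_* densityF ts) (labelDensity-hook (node ts)) ⟩
    1ℚ * densityF ts                     ≡⟨ *-identityˡ _ ⟩
    densityF ts                          ∎
    where
    open ≡-Reasoning
    c = fromℕ (2 ℕ.+ 2 ℕ.* sizeF ts)
    d = fromℕ (1 ℕ.+ 2 ℕ.* sizeF ts)
    w = labelDensity (node ts)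
    h = fromℕ (hookF ts)
    hook-ℚ : c * (d * h) ≡ fromℕ (hook (node ts))
    hook-ℚ = sym (trans (fromℕ-* (2 ℕ.+ 2 ℕ.* sizeF ts) ((1 ℕ.+ 2 ℕ.* sizeF ts) ℕ.* hookF ts)) (cong (c *_) (fromℕ-* (1 ℕ.+ 2 ℕ.* sizeF ts) (hookF ts))))

  weight : Tree → ℚ
  weight t = Π (map φ (outdegs t)) * labelDensity t

  weightF : List Tree → ℚ
  weightF ts = Π (map weight ts)

  Π-++ : ∀ xs ys → Π (xs ++ ys) ≡ Π xs * Π ys
  Π-++ [] ys = sym (*-identityˡ _)
  Π-++ (x ∷ xs) ys = trans (cong (x *_) (Π-++ xs ys)) (sym (*-assoc x _ _))

  weightF-split : ∀ ts → Π (map φ (outdegsF ts)) * densityF ts ≡ weightF ts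
  weightF-split [] = refl
  weightF-split (t ∷ ts) = begin
    Π (map φ (outdegs t ++ outdegsF ts)) * (labelDensity t * densityF ts)
      ≡⟨ cong (_* (labelDensity t * densityF ts)) (trans (cong Π (map-++ φ (outdegs t) (outdegsF ts))) (Π-++ (map φ (outdegs t)) _)) ⟩
    Π (map φ (outdegs t)) * Π (map φ (outdegsF ts)) * (labelDensity t * densityF ts)
      ≡⟨ solve 4 (λ a b c d → a :* b :* (c :* d) := a :* c :* (b :* d)) refl (Π (map φ (outdegs t))) (Π (map φ (outdegsF ts))) (labelDensity t) (densityF ts) ⟩
    weight t * (Π (map φ (outdegsF ts)) * densityF ts)
      ≡⟨ cong (weight t *_) (weightF-split ts) ⟩
    weight t * weightF ts ∎
    where open ≡-Reasoning

  weight-node : ∀ ts → fromℕ (2 ℕ.+ 2 ℕ.* sizeF ts) * (fromℕ (1 ℕ.+ 2 ℕ.* sizeF ts) * weight (node ts)) ≡ φ (length ts) * weightF ts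
  weight-node ts = begin
    c * (d * (φ (length ts) * Π (map φ (outdegsF ts)) * labelDensity (node ts)))
      ≡⟨ solve 5 (λ c d f p l → c :* (d :* (f :* p :* l)) := f :* (p :* (c :* (d :* l)))) refl c d (φ (length ts)) (Π (map φ (outdegsF ts))) (labelDensity (node ts)) ⟩
    φ (length ts) * (Π (map φ (outdegsF ts)) * (c * (d * labelDensity (node ts))))
      ≡⟨ cong (λ u → φ (length ts) * (Π (map φ (outdegsF ts)) * u)) (labelDensity-node ts) ⟩
    φ (length ts) * (Π (map φ (outdegsF ts)) * densityF ts)
      ≡⟨ cong (φ (length ts) *_) (weightF-split ts) ⟩
    φ (length ts) * weightF ts ∎
    where
    open ≡-Reasoning
    c = fromℕ (2 ℕ.+ 2 ℕ.* sizeF ts)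
    d = fromℕ (1 ℕ.+ 2 ℕ.* sizeF ts)

  -- T(z) = τ(z²)
  opaque
    τ : Series
    τ n = inv! (2 ℕ.* n) * Tn n

    τ-at : ∀ n → τ n ≡ inv! (2 ℕ.* n) * Tn n
    τ-at n = refl

  τ0 : τ 0 ≡ 0ℚ
  τ0 = τ-at 0

  τ-forests : ∀ n → τ (suc n) ≡ sumOver (weight ∘ node) (forestsF (suc n) n)
  τ-forests n = begin
    τ (suc n)
      ≡⟨ τ-at (suc n) ⟩
    inv! (2 ℕ.* suc n) * Tn (suc n)
      ≡⟨ cong (inv! (2 ℕ.* suc n) *_) (sumOver-map (λ t → Π (map φ (outdegs t)) * fromℕ (ℓ t)) node (forestsF (suc n) n)) ⟩
    inv! (2 ℕ.* suc n) * sumOver (λ ts → Π (map φ (outdegs (node ts))) * fromℕ (ℓ (node ts))) (forestsF (suc n) n)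
      ≡⟨ sumOver-* (inv! (2 ℕ.* suc n)) (λ ts → Π (map φ (outdegs (node ts))) * fromℕ (ℓ (node ts))) (forestsF (suc n) n) ⟩
    sumOver (λ ts → inv! (2 ℕ.* suc n) * (Π (map φ (outdegs (node ts))) * fromℕ (ℓ (node ts)))) (forestsF (suc n) n)
      ≡⟨ sumOver-cong (All.map (λ {ts} → term ts) (forestsF-size (suc n) n)) ⟩
    sumOver (weight ∘ node) (forestsF (suc n) n) ∎
    where
    open ≡-Reasoning
    term : ∀ ts → sizeF ts ≡ n → inv! (2 ℕ.* suc n) * (Π (map φ (outdegs (node ts))) * fromℕ (ℓ (node ts))) ≡ weight (node ts)
    term ts refl = solve 3 (λ a b c → a :* (b :* c) := b :* (c :* a)) refl
      (inv! (2 ℕ.* suc n)) (Π (map φ (outdegs (node ts)))) (fromℕ (ℓ (node ts)))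

  -- A forest is a sequence of trees and its weight is a product, so forests of length j contribute
  -- `ψ j` times the j-th power of `τ`. Splitting off the first tree turns `ψ` into `shift ψ`, as in
  -- `comp-unfold`; hence the statement for every `ψ`.
  forests-comp : ∀ fuel ψ n → n < fuel → sumOver (λ ts → ψ (length ts) * weightF ts) (forestsF fuel n) ≡ comp ψ τ n
  forests-comp (suc fuel) ψ zero _ =
    trans (solve 1 (λ p → p :* con 1ℚ :+ con 0ℚ := p) refl (ψ 0)) (sym (comp-zero ψ τ0))
  forests-comp (suc fuel) ψ (suc n) (s≤s n<fuel) = begin
    sumOver F (concatMap (λ k → concatMap (λ t → map (t ∷_) (forestsF fuel (n ∸ k))) (map node (forestsF fuel k))) (upTo (suc n)))
      ≡⟨ sumOver-concatMap F (λ k → concatMap (λ t → map (t ∷_) (forestsF fuel (n ∸ k))) (map node (forestsF fuel k))) (upTo (suc n)) ⟩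
    Σ< (suc n) (λ k → sumOver F (concatMap (λ t → map (t ∷_) (forestsF fuel (n ∸ k))) (map node (forestsF fuel k))))
      ≡⟨ Σ<-cong (suc n) first ⟩
    Σ< (suc n) (λ k → τ (suc k) * comp (shift ψ) τ (n ∸ k))
      ≡⟨ sym (⊗-⊛ (shift τ) (comp (shift ψ) τ) .at n) ⟩
    (shift τ ⊗ comp (shift ψ) τ) n
      -- No tree is empty: the zero term with `τ 0` completes the product, whose first factor has so
      -- far been indexed from one node on.
      ≡⟨ sym (+-vanishˡ _ (trans (cong (_* comp (shift ψ) τ (suc n)) τ0) (*-zeroˡ (comp (shift ψ) τ (suc n))))) ⟩
    τ 0 * comp (shift ψ) τ (suc n) + (shift τ ⊗ comp (shift ψ) τ) n
      ≡⟨ sym (⊗-suc τ (comp (shift ψ) τ) n) ⟩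
    (τ ⊗ comp (shift ψ) τ) (suc n)
      ≡⟨ sym (+-vanishˡ _ (trans (scale-at (ψ 0) 1s (suc n)) (*-zeroʳ (ψ 0)))) ⟩
    K (ψ 0) (suc n) + (τ ⊗ comp (shift ψ) τ) (suc n)
      ≡⟨ sym (⊕-at (K (ψ 0)) _ (suc n)) ⟩
    (K (ψ 0) ⊕ τ ⊗ comp (shift ψ) τ) (suc n)
      ≡⟨ sym (comp-unfold ψ τ0 .at (suc n)) ⟩
    comp ψ τ (suc n) ∎
    where
    open ≡-Reasoning
    F : List Tree → ℚ
    F ts = ψ (length ts) * weightF ts
    first : ∀ k → k < suc n →
      sumOver F (concatMap (λ t → map (t ∷_) (forestsF fuel (n ∸ k))) (map node (forestsF fuel k))) ≡ τ (suc k) * comp (shift ψ) τ (n ∸ k)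
    first k (s≤s k≤n) = begin
      sumOver F (concatMap (λ t → map (t ∷_) (forestsF fuel (n ∸ k))) (map node (forestsF fuel k)))
        ≡⟨ sumOver-concatMap F _ (map node (forestsF fuel k)) ⟩
      sumOver (λ t → sumOver F (map (t ∷_) (forestsF fuel (n ∸ k)))) (map node (forestsF fuel k))
        ≡⟨ sumOver-map (λ t → sumOver F (map (t ∷_) (forestsF fuel (n ∸ k)))) node (forestsF fuel k) ⟩
      sumOver (λ us → sumOver F (map (node us ∷_) (forestsF fuel (n ∸ k)))) (forestsF fuel k)
        ≡⟨ sumOver-cong (All.universal inner (forestsF fuel k)) ⟩
      sumOver (λ us → c * weight (node us)) (forestsF fuel k)
        ≡⟨ sym (sumOver-* c (weight ∘ node) (forestsF fuel k)) ⟩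
      c * sumOver (weight ∘ node) (forestsF fuel k)
        ≡⟨ cong (λ us → c * sumOver (weight ∘ node) us) (forestsF-fuel fuel (suc k) k (ℕₚ.≤-<-trans k≤n n<fuel) ℕₚ.≤-refl) ⟩
      c * sumOver (weight ∘ node) (forestsF (suc k) k)
        ≡⟨ cong (c *_) (sym (τ-forests k)) ⟩
      c * τ (suc k)
        ≡⟨ *-comm c _ ⟩
      τ (suc k) * c ∎
      where
      c = comp (shift ψ) τ (n ∸ k)
      inner : ∀ us → sumOver F (map (node us ∷_) (forestsF fuel (n ∸ k))) ≡ c * weight (node us)
      inner us = begin
        sumOver F (map (node us ∷_) (forestsF fuel (n ∸ k)))
          ≡⟨ sumOver-map F (node us ∷_) (forestsF fuel (n ∸ k)) ⟩
        sumOver (λ ts → ψ (suc (length ts)) * (weight (node us) * weightF ts)) (forestsF fuel (n ∸ k))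
          ≡⟨ sumOver-cong (All.universal (λ ts → solve 3 (λ a b c → a :* (b :* c) := b :* (a :* c)) refl (ψ (suc (length ts))) (weight (node us)) (weightF ts)) (forestsF fuel (n ∸ k))) ⟩
        sumOver (λ ts → weight (node us) * (shift ψ (length ts) * weightF ts)) (forestsF fuel (n ∸ k))
          ≡⟨ sym (sumOver-* (weight (node us)) (λ ts → shift ψ (length ts) * weightF ts) (forestsF fuel (n ∸ k))) ⟩
        weight (node us) * sumOver (λ ts → shift ψ (length ts) * weightF ts) (forestsF fuel (n ∸ k))
          ≡⟨ cong (weight (node us) *_) (forests-comp fuel (shift ψ) (n ∸ k) (ℕₚ.≤-<-trans (ℕₚ.m∸n≤m n k) n<fuel)) ⟩
        weight (node us) * c
          ≡⟨ *-comm (weight (node us)) c ⟩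
        c * weight (node us) ∎

  -- cosh T and sinh T, with `τ` for T. The variable is u = z², so T itself, even in z, needs no
  -- further substitution.
  ch sh : Series
  ch = comp φ τ
  sh = comp (λ j → if isEven j then 0ℚ else inv! j) τ

  -- T'' = cosh T
  τ-ode : ∀ n → fromℕ (2 ℕ.+ 2 ℕ.* n) * (fromℕ (1 ℕ.+ 2 ℕ.* n) * τ (suc n)) ≡ ch n
  τ-ode n = begin
    c * (d * τ (suc n))
      ≡⟨ cong (λ u → c * (d * u)) (τ-forests n) ⟩
    c * (d * sumOver (weight ∘ node) (forestsF (suc n) n))
      ≡⟨ cong (c *_) (sumOver-* d (weight ∘ node) (forestsF (suc n) n)) ⟩
    c * sumOver (λ ts → d * weight (node ts)) (forestsF (suc n) n)
      ≡⟨ sumOver-* c (λ ts → d * weight (node ts)) (forestsF (suc n) n) ⟩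
    sumOver (λ ts → c * (d * weight (node ts))) (forestsF (suc n) n)
      ≡⟨ sumOver-cong (All.map (λ {ts} → term ts) (forestsF-size (suc n) n)) ⟩
    sumOver (λ ts → φ (length ts) * weightF ts) (forestsF (suc n) n)
      ≡⟨ forests-comp (suc n) φ n ℕₚ.≤-refl ⟩
    ch n ∎
    where
    open ≡-Reasoning
    c = fromℕ (2 ℕ.+ 2 ℕ.* n)
    d = fromℕ (1 ℕ.+ 2 ℕ.* n)
    term : ∀ ts → sizeF ts ≡ n → c * (d * weight (node ts)) ≡ φ (length ts) * weightF ts
    term ts refl = weight-node ts

  -- T'(z) = z t(z²)
  opaque
    t : Series
    t n = Tn (suc n) * inv! (suc (2 ℕ.* n))

    t-at : ∀ n → t n ≡ Tn (suc n) * inv! (suc (2 ℕ.* n))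
    t-at n = refl

  t-τ : ∀ n → t n ≡ fromℕ (2 ℕ.+ 2 ℕ.* n) * τ (suc n)
  t-τ n = begin
    t n                                          ≡⟨ t-at n ⟩
    Tn (suc n) * inv! (suc (2 ℕ.* n))            ≡⟨ cong (Tn (suc n) *_) (sym (inv!-suc (suc (2 ℕ.* n)))) ⟩
    Tn (suc n) * (fromℕ (2 ℕ.+ 2 ℕ.* n) * inv! (2 ℕ.+ 2 ℕ.* n))
      ≡⟨ solve 3 (λ a b c → a :* (b :* c) := b :* (c :* a)) refl (Tn (suc n)) (fromℕ (2 ℕ.+ 2 ℕ.* n)) (inv! (2 ℕ.+ 2 ℕ.* n)) ⟩
    fromℕ (2 ℕ.+ 2 ℕ.* n) * (inv! (2 ℕ.+ 2 ℕ.* n) * Tn (suc n))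
      ≡⟨ cong (λ k → fromℕ (2 ℕ.+ 2 ℕ.* n) * (inv! k * Tn (suc n))) (sym (ℕₚ.*-suc 2 n)) ⟩
    fromℕ (2 ℕ.+ 2 ℕ.* n) * (inv! (2 ℕ.* suc n) * Tn (suc n))
      ≡⟨ cong (fromℕ (2 ℕ.+ 2 ℕ.* n) *_) (sym (τ-at (suc n))) ⟩
    fromℕ (2 ℕ.+ 2 ℕ.* n) * τ (suc n) ∎
    where open ≡-Reasoning

  t-ch : ∀ n → fromℕ (1 ℕ.+ 2 ℕ.* n) * t n ≡ ch n
  t-ch n = trans (cong (fromℕ (1 ℕ.+ 2 ℕ.* n) *_) (t-τ n))
    (trans (solve 3 (λ a b c → a :* (b :* c) := b :* (a :* c)) refl (fromℕ (1 ℕ.+ 2 ℕ.* n)) (fromℕ (2 ℕ.+ 2 ℕ.* n)) (τ (suc n))) (τ-ode n))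

  -- From T(z) = τ(z²) comes T'(z) = 2 z τ'(z²), that is t = 2 τ'.
  t-Dτ : t ≈ D τ ⊕ D τ
  t-Dτ .at n = begin
    t n                                        ≡⟨ t-τ n ⟩
    fromℕ (2 ℕ.+ 2 ℕ.* n) * τ (suc n)          ≡⟨ cong (λ k → fromℕ k * τ (suc n)) (N.solve 1 (λ n → N.con 2 N.:+ N.con 2 N.:* n N.:= (N.con 1 N.:+ n) N.:+ (N.con 1 N.:+ n)) refl n) ⟩
    fromℕ (suc n ℕ.+ suc n) * τ (suc n)        ≡⟨ cong (_* τ (suc n)) (fromℕ-+ (suc n) (suc n)) ⟩
    (fromℕ (suc n) + fromℕ (suc n)) * τ (suc n) ≡⟨ *-distribʳ-+ (τ (suc n)) (fromℕ (suc n)) (fromℕ (suc n)) ⟩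
    fromℕ (suc n) * τ (suc n) + fromℕ (suc n) * τ (suc n) ≡⟨ sym (cong₂ _+_ (D-at τ n) (D-at τ n)) ⟩
    D τ n + D τ n                              ≡⟨ sym (⊕-at (D τ) (D τ) n) ⟩
    (D τ ⊕ D τ) n                              ∎
    where open ≡-Reasoning

  -- In the variable u = z², T'' = cosh T reads 2 u t' + t = cosh τ
  t-ode : Z ⊗ D t ⊕ Z ⊗ D t ⊕ t ≈ ch
  t-ode .at m = begin
    (Z ⊗ D t ⊕ Z ⊗ D t ⊕ t) m               ≡⟨ ⊕-at _ t m ⟩
    (Z ⊗ D t ⊕ Z ⊗ D t) m + t m             ≡⟨ cong (_+ t m) (⊕-at _ _ m) ⟩
    (Z ⊗ D t) m + (Z ⊗ D t) m + t m         ≡⟨ cong (λ u → u + u + t m) (trans (Z-⊗ (D t) .at m) (X-D-at t m)) ⟩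
    fromℕ m * t m + fromℕ m * t m + t m     ≡⟨ solve 2 (λ a b → a :* b :+ a :* b :+ b := (con 1ℚ :+ (a :+ a)) :* b) refl (fromℕ m) (t m) ⟩
    (1ℚ + (fromℕ m + fromℕ m)) * t m        ≡⟨ cong (λ u → (1ℚ + u) * t m) (sym (fromℕ-+ m m)) ⟩
    (1ℚ + fromℕ (m ℕ.+ m)) * t m            ≡⟨ cong (_* t m) (sym (fromℕ-suc (m ℕ.+ m))) ⟩
    fromℕ (1 ℕ.+ (m ℕ.+ m)) * t m           ≡⟨ cong (λ k → fromℕ (1 ℕ.+ (m ℕ.+ k)) * t m) (sym (ℕₚ.+-identityʳ m)) ⟩
    fromℕ (1 ℕ.+ 2 ℕ.* m) * t m             ≡⟨ t-ch m ⟩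
    ch m                                    ∎
    where open ≡-Reasoning

  D-sinh : D (λ j → if isEven j then 0ℚ else inv! j) ≈ φ
  D-sinh .at j = trans (D-at _ j) (go (isEven j))
    where
    go : ∀ b → fromℕ (suc j) * (if not b then 0ℚ else inv! (suc j)) ≡ (if b then inv! j else 0ℚ)
    go true = inv!-suc j
    go false = *-zeroʳ (fromℕ (suc j))

  D-cosh : D φ ≈ (λ j → if isEven j then 0ℚ else inv! j)
  D-cosh .at j = trans (D-at _ j) (go (isEven j))
    where
    go : ∀ b → fromℕ (suc j) * (if not b then inv! (suc j) else 0ℚ) ≡ (if b then 0ℚ else inv! j)
    go true = *-zeroʳ (fromℕ (suc j))
    go false = inv!-suc j

  D-sh : D sh ≈ ch ⊗ D τ
  D-sh = ≈-trans (D-comp _ τ0) (⊗-cong (comp-cong τ D-sinh) ≈-refl)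

  D-ch : D ch ≈ sh ⊗ D τ
  D-ch = ≈-trans (D-comp φ τ0) (⊗-cong (comp-cong τ D-cosh) ≈-refl)

  -- T'² = 2 sinh T
  t-sh : Z ⊗ (t ⊗ t) ≈ sh ⊕ sh
  t-sh = D-injective initial (begin
    D (Z ⊗ (t ⊗ t))
      ≈⟨ D-⊗ Z (t ⊗ t) ⟩
    D Z ⊗ (t ⊗ t) ⊕ Z ⊗ D (t ⊗ t)
      ≈⟨ ⊕-cong (⊗-cong D-Z ≈-refl) (⊗-cong ≈-refl (D-⊗ t t)) ⟩
    1s ⊗ (t ⊗ t) ⊕ Z ⊗ (D t ⊗ t ⊕ t ⊗ D t)
      -- The derivative of u t² is t times 2 u t' + t, the left side of `t-ode`; this is T'' = cosh
      -- T multiplied by T'.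
      ≈⟨ S.solve 3 (λ z t d → S.con 1 S.:* (t S.:* t) S.:+ z S.:* (d S.:* t S.:+ t S.:* d) S.:= t S.:* (z S.:* d S.:+ z S.:* d S.:+ t)) ≈-refl Z t (D t) ⟩
    t ⊗ (Z ⊗ D t ⊕ Z ⊗ D t ⊕ t)
      ≈⟨ ⊗-cong t-Dτ t-ode ⟩
    (D τ ⊕ D τ) ⊗ ch
      ≈⟨ S.solve 2 (λ d c → (d S.:+ d) S.:* c S.:= c S.:* d S.:+ c S.:* d) ≈-refl (D τ) ch ⟩
    ch ⊗ D τ ⊕ ch ⊗ D τ
      ≈⟨ ⊕-cong (≈-sym D-sh) (≈-sym D-sh) ⟩
    D sh ⊕ D sh
      ≈⟨ ≈-sym (D-⊕ sh sh) ⟩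
    D (sh ⊕ sh) ∎)
    where
    open ≈-Reasoning
    initial : (Z ⊗ (t ⊗ t)) 0 ≡ (sh ⊕ sh) 0
    initial = trans (Z-⊗ (t ⊗ t) .at 0) (sym (trans (⊕-at sh sh 0) (cong₂ _+_ (comp-zero _ τ0) (comp-zero _ τ0))))

  -- The factor four splits as (2 sinh τ)(2 τ'), which equals u t² times t.
  t-cubic : (D ch ⊕ D ch) ⊕ (D ch ⊕ D ch) ≈ X (t ⊗ (t ⊗ t))
  t-cubic = begin
    (D ch ⊕ D ch) ⊕ (D ch ⊕ D ch)
      ≈⟨ ⊕-cong (⊕-cong D-ch D-ch) (⊕-cong D-ch D-ch) ⟩
    (sh ⊗ D τ ⊕ sh ⊗ D τ) ⊕ (sh ⊗ D τ ⊕ sh ⊗ D τ)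
      ≈⟨ S.solve 2 (λ s d → (s S.:* d S.:+ s S.:* d) S.:+ (s S.:* d S.:+ s S.:* d) S.:= (s S.:+ s) S.:* (d S.:+ d)) ≈-refl sh (D τ) ⟩
    (sh ⊕ sh) ⊗ (D τ ⊕ D τ)
      ≈⟨ ⊗-cong (≈-sym t-sh) (≈-sym t-Dτ) ⟩
    Z ⊗ (t ⊗ t) ⊗ t
      ≈⟨ S.solve 2 (λ z t → z S.:* (t S.:* t) S.:* t S.:= z S.:* (t S.:* (t S.:* t))) ≈-refl Z t ⟩
    Z ⊗ (t ⊗ (t ⊗ t))
      ≈⟨ Z-⊗ _ ⟩
    X (t ⊗ (t ⊗ t)) ∎
    where open ≈-Reasoning

  -- T''' = T'³ / 2 at z^(2n+1)
  t-rec : ∀ n → fromℕ 2 * (fromℕ (3 ℕ.+ 2 ℕ.* n) * (fromℕ (2 ℕ.+ 2 ℕ.* n) * t (suc n))) ≡ X (t ⊗ (t ⊗ t)) n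
  t-rec n = begin
    fromℕ 2 * (fromℕ (3 ℕ.+ 2 ℕ.* n) * (fromℕ (2 ℕ.+ 2 ℕ.* n) * t (suc n)))
      ≡⟨ cong (λ u → fromℕ 2 * (fromℕ (3 ℕ.+ 2 ℕ.* n) * (u * t (suc n))))
           (trans (cong fromℕ (sym (ℕₚ.*-suc 2 n))) (fromℕ-* 2 (suc n))) ⟩
    fromℕ 2 * (fromℕ (3 ℕ.+ 2 ℕ.* n) * (fromℕ 2 * fromℕ (suc n) * t (suc n)))
      -- The explicit 2 and the 2 inside 2n+2 together make the four copies required by `t-cubic`.
      ≡⟨ solve 3 (λ a b c → con (fromℕ 2) :* (a :* (con (fromℕ 2) :* b :* c)) := (b :* (a :* c) :+ b :* (a :* c)) :+ (b :* (a :* c) :+ b :* (a :* c)))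
           refl (fromℕ (3 ℕ.+ 2 ℕ.* n)) (fromℕ (suc n)) (t (suc n)) ⟩
    (e + e) + (e + e)
      ≡⟨ cong (λ u → (u + u) + (u + u)) (sym D-ch-at) ⟩
    (D ch n + D ch n) + (D ch n + D ch n)
      ≡⟨ sym (trans (⊕-at _ _ n) (cong₂ _+_ (⊕-at _ _ n) (⊕-at _ _ n))) ⟩
    ((D ch ⊕ D ch) ⊕ (D ch ⊕ D ch)) n
      ≡⟨ t-cubic .at n ⟩
    X (t ⊗ (t ⊗ t)) n ∎
    where
    open ≡-Reasoning
    e = fromℕ (suc n) * (fromℕ (3 ℕ.+ 2 ℕ.* n) * t (suc n))
    D-ch-at : D ch n ≡ e
    D-ch-at = trans (D-at ch n) (cong (fromℕ (suc n) *_) (trans (sym (t-ch (suc n)))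
      (cong (λ k → fromℕ (suc k) * t (suc n)) (ℕₚ.*-suc 2 n))))

-- Differential equation of the lemniscate sine

module LemniscateSine where

  open PowerSeries
  open import Data.Nat as ℕ using (ℕ; zero; suc; _∸_; _!; _≤_; z≤n; s≤s)
  import Data.Nat.Properties as ℕₚ
  open import Data.Nat.Combinatorics using (_C_; nCk≡n!/k![n-k]!; [n∸k]!k!∣n!)
  open import Data.Nat.Divisibility using (_∣_)
  open import Data.Nat.DivMod using (m/n*n≡m)
  open import Data.Nat.Solver using () renaming (module +-*-Solver to N)
  open import Data.Rational using (0ℚ; 1ℚ; ½; _+_; _*_)
  open import Data.Rational.Properties using (*-zeroˡ)
  open import Data.Rational.Solver using (module +-*-Solver)
  open +-*-Solver using (solve; _:+_; _:*_; _:=_; con)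
  open import Data.Product using (proj₁; proj₂)
  open import Relation.Binary.PropositionalEquality

  centralBinomial-! : ∀ k → ((2 ℕ.* k) C k) ℕ.* (k ! ℕ.* k !) ≡ (2 ℕ.* k) !
  centralBinomial-! k = begin
    ((2 ℕ.* k) C k) ℕ.* (k ! ℕ.* k !)
      ≡⟨ cong (λ j → ((2 ℕ.* k) C k) ℕ.* (k ! ℕ.* j !)) (sym 2k∸k) ⟩
    ((2 ℕ.* k) C k) ℕ.* (k ! ℕ.* (2 ℕ.* k ∸ k) !)
      ≡⟨ cong (ℕ._* (k ! ℕ.* (2 ℕ.* k ∸ k) !)) (nCk≡n!/k![n-k]! k≤2k) ⟩
    ((2 ℕ.* k) ! ℕ./ (k ! ℕ.* (2 ℕ.* k ∸ k) !)) ℕ.* (k ! ℕ.* (2 ℕ.* k ∸ k) !)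
      ≡⟨ m/n*n≡m (subst (_∣ (2 ℕ.* k) !) (ℕₚ.*-comm ((2 ℕ.* k ∸ k) !) (k !)) ([n∸k]!k!∣n! k≤2k)) ⟩
    (2 ℕ.* k) ! ∎
    where
    open ≡-Reasoning
    k≤2k : k ≤ 2 ℕ.* k
    k≤2k = ℕₚ.m≤m+n k _
    2k∸k : 2 ℕ.* k ∸ k ≡ k
    2k∸k = trans (ℕₚ.m+n∸m≡n k (k ℕ.+ 0)) (ℕₚ.+-identityʳ k)
    instance
      _ = k ℕₚ.!* (2 ℕ.* k ∸ k) !≢0

  -- Obtained from the factorial form by cancelling (k+1) k!²; up to powers of 4 it is the
  -- differential equation of (1 - u)^(-1/2).
  centralBinomial-suc : ∀ k → suc k ℕ.* ((2 ℕ.* suc k) C suc k) ≡ 2 ℕ.* suc (2 ℕ.* k) ℕ.* ((2 ℕ.* k) C k)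
  centralBinomial-suc k = ℕₚ.*-cancelʳ-≡ _ _ (suc k ℕ.* (k ! ℕ.* k !)) (begin
    suc k ℕ.* c′ ℕ.* (suc k ℕ.* (k ! ℕ.* k !))
      ≡⟨ N.solve 3 (λ s c f → s N.:* c N.:* (s N.:* (f N.:* f)) N.:= c N.:* ((s N.:* f) N.:* (s N.:* f))) refl (suc k) c′ (k !) ⟩
    c′ ℕ.* (suc k ! ℕ.* suc k !)
      ≡⟨ centralBinomial-! (suc k) ⟩
    (2 ℕ.* suc k) !
      ≡⟨ cong _! (ℕₚ.*-suc 2 k) ⟩
    (2 ℕ.+ 2 ℕ.* k) ℕ.* (suc (2 ℕ.* k) ℕ.* (2 ℕ.* k) !)
      ≡⟨ cong (λ f → (2 ℕ.+ 2 ℕ.* k) ℕ.* (suc (2 ℕ.* k) ℕ.* f)) (sym (centralBinomial-! k)) ⟩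
    (2 ℕ.+ 2 ℕ.* k) ℕ.* (suc (2 ℕ.* k) ℕ.* (c ℕ.* (k ! ℕ.* k !)))
      ≡⟨ N.solve 3 (λ k c f → (N.con 2 N.:+ N.con 2 N.:* k) N.:* ((N.con 1 N.:+ N.con 2 N.:* k) N.:* (c N.:* (f N.:* f)))
                          N.:= N.con 2 N.:* (N.con 1 N.:+ N.con 2 N.:* k) N.:* c N.:* ((N.con 1 N.:+ k) N.:* (f N.:* f))) refl k c (k !) ⟩
    2 ℕ.* suc (2 ℕ.* k) ℕ.* c ℕ.* (suc k ℕ.* (k ! ℕ.* k !)) ∎)
    where
    open ≡-Reasoning
    c = (2 ℕ.* k) C k
    c′ = (2 ℕ.* suc k) C suc k
    instance
      _ = ℕₚ.m*n≢0 (suc k) (k ! ℕ.* k !) {{_}} {{k ℕₚ.!* k !≢0}}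

  -- Coefficients of (1 - u)^{-1/2}
  f : Series
  f k = fromℕ (suc (4 ℕ.* k)) * arcslCoeff k

  f-4^ : ∀ k → fromℕ (4 ℕ.^ k) * f k ≡ fromℕ ((2 ℕ.* k) C k)
  f-4^ k = begin
    fromℕ (4 ℕ.^ k) * (fromℕ (suc (4 ℕ.* k)) * arcslCoeff k)
      ≡⟨ solve 3 (λ a b c → a :* (b :* c) := c :* (a :* b)) refl (fromℕ (4 ℕ.^ k)) (fromℕ (suc (4 ℕ.* k))) (arcslCoeff k) ⟩
    arcslCoeff k * (fromℕ (4 ℕ.^ k) * fromℕ (suc (4 ℕ.* k)))
      ≡⟨ cong (arcslCoeff k *_) (sym (fromℕ-* (4 ℕ.^ k) (suc (4 ℕ.* k)))) ⟩
    arcslCoeff k * fromℕ (4 ℕ.^ k ℕ.* suc (4 ℕ.* k))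
      ≡⟨ //-* ((2 ℕ.* k) C k) (4 ℕ.^ k ℕ.* suc (4 ℕ.* k)) {{ℕₚ.m*n≢0 (4 ℕ.^ k) (suc (4 ℕ.* k)) {{ℕₚ.m^n≢0 4 k}}}} ⟩
    fromℕ ((2 ℕ.* k) C k) ∎
    where open ≡-Reasoning

  f-suc : ∀ k → fromℕ 2 * (fromℕ (suc k) * f (suc k)) ≡ fromℕ (suc (2 ℕ.* k)) * f k
  f-suc k = fromℕ-cancel (4 ℕ.^ suc k) {{ℕₚ.m^n≢0 4 (suc k)}} (begin
    fromℕ (4 ℕ.^ suc k) * (fromℕ 2 * (fromℕ (suc k) * f (suc k)))
      ≡⟨ solve 4 (λ a b c d → a :* (b :* (c :* d)) := b :* (c :* (a :* d))) refl (fromℕ (4 ℕ.^ suc k)) (fromℕ 2) (fromℕ (suc k)) (f (suc k)) ⟩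
    fromℕ 2 * (fromℕ (suc k) * (fromℕ (4 ℕ.^ suc k) * f (suc k)))
      ≡⟨ cong (λ u → fromℕ 2 * (fromℕ (suc k) * u)) (f-4^ (suc k)) ⟩
    fromℕ 2 * (fromℕ (suc k) * fromℕ ((2 ℕ.* suc k) C suc k))
      ≡⟨ cong (fromℕ 2 *_) (trans (sym (fromℕ-* (suc k) ((2 ℕ.* suc k) C suc k))) (trans (cong fromℕ (centralBinomial-suc k))
           (trans (fromℕ-* (2 ℕ.* suc (2 ℕ.* k)) ((2 ℕ.* k) C k)) (cong (_* fromℕ ((2 ℕ.* k) C k)) (fromℕ-* 2 (suc (2 ℕ.* k))))))) ⟩
    fromℕ 2 * (fromℕ 2 * fromℕ (suc (2 ℕ.* k)) * fromℕ ((2 ℕ.* k) C k))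
      ≡⟨ cong (λ u → fromℕ 2 * (fromℕ 2 * fromℕ (suc (2 ℕ.* k)) * u)) (sym (f-4^ k)) ⟩
    fromℕ 2 * (fromℕ 2 * fromℕ (suc (2 ℕ.* k)) * (fromℕ (4 ℕ.^ k) * f k))
      ≡⟨ solve 3 (λ a b c → con (fromℕ 2) :* (con (fromℕ 2) :* a :* (b :* c)) := con (fromℕ 4) :* b :* (a :* c)) refl (fromℕ (suc (2 ℕ.* k))) (fromℕ (4 ℕ.^ k)) (f k) ⟩
    fromℕ 4 * fromℕ (4 ℕ.^ k) * (fromℕ (suc (2 ℕ.* k)) * f k)
      ≡⟨ cong (_* (fromℕ (suc (2 ℕ.* k)) * f k)) (sym (fromℕ-* 4 (4 ℕ.^ k))) ⟩
    fromℕ (4 ℕ.^ suc k) * (fromℕ (suc (2 ℕ.* k)) * f k) ∎)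
    where open ≡-Reasoning

  -- 2 (1 - u) f' = f
  f-ode : D f ⊕ D f ≈ f ⊕ (X (D f) ⊕ X (D f))
  f-ode .at k = begin
    (D f ⊕ D f) k
      ≡⟨ trans (⊕-at (D f) (D f) k) (cong₂ _+_ (D-at f k) (D-at f k)) ⟩
    fromℕ (suc k) * f (suc k) + fromℕ (suc k) * f (suc k)
      ≡⟨ solve 1 (λ a → a :+ a := con (fromℕ 2) :* a) refl (fromℕ (suc k) * f (suc k)) ⟩
    fromℕ 2 * (fromℕ (suc k) * f (suc k))
      ≡⟨ f-suc k ⟩
    fromℕ (suc (2 ℕ.* k)) * f k
      ≡⟨ cong (_* f k) (trans (fromℕ-suc (2 ℕ.* k)) (cong (1ℚ +_) (fromℕ-* 2 k))) ⟩
    (1ℚ + fromℕ 2 * fromℕ k) * f k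
      ≡⟨ solve 2 (λ a b → (con 1ℚ :+ con (fromℕ 2) :* a) :* b := b :+ (a :* b :+ a :* b)) refl (fromℕ k) (f k) ⟩
    f k + (fromℕ k * f k + fromℕ k * f k)
      ≡⟨ sym (trans (⊕-at f _ k) (cong (f k +_) (trans (⊕-at _ _ k) (cong₂ _+_ (X-D-at f k) (X-D-at f k))))) ⟩
    (f ⊕ (X (D f) ⊕ X (D f))) k ∎
    where open ≡-Reasoning

  module Lemniscate (a : Series) (isSl : IsSl a) where

    a0 : a 0 ≡ 0ℚ
    a0 = proj₁ isSl

    arcsl-a : arcsl∘ a ≈ Z
    arcsl-a .at zero = proj₂ isSl 0
    arcsl-a .at (suc m) = proj₂ isSl (suc m)

    -- With a = sl: sl⁴, (1 - sl⁴)^(-1/2), and the derivative of (1 - u)^(-1/2) taken at u = sl⁴.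
    b F G : Series
    b = a ↑ 4
    F = comp f b
    G = comp (D f) b

    b0 : b 0 ≡ 0ℚ
    b0 = ↑-vanish a0 4 0 (s≤s z≤n)

    -- Differentiating a^(4k+1) brings down 4k+1, which cancels the denominator left by integration
    -- and leaves `f k` times the k-th power of a⁴.
    D-arcsl : D (arcsl∘ a) ≈ F ⊗ D a
    D-arcsl .at m = begin
      D (arcsl∘ a) m
        ≡⟨ trans (D-at _ m) (cong (fromℕ (suc m) *_) (trans
             (Σ<-cong (2 ℕ.+ m) (λ k _ → trans (cong (arcslCoeff k *_) (power k)) (sym (scale-at _ _ (suc m)))))
             (sym (ΣS-at (2 ℕ.+ m) (λ k → scale (arcslCoeff k) (a ↑ suc (4 ℕ.* k))) (suc m))))) ⟩
      fromℕ (suc m) * ΣS (2 ℕ.+ m) (λ k → scale (arcslCoeff k) (a ↑ suc (4 ℕ.* k))) (suc m)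
        ≡⟨ sym (D-at _ m) ⟩
      D (ΣS (2 ℕ.+ m) (λ k → scale (arcslCoeff k) (a ↑ suc (4 ℕ.* k)))) m
        ≡⟨ D-ΣS (2 ℕ.+ m) (λ k → scale (arcslCoeff k) (a ↑ suc (4 ℕ.* k))) .at m ⟩
      ΣS (2 ℕ.+ m) (λ k → D (scale (arcslCoeff k) (a ↑ suc (4 ℕ.* k)))) m
        ≡⟨ ΣS-cong (2 ℕ.+ m) term .at m ⟩
      ΣS (2 ℕ.+ m) (λ k → scale (f k) (b ↑ k) ⊗ D a) m
        ≡⟨ sym (ΣS-⊗ (2 ℕ.+ m) (λ k → scale (f k) (b ↑ k)) (D a) .at m) ⟩
      (ΣS (2 ℕ.+ m) (λ k → scale (f k) (b ↑ k)) ⊗ D a) m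
        ≡⟨ ⊗-cong-≤ m {b = D a} (λ i i≤m → comp-truncate f b0 (2 ℕ.+ m) i (ℕₚ.m≤n⇒m≤1+n (s≤s i≤m))) (λ _ _ → refl) ⟩
      (F ⊗ D a) m ∎
      where
      open ≡-Reasoning
      power : ∀ k → pow a (4 ℕ.* k ℕ.+ 1) (suc m) ≡ (a ↑ suc (4 ℕ.* k)) (suc m)
      power k = trans (cong (λ p → pow a p (suc m)) (ℕₚ.+-comm (4 ℕ.* k) 1)) (pow-↑ a (suc (4 ℕ.* k)) .at (suc m))
      term : ∀ k → D (scale (arcslCoeff k) (a ↑ suc (4 ℕ.* k))) ≈ scale (f k) (b ↑ k) ⊗ D a
      term k = ≈-trans (D-scale-↑ (arcslCoeff k) a (4 ℕ.* k)) (⊗-cong (pointwise (λ i →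
        trans (scale-at (f k) (a ↑ (4 ℕ.* k)) i) (trans (cong (f k *_) (trans (cong (λ p → (a ↑ p) i) (ℕₚ.*-comm 4 k)) (↑-* a 4 k .at i)))
          (sym (scale-at (f k) (b ↑ k) i))))) ≈-refl)

    -- The derivative of arcsl(sl z) = z. It makes `F` an inverse of `D a`, the only form of
    -- division used for series.
    F-Da : F ⊗ D a ≈ 1s
    F-Da = ≈-trans (≈-sym D-arcsl) (≈-trans (D-cong arcsl-a) D-Z)

    F0 : F 0 ≡ 1ℚ
    F0 = comp-zero f b0

    a1 : a 1 ≡ 1ℚ
    a1 = begin
      a 1                ≡⟨ solve 1 (λ x → x := con 1ℚ :* (con 1ℚ :* x)) refl (a 1) ⟩
      1ℚ * (fromℕ 1 * a 1) ≡⟨ cong₂ _*_ (sym F0) (sym (D-at a 0)) ⟩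
      F 0 * D a 0        ≡⟨ sym (⊗-zero F (D a)) ⟩
      (F ⊗ D a) 0        ≡⟨ F-Da .at 0 ⟩
      1ℚ                 ∎
      where open ≡-Reasoning

    G-ode : G ⊕ G ≈ F ⊕ (b ⊗ G ⊕ b ⊗ G)
    G-ode = begin
      G ⊕ G                                       ≈⟨ ≈-sym (comp-⊕ (D f) (D f) b) ⟩
      comp (D f ⊕ D f) b                          ≈⟨ comp-cong b f-ode ⟩
      comp (f ⊕ (X (D f) ⊕ X (D f))) b            ≈⟨ comp-⊕ f _ b ⟩
      F ⊕ comp (X (D f) ⊕ X (D f)) b              ≈⟨ ⊕-cong ≈-refl (comp-⊕ (X (D f)) (X (D f)) b) ⟩
      F ⊕ (comp (X (D f)) b ⊕ comp (X (D f)) b)   ≈⟨ ⊕-cong ≈-refl (⊕-cong (comp-X (D f) b0) (comp-X (D f) b0)) ⟩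
      F ⊕ (b ⊗ G ⊕ b ⊗ G)                         ∎
      where open ≈-Reasoning

    -- F = (1 - a⁴)^{-1/2}
    F² : F ⊗ F ≈ 1s ⊕ b ⊗ (F ⊗ F)
    F² = D-injective initial (begin
      D (F ⊗ F)
        ≈⟨ D-⊗ F F ⟩
      D F ⊗ F ⊕ F ⊗ D F
        ≈⟨ ⊕-cong (⊗-cong DF ≈-refl) (⊗-cong ≈-refl DF) ⟩
      (G ⊗ D b) ⊗ F ⊕ F ⊗ (G ⊗ D b)
        ≈⟨ S.solve 3 (λ g d f → (g S.:* d) S.:* f S.:+ f S.:* (g S.:* d) S.:= (g S.:+ g) S.:* (d S.:* f)) ≈-refl G (D b) F ⟩
      (G ⊕ G) ⊗ (D b ⊗ F)
        ≈⟨ ⊗-cong G-ode ≈-refl ⟩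
      (F ⊕ (b ⊗ G ⊕ b ⊗ G)) ⊗ (D b ⊗ F)
        -- The added 0 becomes the derivative of the constant 1, so that the right side is a
        -- derivative as a whole.
        ≈⟨ S.solve 4 (λ f b g d → (f S.:+ (b S.:* g S.:+ b S.:* g)) S.:* (d S.:* f)
             S.:= S.con 0 S.:+ (d S.:* (f S.:* f) S.:+ b S.:* ((g S.:* d) S.:* f S.:+ f S.:* (g S.:* d)))) ≈-refl F b G (D b) ⟩
      0s ⊕ (D b ⊗ (F ⊗ F) ⊕ b ⊗ ((G ⊗ D b) ⊗ F ⊕ F ⊗ (G ⊗ D b)))
        ≈⟨ ⊕-cong (≈-sym D-1s) (⊕-cong ≈-refl (⊗-cong ≈-refl (⊕-cong (⊗-cong (≈-sym DF) ≈-refl) (⊗-cong ≈-refl (≈-sym DF))))) ⟩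
      D 1s ⊕ (D b ⊗ (F ⊗ F) ⊕ b ⊗ (D F ⊗ F ⊕ F ⊗ D F))
        ≈⟨ ⊕-cong ≈-refl (⊕-cong ≈-refl (⊗-cong ≈-refl (≈-sym (D-⊗ F F)))) ⟩
      D 1s ⊕ (D b ⊗ (F ⊗ F) ⊕ b ⊗ D (F ⊗ F))
        ≈⟨ ⊕-cong ≈-refl (≈-sym (D-⊗ b (F ⊗ F))) ⟩
      D 1s ⊕ D (b ⊗ (F ⊗ F))
        ≈⟨ ≈-sym (D-⊕ 1s (b ⊗ (F ⊗ F))) ⟩
      D (1s ⊕ b ⊗ (F ⊗ F)) ∎)
      where
      open ≈-Reasoning
      DF : D F ≈ G ⊗ D b
      DF = D-comp f b0
      initial : (F ⊗ F) 0 ≡ (1s ⊕ b ⊗ (F ⊗ F)) 0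
      initial = trans (trans (⊗-zero F F) (cong₂ _*_ F0 F0))
        (sym (trans (⊕-at 1s _ 0) (cong (1ℚ +_) (trans (⊗-zero b (F ⊗ F)) (trans (cong (_* (F ⊗ F) 0) b0) (*-zeroˡ ((F ⊗ F) 0)))))))

    -- Since F a' = 1, the left side equals (1 + b F²) a'², which by `F²` is (F a')².
    Da² : D a ⊗ D a ⊕ b ≈ 1s
    Da² = begin
      D a ⊗ D a ⊕ b
        ≈⟨ S.solve 2 (λ d b → d S.:* d S.:+ b S.:= d S.:* d S.:+ b S.:* (S.con 1 S.:* S.con 1)) ≈-refl (D a) b ⟩
      D a ⊗ D a ⊕ b ⊗ (1s ⊗ 1s)
        ≈⟨ ⊕-cong ≈-refl (⊗-cong ≈-refl (⊗-cong (≈-sym F-Da) (≈-sym F-Da))) ⟩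
      D a ⊗ D a ⊕ b ⊗ ((F ⊗ D a) ⊗ (F ⊗ D a))
        ≈⟨ S.solve 3 (λ d b f → d S.:* d S.:+ b S.:* ((f S.:* d) S.:* (f S.:* d)) S.:= (S.con 1 S.:+ b S.:* (f S.:* f)) S.:* (d S.:* d)) ≈-refl (D a) b F ⟩
      (1s ⊕ b ⊗ (F ⊗ F)) ⊗ (D a ⊗ D a)
        ≈⟨ ⊗-cong (≈-sym F²) ≈-refl ⟩
      (F ⊗ F) ⊗ (D a ⊗ D a)
        ≈⟨ S.solve 2 (λ f d → (f S.:* f) S.:* (d S.:* d) S.:= (f S.:* d) S.:* (f S.:* d)) ≈-refl F (D a) ⟩
      (F ⊗ D a) ⊗ (F ⊗ D a)
        ≈⟨ ⊗-cong F-Da F-Da ⟩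
      1s ⊗ 1s
        ≈⟨ ⊗-identityˡ 1s ⟩
      1s ∎
      where open ≈-Reasoning

    -- The derivative of `Da²` is this expression times a'; multiplication by `F` cancels that
    -- factor.
    sl-ode : (D (D a) ⊕ D (D a)) ⊕ K (fromℕ 4) ⊗ (a ⊗ (a ⊗ a)) ≈ 0s
    sl-ode = begin
      (A ⊕ A) ⊕ K₄ ⊗ (a ⊗ (a ⊗ a))
        ≈⟨ S.solve 3 (λ A k a → (A S.:+ A) S.:+ k S.:* (a S.:* (a S.:* a))
             S.:= S.con 1 S.:* ((A S.:+ A) S.:+ k S.:* (a S.:* (a S.:* (a S.:* S.con 1))))) ≈-refl A K₄ a ⟩
      1s ⊗ ((A ⊕ A) ⊕ K₄ ⊗ a ↑ 3)
        ≈⟨ ⊗-cong (≈-sym F-Da) ≈-refl ⟩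
      (F ⊗ D a) ⊗ ((A ⊕ A) ⊕ K₄ ⊗ a ↑ 3)
        ≈⟨ S.solve 5 (λ f d A k a → (f S.:* d) S.:* ((A S.:+ A) S.:+ k S.:* a) S.:= f S.:* ((A S.:* d S.:+ d S.:* A) S.:+ k S.:* (a S.:* d))) ≈-refl F (D a) A K₄ (a ↑ 3) ⟩
      F ⊗ ((A ⊗ D a ⊕ D a ⊗ A) ⊕ K₄ ⊗ (a ↑ 3 ⊗ D a))
        ≈⟨ ⊗-cong ≈-refl (⊕-cong (≈-sym (D-⊗ (D a) (D a))) (≈-sym (D-↑ a 3))) ⟩
      F ⊗ (D (D a ⊗ D a) ⊕ D b)
        ≈⟨ ⊗-cong ≈-refl (≈-sym (D-⊕ (D a ⊗ D a) b)) ⟩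
      F ⊗ D (D a ⊗ D a ⊕ b)
        ≈⟨ ⊗-cong ≈-refl (≈-trans (D-cong Da²) D-1s) ⟩
      F ⊗ 0s
        ≈⟨ ≈-trans (⊗-comm F 0s) (⊗-zeroˡ F) ⟩
      0s ∎
      where
      open ≈-Reasoning
      A = D (D a)
      K₄ = K (fromℕ 4)

    sl-rec : ∀ m → fromℕ (suc m) * (fromℕ (2 ℕ.+ m) * a (2 ℕ.+ m)) + fromℕ 2 * (a ⊗ (a ⊗ a)) m ≡ 0ℚ
    sl-rec m = begin
      e + fromℕ 2 * c                       ≡⟨ solve 2 (λ e c → e :+ con (fromℕ 2) :* c := con ½ :* ((e :+ e) :+ con (fromℕ 4) :* c)) refl e c ⟩
      ½ * ((e + e) + fromℕ 4 * c)           ≡⟨ cong₂ (λ u v → ½ * ((u + u) + v)) (sym DDa) (sym (trans (K-⊗ (fromℕ 4) (a ⊗ (a ⊗ a)) .at m) (scale-at _ _ m))) ⟩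
      ½ * ((D (D a) m + D (D a) m) + (K (fromℕ 4) ⊗ (a ⊗ (a ⊗ a))) m)
        ≡⟨ cong (½ *_) (trans (cong (_+ (K (fromℕ 4) ⊗ (a ⊗ (a ⊗ a))) m) (sym (⊕-at (D (D a)) (D (D a)) m))) (sym (⊕-at _ _ m))) ⟩
      ½ * ((D (D a) ⊕ D (D a)) ⊕ K (fromℕ 4) ⊗ (a ⊗ (a ⊗ a))) m
        ≡⟨ cong (½ *_) (sl-ode .at m) ⟩
      0ℚ ∎
      where
      open ≡-Reasoning
      e = fromℕ (suc m) * (fromℕ (2 ℕ.+ m) * a (2 ℕ.+ m))
      c = (a ⊗ (a ⊗ a)) m
      DDa : D (D a) m ≡ e
      DDa = trans (D-at (D a) m) (cong (fromℕ (suc m) *_) (D-at a (suc m)))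

-- Comparison of T' with sl, and the recurrence

module Comparison where

  open PowerSeries
  open TreeSeries using (t; t-at; t-rec; sumOver; sumOver-concatMap; sumOver-map)
  open LemniscateSine using (module Lemniscate)
  open import Data.Nat as ℕ using (ℕ; zero; suc; _∸_; _!; _≤_; _<_; z≤n; s≤s)
  import Data.Nat.Properties as ℕₚ
  open import Data.Nat.DivMod using (+-distrib-/-∣ʳ; m*n/n≡m)
  open import Data.Nat.Divisibility using (n∣m*n)
  open import Data.Nat.Induction using (<-rec)
  import Data.Integer as ℤ
  open import Data.Rational using (ℚ; 0ℚ; 1ℚ; ½; _+_; _*_; -_) renaming (_/_ to _//_)
  open import Data.Rational.Properties
  open import Data.Rational.Solver using (module +-*-Solver)
  open +-*-Solver using (solve; _:+_; _:*_; :-_; _:=_; con; Polynomial)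
  open import Data.Bool using (true; not; if_then_else_)
  open import Data.List using ([]; _∷_; map; upTo)
  open import Data.Product using (_×_; _,_; proj₁; proj₂)
  open import Function using (_∘_)
  open import Relation.Binary.PropositionalEquality

  -- Doubling that reduces to two successors on `suc k`, as the recursion of `sp` requires and
  -- `2 * k` does not.
  dbl : ℕ → ℕ
  dbl zero = 0
  dbl (suc k) = 2 ℕ.+ dbl k

  dbl-2* : ∀ k → dbl k ≡ 2 ℕ.* k
  dbl-2* zero = refl
  dbl-2* (suc k) = trans (cong (2 ℕ.+_) (dbl-2* k)) (sym (ℕₚ.*-suc 2 k))

  data Parity : ℕ → Set where
    even : ∀ k → Parity (dbl k)
    odd : ∀ k → Parity (suc (dbl k))

  parity : ∀ m → Parity m
  parity zero = even 0
  parity (suc m) with parity m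
  ... | even k = odd k
  ... | odd k = even (suc k)

  -- sp u (z) = u(z²)
  sp : Series → Series
  sp u 0 = u 0
  sp u 1 = 0ℚ
  sp u (suc (suc m)) = sp (shift u) m

  sp-even : ∀ k u → sp u (dbl k) ≡ u k
  sp-even zero u = refl
  sp-even (suc k) u = sp-even k (shift u)

  sp-odd : ∀ k u → sp u (suc (dbl k)) ≡ 0ℚ
  sp-odd zero u = refl
  sp-odd (suc k) u = sp-odd k (shift u)

  shift-sp : ∀ u → shift (sp u) ≈ X (sp (shift u))
  shift-sp u .at zero = refl
  shift-sp u .at (suc m) = refl

  -- One step in u is two in z: the coefficient of degree one, met in between, is zero.
  sp-⊗-suc² : ∀ u v m → (sp u ⊗ sp v) (2 ℕ.+ m) ≡ u 0 * sp v (2 ℕ.+ m) + (sp (shift u) ⊗ sp v) m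
  sp-⊗-suc² u v m = trans (⊗-suc (sp u) (sp v) (suc m)) (cong (u 0 * sp v (2 ℕ.+ m) +_)
    (trans (⊗-cong (shift-sp u) ≈-refl .at (suc m)) (X-⊗ (sp (shift u)) (sp v) .at (suc m))))

  sp-⊗-even : ∀ k u v → (sp u ⊗ sp v) (dbl k) ≡ (u ⊗ v) k
  sp-⊗-even zero u v = trans (⊗-zero (sp u) (sp v)) (sym (⊗-zero u v))
  sp-⊗-even (suc k) u v = trans (sp-⊗-suc² u v (dbl k))
    (trans (cong₂ (λ x y → u 0 * x + y) (sp-even (suc k) v) (sp-⊗-even k (shift u) v)) (sym (⊗-suc u v k)))

  sp-⊗-odd : ∀ k u v → (sp u ⊗ sp v) (suc (dbl k)) ≡ 0ℚ
  sp-⊗-odd zero u v = trans (⊗-suc (sp u) (sp v) 0) (trans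
    (cong₂ _+_ (*-zeroʳ (u 0)) (trans (⊗-zero (shift (sp u)) (sp v)) (*-zeroˡ (v 0)))) (+-identityˡ 0ℚ))
  sp-⊗-odd (suc k) u v = trans (sp-⊗-suc² u v (suc (dbl k))) (trans
    (cong₂ _+_ (trans (cong (u 0 *_) (sp-odd (suc k) v)) (*-zeroʳ (u 0))) (sp-⊗-odd k (shift u) v)) (+-identityˡ 0ℚ))

  sp-⊗ : ∀ u v → sp u ⊗ sp v ≈ sp (u ⊗ v)
  sp-⊗ u v .at m with parity m
  ... | even k = trans (sp-⊗-even k u v) (sym (sp-even k (u ⊗ v)))
  ... | odd k = trans (sp-⊗-odd k u v) (sym (sp-odd k (u ⊗ v)))

  X-⊗-X : ∀ u v → X u ⊗ X v ≈ X (X (u ⊗ v))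
  X-⊗-X u v = ≈-trans (X-⊗ u (X v)) (X-cong (≈-trans (⊗-comm u (X v)) (≈-trans (X-⊗ v u) (X-cong (⊗-comm v u)))))

  -- T'(z) = z t(z²), back in the variable z.
  y : Series
  y = X (sp t)

  y³ : y ⊗ (y ⊗ y) ≈ X (X (X (sp (t ⊗ (t ⊗ t)))))
  y³ = ≈-trans (⊗-cong ≈-refl (X-⊗-X (sp t) (sp t))) (≈-trans (X-⊗-X (sp t) (X (sp t ⊗ sp t))) (X-cong (X-cong
    (≈-trans (⊗-comm (sp t) _) (≈-trans (X-⊗ (sp t ⊗ sp t) (sp t)) (X-cong
      (≈-trans (⊗-comm _ (sp t)) (≈-trans (⊗-cong ≈-refl (sp-⊗ t t)) (sp-⊗ t (t ⊗ t))))))))))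

  -- T''' = T'³ / 2
  y-rec : ∀ m → fromℕ 2 * (fromℕ (2 ℕ.+ m) * (fromℕ (suc m) * y (2 ℕ.+ m))) ≡ (y ⊗ (y ⊗ y)) m
  y-rec m with parity m
  -- Both T''' and T'³ are odd, so nothing remains in even degree.
  ... | even k = trans (trans (cong (λ x → fromℕ 2 * (fromℕ (2 ℕ.+ dbl k) * (fromℕ (suc (dbl k)) * x))) (sp-odd k t))
      (solve 2 (λ a b → con (fromℕ 2) :* (a :* (b :* con 0ℚ)) := con 0ℚ) refl (fromℕ (2 ℕ.+ dbl k)) (fromℕ (suc (dbl k)))))
    (sym (trans (y³ .at (dbl k)) (vanish k)))
    where
    vanish : ∀ k → X (X (X (sp (t ⊗ (t ⊗ t))))) (dbl k) ≡ 0ℚ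
    vanish zero = refl
    vanish (suc zero) = refl
    vanish (suc (suc k)) = sp-odd k (t ⊗ (t ⊗ t))
  -- Degree 2k+1 in z is index `k` in u, where the equation is `t-rec k`.
  ... | odd k = trans
    (cong₂ (λ n x → fromℕ 2 * (fromℕ (3 ℕ.+ n) * (fromℕ (2 ℕ.+ n) * x))) (dbl-2* k) (sp-even k (shift t)))
    (trans (t-rec k) (sym (trans (y³ .at (suc (dbl k))) (keep k))))
    where
    keep : ∀ k → X (X (sp (t ⊗ (t ⊗ t)))) (dbl k) ≡ X (t ⊗ (t ⊗ t)) k
    keep zero = refl
    keep (suc k) = sp-even k (t ⊗ (t ⊗ t))

  y-odd : ∀ k → y (suc (dbl k)) ≡ Tn (suc k) * inv! (suc (dbl k))
  y-odd k = trans (sp-even k t) (trans (t-at k) (cong (λ n → Tn (suc k) * inv! (suc n)) (sym (dbl-2* k))))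

  isEven-dbl : ∀ k → isEven (dbl k) ≡ true
  isEven-dbl zero = refl
  isEven-dbl (suc k) = cong (not ∘ not) (isEven-dbl k)

  half-odd : ∀ k → suc (dbl k) ℕ./ 2 ≡ k
  half-odd k = trans (cong (λ n → suc n ℕ./ 2) (trans (dbl-2* k) (ℕₚ.*-comm 2 k)))
    (trans (+-distrib-/-∣ʳ 1 {k ℕ.* 2} {2} (n∣m*n k)) (m*n/n≡m k 2))

  T′coeff-y : T′coeff ≈ y
  T′coeff-y .at m = go (parity m)
    where
    T′coeff-parity : ∀ m {b} → isEven m ≡ b → T′coeff m ≡ (if b then 0ℚ else Tn (suc (m ℕ./ 2)) * inv! m)
    T′coeff-parity m = cong (λ b → if b then 0ℚ else Tn (suc (m ℕ./ 2)) * inv! m)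
    go : ∀ {m} → Parity m → T′coeff m ≡ y m
    go (even zero) = refl
    go (even (suc k)) = trans (T′coeff-parity (dbl (suc k)) (isEven-dbl (suc k))) (sym (sp-odd k t))
    go (odd k) = trans (T′coeff-parity (suc (dbl k)) (cong not (isEven-dbl k)))
      (trans (cong (λ j → Tn (suc j) * inv! (suc (dbl k))) (half-odd k)) (sym (y-odd k)))

  -- Complex multiplication of solver polynomials, mirroring _*i_.
  _⊠_ : ∀ {n} → Polynomial n × Polynomial n → Polynomial n × Polynomial n → Polynomial n × Polynomial n
  (a , b) ⊠ (c , d) = (a :* c :+ (:- (b :* d))) , (a :* d :+ b :* c)

  *i-assoc : ∀ u v w → (u *i v) *i w ≡ u *i (v *i w)
  *i-assoc (a +i b) (c +i d) (e +i f) = cong₂ _+i_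
    (solve 6 (λ a b c d e f → proj₁ (((a , b) ⊠ (c , d)) ⊠ (e , f)) := proj₁ ((a , b) ⊠ ((c , d) ⊠ (e , f)))) refl a b c d e f)
    (solve 6 (λ a b c d e f → proj₂ (((a , b) ⊠ (c , d)) ⊠ (e , f)) := proj₂ ((a , b) ⊠ ((c , d) ⊠ (e , f)))) refl a b c d e f)

  *i-comm : ∀ u v → u *i v ≡ v *i u
  *i-comm (a +i b) (c +i d) = cong₂ _+i_
    (solve 4 (λ a b c d → proj₁ ((a , b) ⊠ (c , d)) := proj₁ ((c , d) ⊠ (a , b))) refl a b c d)
    (solve 4 (λ a b c d → proj₂ ((a , b) ⊠ (c , d)) := proj₂ ((c , d) ⊠ (a , b))) refl a b c d)

  *i-identityˡ : ∀ u → (1ℚ +i 0ℚ) *i u ≡ u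
  *i-identityˡ (a +i b) = cong₂ _+i_
    (solve 2 (λ a b → con 1ℚ :* a :+ (:- (con 0ℚ :* b)) := a) refl a b)
    (solve 2 (λ a b → con 1ℚ :* b :+ con 0ℚ :* a := b) refl a b)

  *i-interchange : ∀ u v w x → (u *i v) *i (w *i x) ≡ (u *i w) *i (v *i x)
  *i-interchange u v w x = begin
    (u *i v) *i (w *i x) ≡⟨ *i-assoc u v (w *i x) ⟩
    u *i (v *i (w *i x)) ≡⟨ cong (u *i_) (sym (*i-assoc v w x)) ⟩
    u *i ((v *i w) *i x) ≡⟨ cong (λ z → u *i (z *i x)) (*i-comm v w) ⟩
    u *i ((w *i v) *i x) ≡⟨ cong (u *i_) (*i-assoc w v x) ⟩
    u *i (w *i (v *i x)) ≡⟨ sym (*i-assoc u w (v *i x)) ⟩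
    (u *i w) *i (v *i x) ∎
    where open ≡-Reasoning

  ofℚ-* : ∀ p q → ofℚ (p * q) ≡ ofℚ p *i ofℚ q
  ofℚ-* p q = cong₂ _+i_
    (solve 2 (λ p q → p :* q := p :* q :+ (:- (con 0ℚ :* con 0ℚ))) refl p q)
    (solve 2 (λ p q → con 0ℚ := p :* con 0ℚ :+ con 0ℚ :* q) refl p q)

  ^i-+ : ∀ w m n → w ^i (m ℕ.+ n) ≡ (w ^i m) *i (w ^i n)
  ^i-+ w zero n = sym (*i-identityˡ _)
  ^i-+ w (suc m) n = trans (cong (w *i_) (^i-+ w m n)) (sym (*i-assoc w (w ^i m) (w ^i n)))

  ofℚ-scale : ∀ s κ x → ofℚ s *i (κ *i ofℚ x) ≡ κ *i ofℚ (s * x)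
  ofℚ-scale s κ x = begin
    ofℚ s *i (κ *i ofℚ x)   ≡⟨ sym (*i-assoc (ofℚ s) κ (ofℚ x)) ⟩
    (ofℚ s *i κ) *i ofℚ x   ≡⟨ cong (_*i ofℚ x) (*i-comm (ofℚ s) κ) ⟩
    (κ *i ofℚ s) *i ofℚ x   ≡⟨ *i-assoc κ (ofℚ s) (ofℚ x) ⟩
    κ *i (ofℚ s *i ofℚ x)   ≡⟨ cong (κ *i_) (sym (ofℚ-* s x)) ⟩
    κ *i ofℚ (s * x)        ∎
    where open ≡-Reasoning

  ofℚ-cancel : ∀ κ n .{{_ : ℕ.NonZero n}} {x x′} → ofℚ (fromℕ n * x) ≡ κ *i ofℚ (fromℕ n * x′) → ofℚ x ≡ κ *i ofℚ x′
  ofℚ-cancel κ n {x} {x′} h = begin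
    ofℚ x                                ≡⟨ cong ofℚ (sym (//-fromℕ n x)) ⟩
    ofℚ (ρ * (fromℕ n * x))              ≡⟨ ofℚ-* ρ _ ⟩
    ofℚ ρ *i ofℚ (fromℕ n * x)           ≡⟨ cong (ofℚ ρ *i_) h ⟩
    ofℚ ρ *i (κ *i ofℚ (fromℕ n * x′))   ≡⟨ ofℚ-scale ρ κ _ ⟩
    κ *i ofℚ (ρ * (fromℕ n * x′))        ≡⟨ cong (λ q → κ *i ofℚ q) (//-fromℕ n x′) ⟩
    κ *i ofℚ x′                          ∎
    where
    open ≡-Reasoning
    ρ = ℤ.+ 1 // n

  ofℚ-Σ< : ∀ κ N {f g : ℕ → ℚ} → (∀ i → i < N → ofℚ (f i) ≡ κ *i ofℚ (g i)) → ofℚ (Σ< N f) ≡ κ *i ofℚ (Σ< N g)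
  ofℚ-Σ< κ zero h = cong₂ _+i_
    (solve 2 (λ a b → con 0ℚ := a :* con 0ℚ :+ (:- (b :* con 0ℚ))) refl (re κ) (im κ))
    (solve 2 (λ a b → con 0ℚ := a :* con 0ℚ :+ b :* con 0ℚ) refl (re κ) (im κ))
  ofℚ-Σ< κ (suc N) {f} {g} h =
    trans (cong ofℚ (Σ<-suc N f)) (trans
      (add (h 0 (s≤s z≤n)) (ofℚ-Σ< κ N (λ i i<N → h (suc i) (s≤s i<N))))
      (cong (λ q → κ *i ofℚ q) (sym (Σ<-suc N g))))
    where
    add : ∀ {p q p′ q′} → ofℚ p ≡ κ *i ofℚ p′ → ofℚ q ≡ κ *i ofℚ q′ → ofℚ (p + q) ≡ κ *i ofℚ (p′ + q′)
    add {p} {q} {p′} {q′} hp hq = cong₂ _+i_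
      (trans (cong₂ _+_ (cong re hp) (cong re hq))
        (solve 4 (λ a b p q → (a :* p :+ (:- (b :* con 0ℚ))) :+ (a :* q :+ (:- (b :* con 0ℚ))) := a :* (p :+ q) :+ (:- (b :* con 0ℚ))) refl (re κ) (im κ) p′ q′))
      (trans (sym (+-identityˡ 0ℚ)) (trans (cong₂ _+_ (cong im hp) (cong im hq))
        (solve 4 (λ a b p q → (a :* con 0ℚ :+ b :* p) :+ (a :* con 0ℚ :+ b :* q) := a :* con 0ℚ :+ b :* (p :+ q)) refl (re κ) (im κ) p′ q′)))

  -- Coefficient `i` of u(z) = c a(w z), with the rational series kept apart from the complex
  -- scalar.
  Twisted : ℚi → ℚi → Series → Series → ℕ → Set
  Twisted w c u a i = ofℚ (u i) ≡ (c *i (w ^i i)) *i ofℚ (a i)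

  -- The powers of w add up to w^n in every summand, so one scalar can be taken out. The bound `m`
  -- allows use inside a strong induction.
  twisted-⊗ : ∀ w c d u v a b m → (∀ i → i ≤ m → Twisted w c u a i) → (∀ i → i ≤ m → Twisted w d v b i) →
    ∀ i → i ≤ m → Twisted w (c *i d) (u ⊗ v) (a ⊗ b) i
  twisted-⊗ w c d u v a b m hu hv n n≤m = begin
    ofℚ ((u ⊗ v) n)
      ≡⟨ cong ofℚ (⊗-⊛ u v .at n) ⟩
    ofℚ (Σ< (suc n) (λ i → u i * v (n ∸ i)))
      ≡⟨ ofℚ-Σ< ((c *i d) *i (w ^i n)) (suc n) (λ { i (s≤s i≤n) → term i i≤n }) ⟩
    ((c *i d) *i (w ^i n)) *i ofℚ (Σ< (suc n) (λ i → a i * b (n ∸ i)))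
      ≡⟨ cong (λ q → ((c *i d) *i (w ^i n)) *i ofℚ q) (sym (⊗-⊛ a b .at n)) ⟩
    ((c *i d) *i (w ^i n)) *i ofℚ ((a ⊗ b) n) ∎
    where
    open ≡-Reasoning
    term : ∀ i → i ≤ n → ofℚ (u i * v (n ∸ i)) ≡ ((c *i d) *i (w ^i n)) *i ofℚ (a i * b (n ∸ i))
    term i i≤n = begin
      ofℚ (u i * v (n ∸ i))
        ≡⟨ ofℚ-* (u i) (v (n ∸ i)) ⟩
      ofℚ (u i) *i ofℚ (v (n ∸ i))
        ≡⟨ cong₂ _*i_ (hu i (ℕₚ.≤-trans i≤n n≤m)) (hv (n ∸ i) (ℕₚ.≤-trans (ℕₚ.m∸n≤m n i) n≤m)) ⟩
      ((c *i (w ^i i)) *i ofℚ (a i)) *i ((d *i (w ^i (n ∸ i))) *i ofℚ (b (n ∸ i)))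
        ≡⟨ *i-interchange (c *i (w ^i i)) (ofℚ (a i)) (d *i (w ^i (n ∸ i))) (ofℚ (b (n ∸ i))) ⟩
      ((c *i (w ^i i)) *i (d *i (w ^i (n ∸ i)))) *i (ofℚ (a i) *i ofℚ (b (n ∸ i)))
        ≡⟨ cong₂ _*i_ (*i-interchange c (w ^i i) d (w ^i (n ∸ i))) (sym (ofℚ-* (a i) (b (n ∸ i)))) ⟩
      ((c *i d) *i ((w ^i i) *i (w ^i (n ∸ i)))) *i ofℚ (a i * b (n ∸ i))
        ≡⟨ cong (λ z → ((c *i d) *i z) *i ofℚ (a i * b (n ∸ i))) (trans (sym (^i-+ w i (n ∸ i))) (cong (w ^i_) (ℕₚ.m+[n∸m]≡n i≤n))) ⟩
      ((c *i d) *i (w ^i n)) *i ofℚ (a i * b (n ∸ i)) ∎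

  c w : ℚi
  c = 1ℚ +i (- 1ℚ)
  w = ½ +i ½

  module _ (a : Series) (isSl : IsSl a) where

    open Lemniscate a isSl using (a0; a1; sl-rec)

    -- Strong induction: in both second-order equations, coefficient m+2 is fixed by the cube's
    -- coefficient `m`, which depends on degrees up to `m` only.
    y-sl : ∀ m → Twisted w c y a m
    y-sl = <-rec (Twisted w c y a) step
      where
      open ≡-Reasoning
      step : ∀ m → (∀ {i} → i < m → Twisted w c y a i) → Twisted w c y a m
      -- Both series start at 0; in degree one T_1 = 1 = sl'(0), and c w = 1.
      step 0 ih = cong (λ q → (c *i (w ^i 0)) *i ofℚ q) (sym a0)
      step 1 ih = trans (cong ofℚ (t-at 0)) (cong (λ q → (c *i (w ^i 1)) *i ofℚ q) (sym a1))
      step (suc (suc m)) ih = begin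
        ofℚ (y (2 ℕ.+ m))
          ≡⟨ ofℚ-cancel (c³ *i (w ^i m)) s (begin
               ofℚ (fromℕ s * y (2 ℕ.+ m))
                 ≡⟨ cong ofℚ (trans (cong (_* y (2 ℕ.+ m)) s-ℚ) (trans
                      (solve 4 (λ a b c d → a :* (b :* c) :* d := a :* (b :* (c :* d))) refl (fromℕ 2) (fromℕ (2 ℕ.+ m)) (fromℕ (suc m)) (y (2 ℕ.+ m)))
                      (y-rec m))) ⟩
               ofℚ ((y ⊗ (y ⊗ y)) m)
                 ≡⟨ twisted-⊗ w c (c *i c) y (y ⊗ y) a (a ⊗ a) m below (twisted-⊗ w c c y y a a m below below) m ℕₚ.≤-refl ⟩
               (c³ *i (w ^i m)) *i ofℚ ((a ⊗ (a ⊗ a)) m)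
                 ≡⟨ cong (λ q → (c³ *i (w ^i m)) *i ofℚ q) a³ ⟩
               (c³ *i (w ^i m)) *i ofℚ (fromℕ s * (-¼ * a (2 ℕ.+ m))) ∎) ⟩
        (c³ *i (w ^i m)) *i ofℚ (-¼ * a (2 ℕ.+ m))
          ≡⟨ cong ((c³ *i (w ^i m)) *i_) (ofℚ-* -¼ (a (2 ℕ.+ m))) ⟩
        (c³ *i (w ^i m)) *i (ofℚ -¼ *i ofℚ (a (2 ℕ.+ m)))
          ≡⟨ sym (*i-assoc (c³ *i (w ^i m)) (ofℚ -¼) _) ⟩
        ((c³ *i (w ^i m)) *i ofℚ -¼) *i ofℚ (a (2 ℕ.+ m))
          ≡⟨ cong (_*i ofℚ (a (2 ℕ.+ m))) (trans (*i-assoc c³ (w ^i m) (ofℚ -¼)) (trans (cong (c³ *i_) (*i-comm (w ^i m) (ofℚ -¼))) (sym (*i-assoc c³ (ofℚ -¼) (w ^i m))))) ⟩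
        ((c³ *i ofℚ -¼) *i (w ^i m)) *i ofℚ (a (2 ℕ.+ m))
          -- Closed arithmetic, settled by evaluation: -c³/4 = (1+i)/2 = c w².
          ≡⟨⟩
        ((c *i (w *i w)) *i (w ^i m)) *i ofℚ (a (2 ℕ.+ m))
          ≡⟨ cong (_*i ofℚ (a (2 ℕ.+ m))) (trans (*i-assoc c (w *i w) (w ^i m)) (cong (c *i_) (*i-assoc w w (w ^i m)))) ⟩
        (c *i (w ^i (2 ℕ.+ m))) *i ofℚ (a (2 ℕ.+ m)) ∎
        where
        c³ = c *i (c *i c)
        -- The sign and one half come from sl'' = -2 sl³ solved for sl³, the other half from Y'' =
        -- Y³/2.
        -¼ = - (½ * ½)
        s = 2 ℕ.* ((2 ℕ.+ m) ℕ.* suc m)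
        s-ℚ : fromℕ s ≡ fromℕ 2 * (fromℕ (2 ℕ.+ m) * fromℕ (suc m))
        s-ℚ = trans (fromℕ-* 2 ((2 ℕ.+ m) ℕ.* suc m)) (cong (fromℕ 2 *_) (fromℕ-* (2 ℕ.+ m) (suc m)))
        below : ∀ i → i ≤ m → Twisted w c y a i
        below i i≤m = ih (s≤s (ℕₚ.m≤n⇒m≤1+n i≤m))
        a³ : (a ⊗ (a ⊗ a)) m ≡ fromℕ s * (-¼ * a (2 ℕ.+ m))
        a³ = begin
          x
            ≡⟨ solve 2 (λ x e → x := con ½ :* (e :+ con (fromℕ 2) :* x) :+ con (- ½) :* e) refl x e ⟩
          ½ * (e + fromℕ 2 * x) + (- ½) * e
            ≡⟨ cong (λ z → ½ * z + (- ½) * e) (sl-rec m) ⟩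
          ½ * 0ℚ + (- ½) * e
            ≡⟨ solve 3 (λ p q r → con ½ :* con 0ℚ :+ con (- ½) :* (p :* (q :* r)) := con (fromℕ 2) :* (q :* p) :* (con -¼ :* r)) refl (fromℕ (suc m)) (fromℕ (2 ℕ.+ m)) (a (2 ℕ.+ m)) ⟩
          fromℕ 2 * (fromℕ (2 ℕ.+ m) * fromℕ (suc m)) * (-¼ * a (2 ℕ.+ m))
            ≡⟨ cong (_* (-¼ * a (2 ℕ.+ m))) (sym s-ℚ) ⟩
          fromℕ s * (-¼ * a (2 ℕ.+ m)) ∎
          where
          x = (a ⊗ (a ⊗ a)) m
          e = fromℕ (suc m) * (fromℕ (2 ℕ.+ m) * a (2 ℕ.+ m))

    T′-sl : ∀ m → ofℚ (T′coeff m) ≡ rhsCoeff a m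
    T′-sl m = trans (cong ofℚ (T′coeff-y .at m)) (trans (y-sl m) (*i-assoc c (w ^i m) (ofℚ (a m))))

    -- From c w = 1 and w² = i/2.
    c-w-odd : ∀ k → c *i (w ^i (suc (dbl k))) ≡ (0ℚ +i ½) ^i k
    c-w-odd zero = refl
    c-w-odd (suc k) = begin
      c *i (w *i (w *i v))         ≡⟨ cong (c *i_) (sym (*i-assoc w w v)) ⟩
      c *i ((w *i w) *i v)         ≡⟨ sym (*i-assoc c (w *i w) v) ⟩
      (c *i (w *i w)) *i v         ≡⟨ cong (_*i v) (*i-comm c (w *i w)) ⟩
      ((w *i w) *i c) *i v         ≡⟨ *i-assoc (w *i w) c v ⟩
      (0ℚ +i ½) *i (c *i v)        ≡⟨ cong ((0ℚ +i ½) *i_) (c-w-odd k) ⟩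
      (0ℚ +i ½) ^i suc k           ∎
      where
      open ≡-Reasoning
      v = w ^i (suc (dbl k))

    Tn-sl : ∀ k → ofℚ (Tn (suc k)) ≡ ((0ℚ +i ½) ^i k) *i ofℚ (Sn a (2 ℕ.* k ℕ.+ 1))
    Tn-sl k = begin
      ofℚ (Tn (suc k))
        ≡⟨ cong ofℚ (sym (trans (cong (fromℕ (n !) *_) (y-odd k))
             (trans (solve 3 (λ f x i → f :* (x :* i) := x :* (i :* f)) refl (fromℕ (n !)) (Tn (suc k)) (inv! n))
               (trans (cong (Tn (suc k) *_) (inv!-! n)) (*-identityʳ _))))) ⟩
      ofℚ (fromℕ (n !) * y n)
        ≡⟨ ofℚ-* (fromℕ (n !)) (y n) ⟩
      ofℚ (fromℕ (n !)) *i ofℚ (y n)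
        ≡⟨ cong (ofℚ (fromℕ (n !)) *i_) (trans (y-sl n) (cong (_*i ofℚ (a n)) (c-w-odd k))) ⟩
      ofℚ (fromℕ (n !)) *i (((0ℚ +i ½) ^i k) *i ofℚ (a n))
        ≡⟨ ofℚ-scale (fromℕ (n !)) ((0ℚ +i ½) ^i k) (a n) ⟩
      ((0ℚ +i ½) ^i k) *i ofℚ (Sn a n)
        ≡⟨ cong (λ j → ((0ℚ +i ½) ^i k) *i ofℚ (Sn a j)) (trans (cong suc (dbl-2* k)) (ℕₚ.+-comm 1 (2 ℕ.* k))) ⟩
      ((0ℚ +i ½) ^i k) *i ofℚ (Sn a (2 ℕ.* k ℕ.+ 1)) ∎
      where
      open ≡-Reasoning
      n = suc (dbl k)

  sumTriples-suc : ∀ m (h : ℕ × ℕ × ℕ → ℚ) →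
    sumL (map h (triples (suc m))) ≡ Σ< (suc m) (λ j → Σ< (suc (m ∸ j)) (λ k → h (j , k , m ∸ j ∸ k)))
  sumTriples-suc m h = begin
    sumL (map h (triples (suc m)))
      ≡⟨ sumL-map (triples (suc m)) ⟩
    sumOver h (triples (suc m))
      ≡⟨ sumOver-concatMap h (λ j → map (λ k → (j , k , m ∸ j ∸ k)) (upTo (suc (m ∸ j)))) (upTo (suc m)) ⟩
    Σ< (suc m) (λ j → sumOver h (map (λ k → (j , k , m ∸ j ∸ k)) (upTo (suc (m ∸ j)))))
      ≡⟨ Σ<-cong (suc m) (λ j _ → sumOver-map h (λ k → (j , k , m ∸ j ∸ k)) (upTo (suc (m ∸ j)))) ⟩
    Σ< (suc m) (λ j → Σ< (suc (m ∸ j)) (λ k → h (j , k , m ∸ j ∸ k))) ∎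
    where
    open ≡-Reasoning
    sumL-map : ∀ xs → sumL (map h xs) ≡ sumOver h xs
    sumL-map [] = refl
    sumL-map (x ∷ xs) = cong (h x +_) (sumL-map xs)

  -- Triples with sum n-1 index the coefficient n-1 of t³; the shift `X` supplies the empty sum at n
  -- = 0.
  sumTriples-X : ∀ n s (h : ℕ × ℕ × ℕ → ℚ) → (∀ j k l → h (j , k , l) ≡ s * (t j * (t k * t l))) →
    sumL (map h (triples n)) ≡ s * X (t ⊗ (t ⊗ t)) n
  sumTriples-X zero s h e = sym (*-zeroʳ s)
  sumTriples-X (suc m) s h e = begin
    sumL (map h (triples (suc m)))
      ≡⟨ sumTriples-suc m h ⟩
    Σ< (suc m) (λ j → Σ< (suc (m ∸ j)) (λ k → h (j , k , m ∸ j ∸ k)))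
      ≡⟨ Σ<-cong (suc m) (λ j _ → inner j) ⟩
    Σ< (suc m) (λ j → s * (t j * (t ⊗ t) (m ∸ j)))
      ≡⟨ sym (Σ<-* (suc m) s (λ j → t j * (t ⊗ t) (m ∸ j))) ⟩
    s * Σ< (suc m) (λ j → t j * (t ⊗ t) (m ∸ j))
      ≡⟨ cong (s *_) (sym (⊗-⊛ t (t ⊗ t) .at m)) ⟩
    s * (t ⊗ (t ⊗ t)) m ∎
    where
    open ≡-Reasoning
    inner : ∀ j → Σ< (suc (m ∸ j)) (λ k → h (j , k , m ∸ j ∸ k)) ≡ s * (t j * (t ⊗ t) (m ∸ j))
    inner j = begin
      Σ< (suc (m ∸ j)) (λ k → h (j , k , m ∸ j ∸ k))
        ≡⟨ Σ<-cong (suc (m ∸ j)) (λ k _ → trans (e j k (m ∸ j ∸ k)) (sym (*-assoc s (t j) _))) ⟩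
      Σ< (suc (m ∸ j)) (λ k → s * t j * (t k * t (m ∸ j ∸ k)))
        ≡⟨ sym (Σ<-* (suc (m ∸ j)) (s * t j) (λ k → t k * t (m ∸ j ∸ k))) ⟩
      s * t j * Σ< (suc (m ∸ j)) (λ k → t k * t (m ∸ j ∸ k))
        ≡⟨ cong (s * t j *_) (sym (⊗-⊛ t t .at (m ∸ j))) ⟩
      s * t j * (t ⊗ t) (m ∸ j)
        ≡⟨ *-assoc s (t j) _ ⟩
      s * (t j * (t ⊗ t) (m ∸ j)) ∎

  Tn-rec : ∀ n → Tn (n ℕ.+ 2) ≡ ½ * sumTriples n (λ j k l → multinom n j k l * Tn (suc j) * Tn (suc k) * Tn (suc l))
  Tn-rec n = begin
    Tn (n ℕ.+ 2)
      ≡⟨ cong Tn (ℕₚ.+-comm n 2) ⟩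
    Tn (2 ℕ.+ n)
      ≡⟨ sym (*-identityʳ _) ⟩
    Tn (2 ℕ.+ n) * 1ℚ
      ≡⟨ cong (Tn (2 ℕ.+ n) *_) (sym (inv!-! (3 ℕ.+ 2 ℕ.* n))) ⟩
    Tn (2 ℕ.+ n) * (inv! (3 ℕ.+ 2 ℕ.* n) * fromℕ ((3 ℕ.+ 2 ℕ.* n) !))
      ≡⟨ cong (λ u → Tn (2 ℕ.+ n) * (inv! (3 ℕ.+ 2 ℕ.* n) * u)) (trans (fromℕ-* (3 ℕ.+ 2 ℕ.* n) ((2 ℕ.+ 2 ℕ.* n) !)) (cong (A *_) (fromℕ-* (2 ℕ.+ 2 ℕ.* n) (suc (2 ℕ.* n) !)))) ⟩
    Tn (2 ℕ.+ n) * (inv! (3 ℕ.+ 2 ℕ.* n) * (A * (B * M)))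
      -- With (2n+3)! written as A B M, where M = (2n+1)!, this regrouping exposes the left side of
      -- `t-rec`.
      ≡⟨ solve 5 (λ x i a b m → x :* (i :* (a :* (b :* m))) := con ½ :* (m :* (con (fromℕ 2) :* (a :* (b :* (x :* i)))))) refl
           (Tn (2 ℕ.+ n)) (inv! (3 ℕ.+ 2 ℕ.* n)) A B M ⟩
    ½ * (M * (fromℕ 2 * (A * (B * (Tn (2 ℕ.+ n) * inv! (3 ℕ.+ 2 ℕ.* n))))))
      ≡⟨ cong (λ u → ½ * (M * (fromℕ 2 * (A * (B * u))))) (sym (trans (t-at (suc n)) (cong (λ k → Tn (2 ℕ.+ n) * inv! (suc k)) (ℕₚ.*-suc 2 n)))) ⟩
    ½ * (M * (fromℕ 2 * (A * (B * t (suc n)))))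
      ≡⟨ cong (λ u → ½ * (M * u)) (t-rec n) ⟩
    ½ * (M * X (t ⊗ (t ⊗ t)) n)
      ≡⟨ cong (½ *_) (sym (sumTriples-X n M _ term)) ⟩
    ½ * sumTriples n (λ j k l → multinom n j k l * Tn (suc j) * Tn (suc k) * Tn (suc l)) ∎
    where
    open ≡-Reasoning
    A = fromℕ (3 ℕ.+ 2 ℕ.* n)
    B = fromℕ (2 ℕ.+ 2 ℕ.* n)
    M = fromℕ (suc (2 ℕ.* n) !)
    term : ∀ j k l → multinom n j k l * Tn (suc j) * Tn (suc k) * Tn (suc l) ≡ M * (t j * (t k * t l))
    term j k l = begin
      fromℕ ((2 ℕ.* n ℕ.+ 1) !) * inv! (2 ℕ.* j ℕ.+ 1) * inv! (2 ℕ.* k ℕ.+ 1) * inv! (2 ℕ.* l ℕ.+ 1) * Tn (suc j) * Tn (suc k) * Tn (suc l)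
        ≡⟨ solve 7 (λ m p q r x y z → m :* p :* q :* r :* x :* y :* z := m :* ((x :* p) :* ((y :* q) :* (z :* r)))) refl
             (fromℕ ((2 ℕ.* n ℕ.+ 1) !)) (inv! (2 ℕ.* j ℕ.+ 1)) (inv! (2 ℕ.* k ℕ.+ 1)) (inv! (2 ℕ.* l ℕ.+ 1)) (Tn (suc j)) (Tn (suc k)) (Tn (suc l)) ⟩
      fromℕ ((2 ℕ.* n ℕ.+ 1) !) * (u j * (u k * u l))
        ≡⟨ cong₂ _*_ (cong (λ i → fromℕ (i !)) (ℕₚ.+-comm (2 ℕ.* n) 1)) (cong₂ _*_ (u-t j) (cong₂ _*_ (u-t k) (u-t l))) ⟩
      M * (t j * (t k * t l)) ∎
      where
      u : ℕ → ℚ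
      u i = Tn (suc i) * inv! (2 ℕ.* i ℕ.+ 1)
      u-t : ∀ i → u i ≡ t i
      u-t i = trans (cong (λ d → Tn (suc i) * inv! d) (ℕₚ.+-comm (2 ℕ.* i) 1)) (sym (t-at i))

open Comparison using (T′-sl; Tn-sl; Tn-rec)
open import Data.Nat using (ℕ; suc; _+_; _*_)
open import Data.Rational using (0ℚ; 1ℚ; ½) renaming (_*_ to _*q_)
open import Data.Product using (_×_; _,_)
open import Relation.Binary.PropositionalEquality using (_≡_; refl)

theorem4p3 : (a : Series) → IsSl a →
    ((m : ℕ) → ofℚ (T′coeff m) ≡ rhsCoeff a m)
    × ((k : ℕ) → ofℚ (Tn (suc k)) ≡ ((0ℚ +i ½) ^i k) *i ofℚ (Sn a (2 * k + 1)))
    × ((n : ℕ) → Tn (n + 2) ≡ ½ *q sumTriples n (λ j k l →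
    multinom n j k l *q Tn (suc j) *q Tn (suc k) *q Tn (suc l)))
    × (Tn 1 ≡ 1ℚ)
theorem4p3 a isSl = T′-sl a isSl , Tn-sl a isSl , Tn-rec , refl
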